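{- Let $\varepsilon_0$ denote the infimum of all $\varepsilon>0$ having the finite rotation property. Then $\varepsilon_0\le\frac15$.
   Context: For real $x$, $\|x\|$ denotes the distance from $x$ to the nearest integer. For $\varepsilon>0$, $E_{\varepsilon}=\{(x,y)\in\mathbb{R}^2:\|x\|\le\varepsilon\}$. $R_{\theta}$ denotes the counterclockwise rotation of the plane $\mathbb{R}^2$ by angle $\theta$ around the origin. A real number $\varepsilon>0$ has the finite rotation property if there exist finitely many angles $\theta_0,\dots,\theta_n$ such that $\mathbb{R}^2=\bigcup_{j=0}^{n}R_{\theta_j}E_{\varepsilon}$. -}

module Defs where

open import Algebra.Bundles using (CommutativeRing)
open import Algebra.Core using (Op₁; Op₂)
open import Algebra.Structures using (IsCommutativeRing)
open import Data.Fin.Base using (Fin; toℕ)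
open import Data.Integer.Base using (ℤ; +_; -[1+_])
open import Data.Nat.Base as ℕ using (ℕ; suc; _!)
open import Data.Product using (_×_; _,_; ∃; ∃-syntax; Σ-syntax)
open import Level using (0ℓ) renaming (suc to lsuc)
open import Relation.Binary.Bundles using (TotalOrder)
open import Relation.Binary.Core using (Rel)
open import Relation.Binary.Structures using (IsTotalOrder)
open import Relation.Nullary using (¬_)
open import Relation.Unary using (Pred; _∈_)

import Algebra.Construct.NaturalChoice.Max as Max
import Algebra.Properties.Semiring.Exp as Exp
import Algebra.Properties.Semiring.Mult as Mult
import Algebra.Properties.Semiring.Sum as Sum
import Relation.Binary.Construct.NonStrictToStrict as Strict

IsUpperBound : {A : Set} → Rel A 0ℓ → Pred A 0ℓ → Pred A 0ℓ
IsUpperBound _≤_ P b = ∀ x → x ∈ P → x ≤ b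

IsLowerBound : {A : Set} → Rel A 0ℓ → Pred A 0ℓ → Pred A 0ℓ
IsLowerBound _≤_ P b = ∀ x → x ∈ P → b ≤ x

IsSupremum : {A : Set} → Rel A 0ℓ → Pred A 0ℓ → Pred A 0ℓ
IsSupremum _≤_ P s = IsUpperBound _≤_ P s × (∀ b → IsUpperBound _≤_ P b → s ≤ b)

IsInfimum : {A : Set} → Rel A 0ℓ → Pred A 0ℓ → Pred A 0ℓ
IsInfimum _≤_ P m = IsLowerBound _≤_ P m × (∀ b → IsLowerBound _≤_ P b → b ≤ m)

-- The usual axioms for the real numbers: a Dedekind-complete totally ordered
-- field.  Classically these determine ℝ up to unique isomorphism.

record RealNumbers : Set (lsuc 0ℓ) where
  infix  4 _≈_ _≤_
  infixl 6 _+_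
  infixl 7 _*_
  infix  8 -_ _⁻¹
  field
    Carrier           : Set
    _≈_               : Rel Carrier 0ℓ
    _≤_               : Rel Carrier 0ℓ
    _+_ _*_           : Op₂ Carrier
    -_                : Op₁ Carrier
    0# 1#             : Carrier
    _⁻¹               : Op₁ Carrier
    isCommutativeRing : IsCommutativeRing _≈_ _+_ _*_ -_ 0# 1#
    isTotalOrder      : IsTotalOrder _≈_ _≤_

    0≉1               : ¬ 0# ≈ 1#
    -- As a total operation, _⁻¹ takes an unspecified value at 0#.
    ⁻¹-cong           : ∀ {x y} → x ≈ y → x ⁻¹ ≈ y ⁻¹
    ⁻¹-inverseʳ       : ∀ x → ¬ x ≈ 0# → x * x ⁻¹ ≈ 1#

    +-monoˡ-≤         : ∀ z {x y} → x ≤ y → x + z ≤ y + z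
    *-nonNegative     : ∀ {x y} → 0# ≤ x → 0# ≤ y → 0# ≤ x * y

    complete          : (P : Pred Carrier 0ℓ) → ∃ P → ∃ (IsUpperBound _≤_ P) →
                        ∃ (IsSupremum _≤_ P)

  commutativeRing : CommutativeRing 0ℓ 0ℓ
  commutativeRing = record { isCommutativeRing = isCommutativeRing }

  totalOrder : TotalOrder 0ℓ 0ℓ 0ℓ
  totalOrder = record { isTotalOrder = isTotalOrder }

  open CommutativeRing commutativeRing public
    using (_-_; semiring)
  open Strict _≈_ _≤_ public using (_<_)
  open Max totalOrder public using (_⊔_)
  open Exp semiring public using (_^_)
  open Mult semiring public using () renaming (_×_ to _·_)
  open Sum semiring public using (sum)

module Rotations (ℝ : RealNumbers) where
  open RealNumbers ℝ

  fromℕ : ℕ → Carrier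
  fromℕ n = n · 1#

  fromℤ : ℤ → Carrier
  fromℤ (+ n)    = fromℕ n
  fromℤ -[1+ n ] = - fromℕ (suc n)

  ∣_∣ : Op₁ Carrier
  ∣ x ∣ = x ⊔ (- x)

  _⟶_ : (ℕ → Carrier) → Carrier → Set
  a ⟶ l = ∀ δ → 0# < δ → ∃[ N ] (∀ n → N ℕ.≤ n → ∣ a n - l ∣ < δ)

  -- Sine and cosine are given by their power series; being limits, they
  -- appear as relations between the angle and the value.

  cosSum : Carrier → ℕ → Carrier
  cosSum θ n = sum {n} λ i → let k = toℕ i in
    (- 1#) ^ k * (θ ^ (2 ℕ.* k) * fromℕ ((2 ℕ.* k) !) ⁻¹)

  sinSum : Carrier → ℕ → Carrier
  sinSum θ n = sum {n} λ i → let k = toℕ i in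
    (- 1#) ^ k * (θ ^ (1 ℕ.+ 2 ℕ.* k) * fromℕ ((1 ℕ.+ 2 ℕ.* k) !) ⁻¹)

  IsCos : Carrier → Carrier → Set
  IsCos θ c = cosSum θ ⟶ c

  IsSin : Carrier → Carrier → Set
  IsSin θ s = sinSum θ ⟶ s

  ℝ² : Set
  ℝ² = Carrier × Carrier

  _≈²_ : Rel ℝ² 0ℓ
  (x , y) ≈² (x′ , y′) = (x ≈ x′) × (y ≈ y′)

  -- IsRotation θ p q says that q = R_θ p.

  IsRotation : Carrier → ℝ² → ℝ² → Set
  IsRotation θ (x , y) q =
    ∃[ c ] ∃[ s ] (IsCos θ c × IsSin θ s × (q ≈² (c * x - s * y , s * x + c * y)))

  R[_] : Carrier → Pred ℝ² 0ℓ → Pred ℝ² 0ℓ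
  R[ θ ] A q = ∃[ p ] (p ∈ A × IsRotation θ p q)

  -- IsDistanceToℤ x d says that d = ‖x‖.

  IsDistanceToℤ : Carrier → Carrier → Set
  IsDistanceToℤ x d =
    ∃[ n ] ((d ≈ ∣ x - fromℤ n ∣) × (∀ m → d ≤ ∣ x - fromℤ m ∣))

  E : Carrier → Pred ℝ² 0ℓ
  E ε (x , y) = ∃[ d ] (IsDistanceToℤ x d × d ≤ ε)

  FiniteRotationProperty : Pred Carrier 0ℓ
  FiniteRotationProperty ε =
    (0# < ε) ×
    (∃[ n ] Σ[ θ ∈ (Fin (suc n) → Carrier) ]
      (∀ (q : ℝ²) → ∃[ j ] (q ∈ R[ θ j ] (E ε))))

-- The value 1/5 itself has the finite rotation property.  For a point q let x(u) be the inner product of q with a unit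
-- vector u, and suppose that x(u) stays farther than 1/5 from ℤ for all u in the finite set  ωⁱ ζᵏ ηˡ  with i, l < 3
-- and k < 15, where ω is a primitive cube root of unity and ζ, η are the unit complex numbers with
-- (ω − ω²)(ζ² − 1) + ζ = 0  and  2η² + 2 + η = 0.
-- Since 1 + ω + ω² = 0, each triple (x(u), x(ωu), x(ω²u)) is a point near (1/3, 1/3, 1/3) or (2/3, 2/3, 2/3) modulo 1,
-- and the relation for ζ determines each triple of a chain u, ζu, ζ²u, … from the preceding two up to three choices.
-- Linear programming shows that the middle triple of a chain of 15 must be close to a permutation of ±(1/2, 1/4, 1/4).
-- Three such triples, at u, ηu and η²u, cannot satisfy  2x(η²u) + 2x(u) + x(ηu) = 0  in all three rows: in the row where
-- x(ηu) is near 1/2, either the row itself or the difference of the other two is near a half-integer.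
--
-- Opposite directions give the same strips, so only the directions (cos θ, sin θ) with θ in [−2, 2] are needed.  They
-- exhaust all lines by the intermediate value theorem, once cos 0 = 1, cos 2 ≤ 0 and cos² + sin² = 1 are known; the
-- last identity holds because the left-hand side changes only quadratically in the increment of θ.

module Submission where

open import Defs
open import Axiom.ExcludedMiddle using (ExcludedMiddle)
open import Data.Product using (_×_; ∃-syntax)
open import Level using (0ℓ)

open import Algebra.Bundles using (CommutativeRing)
open import Algebra.Solver.Ring.AlmostCommutativeRing using (fromCommutativeRing; _-Raw-AlmostCommutative⟶_)
open import Data.Bool.Base using (Bool; true; false; _∧_)
open import Data.Empty using (⊥; ⊥-elim)
open import Data.Fin.Base as Fin using (Fin; zero; suc; toℕ)
import Data.Fin.Properties as Fin
open import Data.Integer.Base as ℤ using (ℤ; +_; -[1+_])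
import Data.Integer.Properties as ℤ
open import Data.List.Base using (List; []; _∷_)
open import Data.List.Relation.Unary.All using (All; []; _∷_)
open import Data.Maybe.Base using (just; nothing)
open import Data.Nat.Base as ℕ using (ℕ; zero; suc; _!)
import Data.Nat.Properties as ℕ
open import Data.Product using (_,_; ∃; proj₁; proj₂; Σ-syntax)
open import Data.Sign.Base using (Sign; opposite) renaming (+ to pos; - to neg)
open import Data.Sum using (_⊎_; inj₁; inj₂; [_,_]′)
open import Data.Unit.Base using (⊤; tt)
open import Data.Vec.Base using (Vec; []; _∷_; zipWith; map)
open import Function.Base using (_∘_)
open import Relation.Binary.Definitions using (tri<; tri≈; tri>)
open import Relation.Binary.PropositionalEquality as ≡ using (_≡_)
open import Relation.Binary.Structures using (IsTotalOrder)
open import Relation.Nullary using (¬_; yes; no)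
open import Relation.Unary using (_∈_)

-- Certificates for chains of triples

-- For unit complex numbers, ζ² - 1 = 2i Im ζ · ζ and η² + 1 = 2 Re η · η. Hence the two relations
-- only prescribe Im ζ = 1/√12 and Re η = -1/4, and their small coefficients leave few values for
-- the unknown integers in each row.
--
-- Deviations are measured in units of 1/15, which makes 1/3 and 1/5 integral. The final
-- contradiction tolerates an error of 15 in 4(a₁ - a₂) + 4(b₁ - b₂) + 2(c₁ - c₂), so it is not
-- enough that the middle triple is near its limit position: it is confined to a hexagon whose
-- half-widths 7/5 and 33/20 satisfy 4 · 7/5 + 4 · 33/20 + 2 · 7/5 = 15 exactly.
--
-- A chain has four real parameters, the free entries of two adjacent triples, and every further
-- triple multiplies the cases by six: three integer choices and two signs. Every branch ends in
-- Farkas certificates with natural multipliers, so that a leaf is an evaluation in ℤ and the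
-- optimisation that produced the multipliers need not be trusted.

record Triple (A : Set) : Set where
  constructor ⟨_,_,_⟩
  field t₀ t₁ t₂ : A

mapT : {A B : Set} → (A → B) → Triple A → Triple B
mapT f ⟨ a , b , c ⟩ = ⟨ f a , f b , f c ⟩

rotate : {A : Set} → Fin 3 → Triple A → Triple A
rotate zero             ⟨ a , b , c ⟩ = ⟨ a , b , c ⟩
rotate (suc zero)       ⟨ a , b , c ⟩ = ⟨ b , c , a ⟩
rotate (suc (suc zero)) ⟨ a , b , c ⟩ = ⟨ c , a , b ⟩

toℤ : Sign → ℤ
toℤ pos = + 1
toℤ neg = -[1+ 0 ]

-- An affine form in four variables, the constant coefficient being last.
Form : Set
Form = Vec ℤ 5

infixl 6 _⊞_ _⊟_
infixl 7 _⊡_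
_⊞_ _⊟_ : Form → Form → Form
_⊞_ = zipWith ℤ._+_
_⊟_ = zipWith ℤ._-_

_⊡_ : ℤ → Form → Form
k ⊡ u = map (k ℤ.*_) u

constantForm : ℤ → Form
constantForm k = + 0 ∷ + 0 ∷ + 0 ∷ + 0 ∷ k ∷ []

-- Solving  (ω − ω²)(c − a) + b ∈ ℤ³  for c means dividing by √−3, which leaves three solutions modulo 1.
spike : Fin 3 → Triple ℤ
spike zero             = ⟨ + 0 , + 1 , -[1+ 0 ] ⟩
spike (suc zero)       = ⟨ -[1+ 0 ] , + 0 , + 1 ⟩
spike (suc (suc zero)) = ⟨ + 1 , -[1+ 0 ] , + 0 ⟩

-- A positive combination of hypotheses: a hypothesis i at n enters with coefficient n + 1.
infixr 5 _at_&_
data Combination : Set where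
  []     : Combination
  _at_&_ : ℕ → ℕ → Combination → Combination

-- n ⊢ c also uses the denied inequality, with coefficient n.
infix 4 _⊢_
data Refutation : Set where
  _⊢_ : ℕ → Combination → Refutation

-- An inner node adds one triple at one end of the chain and branches over the spike of the step and
-- the sign of the new triple; the end is chosen branch by branch. In `conclusion h` the index names
-- the entry near a half, and each of the six refutations denies one side of the hexagon.
data Tree : Set where
  refuted : Combination → Tree
  conclusion    : Fin 3 → (_ _ _ _ _ _ : Refutation) → Tree
  rightwards    : (Fin 3 → Sign → Tree) → Tree
  leftwards     : (Fin 3 → Sign → Tree) → Tree

branches : {A : Set} (_ _ _ _ _ _ : A) → Fin 3 → Sign → A
branches a b c d e f zero             pos = a
branches a b c d e f zero             neg = b
branches a b c d e f (suc zero)       pos = c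
branches a b c d e f (suc zero)       neg = d
branches a b c d e f (suc (suc zero)) pos = e
branches a b c d e f (suc (suc zero)) neg = f

right left : (_ _ _ _ _ _ : Tree) → Tree
right a b c d e f = rightwards (branches a b c d e f)
left a b c d e f = leftwards (branches a b c d e f)

every : (Fin 3 → Sign → Bool) → Bool
every p = p zero pos ∧ (p zero neg ∧ (p (suc zero) pos ∧ (p (suc zero) neg ∧ (p (suc (suc zero)) pos ∧ p (suc (suc zero)) neg))))

-- An index out of range yields the constant form 1, which is positive as well, so that lookups need
-- no bounds.
hypothesis : List Form → ℕ → Form
hypothesis []       _       = constantForm (+ 1)
hypothesis (u ∷ us) zero    = u
hypothesis (u ∷ us) (suc n) = hypothesis us n

combine : List Form → Combination → Form
combine us []            = constantForm (+ 0)
combine us (i at n & c) = + suc n ⊡ hypothesis us i ⊞ combine us c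

isNonPositive : ℤ → Bool
isNonPositive (+ 0)    = true
isNonPositive (+ suc _) = false
isNonPositive -[1+ _ ] = true

isZero : ℤ → Bool
isZero (+ 0) = true
isZero _     = false

isNonPositiveConstant : Form → Bool
isNonPositiveConstant (a ∷ b ∷ c ∷ d ∷ e ∷ []) = isZero a ∧ (isZero b ∧ (isZero c ∧ (isZero d ∧ isNonPositive e)))

-- A Farkas certificate: the combination collapses to a constant that is at most 0, although it is
-- positive as soon as the denied form is nonnegative. Strictness comes from the hypotheses, hence
-- the empty combination is rejected.
refutes : List Form → Form → Refutation → Bool
refutes us u (k ⊢ [])              = false
refutes us u (k ⊢ c@(i at n & _)) = isNonPositiveConstant (+ k ⊡ u ⊞ combine us c)

-- One end of the chain: its last two triples over a common denominator, with `sign` belonging to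
-- `current`. Each step divides by 3, so numerators and denominator are kept apart to stay in ℤ.
record Side : Set where
  constructor side
  field
    denominator   : ℕ
    previous      : Triple Form
    sign          : Sign
    current       : Triple Form

-- The recurrence multiplied by 3 and by the denominator. Leftwards the roles of first and third
-- triple are exchanged, which only changes the outer sign.
next : Sign → Fin 3 → Side → Triple Form
next dir j (side D ⟨ a₀ , a₁ , a₂ ⟩ σ ⟨ b₀ , b₁ , b₂ ⟩) =
  ⟨ new a₀ b₁ b₂ (Triple.t₀ (spike j)) , new a₁ b₂ b₀ (Triple.t₁ (spike j)) , new a₂ b₀ b₁ (Triple.t₂ (spike j)) ⟩
  where
  new : Form → Form → Form → ℤ → Form
  new a b b′ k = + 3 ⊡ a ⊞ toℤ dir ⊡ (constantForm (+ 15 ℤ.* + D ℤ.* (toℤ σ ℤ.* k)) ⊟ (b′ ⊟ b))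

extend : Sign → Fin 3 → Sign → Side → Side
extend dir j σ s@(side D _ _ b) = side (3 ℕ.* D) (mapT (+ 3 ⊡_) b) σ (next dir j s)

-- The condition of being farther than 1/5 from ℤ; the 2 is 15 (1/3 - 1/5), scaled by the
-- denominator.
positivity : ℕ → Sign → Form → Form
positivity D σ u = toℤ σ ⊡ u ⊞ constantForm (+ 2 ℤ.* + D)

positivities : ℕ → Sign → Triple Form → List Form → List Form
positivities D σ ⟨ u , v , w ⟩ us = positivity D σ u ∷ positivity D σ v ∷ positivity D σ w ∷ us

e₀ e₁ e₂ e₃ : Form
e₀ = + 1 ∷ + 0 ∷ + 0 ∷ + 0 ∷ + 0 ∷ []
e₁ = + 0 ∷ + 1 ∷ + 0 ∷ + 0 ∷ + 0 ∷ []
e₂ = + 0 ∷ + 0 ∷ + 1 ∷ + 0 ∷ + 0 ∷ []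
e₃ = + 0 ∷ + 0 ∷ + 0 ∷ + 1 ∷ + 0 ∷ []

-- Two adjacent triples generate the chain in both directions. Their third entries are eliminated
-- because each triple sums to zero.
centre neighbour : Triple Form
centre    = ⟨ e₀ , e₁ , -[1+ 0 ] ⊡ (e₀ ⊞ e₁) ⟩
neighbour = ⟨ e₂ , e₃ , -[1+ 0 ] ⊡ (e₂ ⊞ e₃) ⟩

-- Nonnegative exactly when the inequality  k (u − v) σ < c  fails.
failure : Sign → Form → Form → ℕ → ℤ → Form
failure σ u v k c = + k ⊡ (toℤ σ ⊡ (u ⊟ v)) ⊟ constantForm c

module _ (σ₀ : Sign) where

  concludes : List Form → Triple Form → (_ _ _ _ _ _ : Refutation) → Bool
  concludes us ⟨ x , y , z ⟩ c₁ c₂ c₃ c₄ c₅ c₆ =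
    refutes us (failure σ₀ x y 5 (+ 27)) c₁ ∧ (refutes us (failure σ₀ y x 10 (ℤ.- + 21)) c₂ ∧
    (refutes us (failure σ₀ x z 5 (+ 27)) c₃ ∧ (refutes us (failure σ₀ z x 10 (ℤ.- + 21)) c₄ ∧
    (refutes us (failure σ₀ y z 5 (+ 7)) c₅ ∧ refutes us (failure σ₀ z y 5 (+ 7)) c₆))))

  -- The two numbers count the triples still available on the right and on the left; a tree that
  -- asks for more is rejected.
  check : ℕ → ℕ → Side → Side → List Form → Tree → Bool
  check m n r l us (refuted c) = refutes us (constantForm (+ 0)) (0 ⊢ c)
  check m n r l us (conclusion h c₁ c₂ c₃ c₄ c₅ c₆) = concludes us (rotate h centre) c₁ c₂ c₃ c₄ c₅ c₆
  check zero n r l us (rightwards _) = false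
  check (suc m) n r l us (rightwards t) = every λ j σ → let r′ = extend pos j σ r in
    check m n r′ l (positivities (Side.denominator r′) σ (Side.current r′) us) (t j σ)
  check m zero r l us (leftwards _) = false
  check m (suc n) r l us (leftwards t) = every λ j σ → let l′ = extend neg j σ l in
    check m n r l′ (positivities (Side.denominator l′) σ (Side.current l′) us) (t j σ)

-- Hypotheses come in blocks of three, one block per triple, so a cyclic shift of the entries
-- permutes each block and keeps the multipliers.
rotateIndex : ℕ → ℕ
rotateIndex 0 = 1
rotateIndex 1 = 2
rotateIndex 2 = 0
rotateIndex (suc (suc (suc i))) = 3 ℕ.+ rotateIndex i

rotateCombination : Combination → Combination
rotateCombination [] = []
rotateCombination (i at n & c) = rotateIndex i at n & rotateCombination c

rotateRefutation : Refutation → Refutation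
rotateRefutation (k ⊢ c) = k ⊢ rotateCombination c

rotateFin : Fin 3 → Fin 3
rotateFin zero             = suc zero
rotateFin (suc zero)       = suc (suc zero)
rotateFin (suc (suc zero)) = zero

unrotateFin : Fin 3 → Fin 3
unrotateFin j = rotateFin (rotateFin j)

-- Shifting the entries by one place carries each spike to the next one. The subtree for `j` is
-- therefore the image of the subtree for the index before `j`.
rotateTree : Tree → Tree
rotateTree (refuted c) = refuted (rotateCombination c)
rotateTree (conclusion h c₁ c₂ c₃ c₄ c₅ c₆) = conclusion (rotateFin h)
  (rotateRefutation c₁) (rotateRefutation c₂) (rotateRefutation c₃) (rotateRefutation c₄) (rotateRefutation c₅) (rotateRefutation c₆)
rotateTree (rightwards t) = rightwards λ j σ → rotateTree (t (unrotateFin j) σ)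
rotateTree (leftwards t)  = leftwards λ j σ → rotateTree (t (unrotateFin j) σ)

-- Negating all deviations and all signs preserves every inequality of the problem, so the
-- multipliers stay valid and only the sign labels of the branches are exchanged.
negateTree : Tree → Tree
negateTree (rightwards t) = rightwards λ j σ → negateTree (t j (opposite σ))
negateTree (leftwards t)  = leftwards λ j σ → negateTree (t j (opposite σ))
negateTree t = t

orbit : Tree → Tree → Fin 3 → Sign → Tree
orbit a b = branches a b (rotateTree a) (rotateTree b) (rotateTree (rotateTree a)) (rotateTree (rotateTree b))

orbitRight : Tree → Tree → Tree
orbitRight a b = rightwards (orbit a b)

-- The multipliers were found by linear programming; by symmetry only the first branch at the root is recorded.
tree⁺ : Tree
tree⁺ = orbitRight
  (right (refuted (2 at 0 & 5 at 0 & 7 at 6 & 6 at 4 & 10 at 5 & []))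
  (refuted (1 at 6 & 0 at 1 & 5 at 11 & 7 at 53 & 10 at 26 & []))
  (right (refuted (2 at 0 & 0 at 0 & 11 at 29 & 10 at 14 & 13 at 17 & []))
  (refuted (1 at 0 & 11 at 29 & 10 at 14 & 13 at 17 & []))
  (refuted (0 at 7 & 3 at 2 & 8 at 50 & 11 at 188 & 13 at 134 & []))
  (refuted (2 at 4 & 1 at 5 & 8 at 29 & 11 at 134 & 13 at 107 & []))
  (right (left (refuted (1 at 44 & 8 at 4 & 7 at 0 & 17 at 44 & 19 at 26 & []))
  (refuted (2 at 49 & 0 at 105 & 8 at 9 & 9 at 2 & 18 at 14 & []))
  (refuted (2 at 116 & 1 at 206 & 8 at 19 & 9 at 5 & 12 at 14 & []))
  (refuted (0 at 8 & 9 at 1 & 14 at 9 & 12 at 4 & []))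
  (left (refuted (1 at 269 & 8 at 22 & 13 at 149 & 17 at 44 & 20 at 1457 & []))
  (refuted (2 at 26 & 8 at 0 & 13 at 29 & 17 at 8 & 20 at 80 & []))
  (left (left (refuted (1 at 31 & 8 at 104 & 14 at 13 & 16 at 53 & 26 at 818 & []))
  (refuted (2 at 4 & 0 at 9 & 14 at 0 & 26 at 665 & []))
  (refuted (2 at 15 & 17 at 26 & 18 at 104 & 26 at 314 & 27 at 314 & []))
  (refuted (0 at 15 & 17 at 14 & 18 at 44 & 26 at 1214 & 27 at 278 & []))
  (left (refuted (1 at 15 & 14 at 314 & 22 at 242 & 26 at 944 & 31 at 944 & []))
  (refuted (2 at 15 & 14 at 278 & 22 at 134 & 26 at 404 & 31 at 3644 & []))
  (right (refuted (2 at 349 & 8 at 809 & 10 at 557 & 22 at 464 & 31 at 10880 & []))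
  (refuted (1 at 4776 & 0 at 4373 & 8 at 11987 & 10 at 7532 & 22 at 6881 & []))
  (right (refuted (2 at 2 & 8 at 6 & 20 at 287 & []))
  (refuted (1 at 29 & 8 at 34 & 17 at 242 & 20 at 1439 & 32 at 5993 & []))
  (refuted (0 at 349 & 12 at 7289 & 17 at 5021 & 23 at 464 & 32 at 10880 & []))
  (refuted (2 at 4776 & 1 at 4373 & 12 at 107891 & 17 at 67796 & 23 at 6881 & []))
  (left (left (refuted (1 at 44 & 7 at 30 & 34 at 9710 & []))
  (refuted (2 at 44 & 0 at 44 & 7 at 30 & 34 at 9710 & [])) (refuted (2 at 0 & 29 at 20 & 41 at 863 & []))
  (refuted (0 at 9 & 23 at 1997 & 29 at 104 & 38 at 728 & 41 at 4319 & []))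
  (conclusion (suc (suc zero)) (630 ⊢ 13 at 19 & 15 at 5 & 33 at 44 & 42 at 350 & [])
  (243 ⊢ 7 at 3 & 34 at 233 & []) (210 ⊢ 19 at 4 & 27 at 19 & 31 at 5 & 43 at 116 & [])
  (729 ⊢ 0 at 3 & 18 at 233 & []) (6561 ⊢ 2 at 4 & 14 at 194 & []) (2187 ⊢ 8 at 4 & 29 at 194 & []))
  (conclusion (suc (suc zero)) (630 ⊢ 13 at 19 & 15 at 5 & 33 at 44 & 42 at 350 & []) (2241 ⊢ 1 at 9 & 7 at 29 & [])
  (118098 ⊢ 1 at 12 & 19 at 2276 & 27 at 12149 & 31 at 3644 & [])
  (21141 ⊢ 1 at 147 & 15 at 1439 & 18 at 5057 & 29 at 2915 & [])
  (13149 ⊢ 1 at 31 & 3 at 38 & 33 at 2807 & 43 at 79136 & []) (2187 ⊢ 8 at 4 & 29 at 194 & [])))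
  (conclusion (suc (suc zero)) (8766 ⊢ 2 at 11 & 10 at 318 & 28 at 116 & 38 at 1673 & [])
  (6561 ⊢ 2 at 127 & 20 at 2231 & 28 at 1619 & 31 at 12149 & [])
  (210 ⊢ 16 at 4 & 24 at 19 & 28 at 5 & 40 at 116 & []) (2187 ⊢ 2 at 26 & 5 at 4 & 20 at 3887 & 26 at 194 & [])
  (7101 ⊢ 2 at 4 & 6 at 29 & 11 at 239 & 40 at 2699 & []) (2187 ⊢ 5 at 4 & 26 at 194 & []))
  (refuted (2 at 349 & 12 at 464 & 21 at 10880 & 29 at 7289 & 30 at 5021 & []))
  (refuted (1 at 4373 & 0 at 4776 & 12 at 6881 & 29 at 107891 & 30 at 67796 & []))
  (refuted (0 at 2 & 6 at 6 & 33 at 287 & []))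
  (refuted (1 at 29 & 6 at 34 & 21 at 5993 & 30 at 242 & 33 at 1439 & [])))
  (conclusion (suc (suc zero)) (39366 ⊢ 0 at 12 & 7 at 1349 & 9 at 404 & 27 at 2276 & [])
  (7047 ⊢ 0 at 147 & 8 at 323 & 25 at 1439 & 28 at 5057 & []) (210 ⊢ 13 at 4 & 21 at 19 & 25 at 5 & 37 at 116 & [])
  (61236 ⊢ 0 at 1389 & 4 at 1109 & 11 at 3644 & 23 at 464 & [])
  (65763 ⊢ 0 at 79 & 3 at 194 & 8 at 2079 & 37 at 98414 & [])
  (4383 ⊢ 0 at 31 & 4 at 38 & 13 at 311 & 36 at 26378 & [])))
  (left (conclusion (suc (suc zero)) (630 ⊢ 7 at 19 & 9 at 5 & 27 at 44 & 36 at 350 & [])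
  (1458 ⊢ 5 at 58 & 8 at 44 & 16 at 269 & 32 at 8090 & []) (2922 ⊢ 5 at 11 & 9 at 12 & 20 at 185 & 21 at 318 & [])
  (2187 ⊢ 5 at 127 & 9 at 179 & 12 at 1349 & 32 at 2231 & []) (1458 ⊢ 5 at 4 & 8 at 44 & 16 at 269 & 32 at 314 & [])
  (7101 ⊢ 1 at 9 & 5 at 14 & 23 at 719 & 36 at 2699 & []))
  (refuted (2 at 2456 & 5 at 7260 & 7 at 1619 & 21 at 4439 & 25 at 1859 & []))
  (refuted (2 at 349 & 9 at 464 & 18 at 10880 & 26 at 7289 & 27 at 5021 & []))
  (refuted (1 at 4373 & 0 at 4776 & 9 at 6881 & 26 at 107891 & 27 at 67796 & []))
  (refuted (0 at 15 & 16 at 314 & 18 at 944 & 30 at 2186 & 34 at 8504 & []))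
  (refuted (1 at 15 & 16 at 278 & 18 at 3644 & 30 at 1214 & 34 at 3644 & [])))
  (refuted (1 at 15 & 13 at 242 & 15 at 944 & 27 at 314 & 31 at 944 & []))
  (refuted (0 at 15 & 13 at 134 & 15 at 404 & 27 at 278 & 31 at 3644 & [])))
  (left (refuted (2 at 349 & 6 at 464 & 15 at 10880 & 23 at 7289 & 24 at 5021 & []))
  (refuted (1 at 15 & 13 at 278 & 15 at 3644 & 27 at 1214 & 31 at 3644 & []))
  (refuted (0 at 15 & 13 at 314 & 15 at 944 & 27 at 2186 & 31 at 8504 & []))
  (refuted (2 at 2746 & 1 at 1626 & 3 at 1364 & 27 at 255878 & 31 at 1377809 & []))
  (conclusion (suc (suc zero)) (54 ⊢ 3 at 0 & 15 at 8 & 33 at 404 & [])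
  (2205 ⊢ 2 at 51 & 3 at 139 & 25 at 629 & 29 at 26243 & []) (63 ⊢ 3 at 1 & 24 at 8 & [])
  (735 ⊢ 2 at 11 & 9 at 69 & 20 at 69 & 29 at 4553 & []) (2205 ⊢ 2 at 16 & 3 at 139 & 25 at 629 & 29 at 11123 & [])
  (6831 ⊢ 2 at 4 & 1 at 9 & 20 at 719 & []))
  (refuted (0 at 618 & 3 at 80 & 6 at 1130 & 17 at 107891 & 23 at 7289 & [])))
  (refuted (0 at 349 & 7 at 464 & 15 at 809 & 19 at 557 & 31 at 10880 & []))
  (refuted (2 at 4373 & 1 at 4776 & 7 at 6881 & 15 at 11987 & 19 at 7532 & [])))
  (left (left (refuted (1 at 4 & 7 at 47 & 34 at 2186 & []))
  (refuted (2 at 69 & 7 at 92 & 10 at 818 & 22 at 728 & 31 at 30617 & []))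
  (refuted (2 at 15 & 23 at 404 & 24 at 278 & 32 at 836 & 33 at 836 & []))
  (conclusion (suc (suc zero)) (1458 ⊢ 0 at 24 & 3 at 65 & 7 at 479 & 24 at 5102 & [])
  (63 ⊢ 5 at 3 & 3 at 3 & 25 at 17 & []) (6831 ⊢ 1 at 9 & 0 at 4 & 18 at 719 & [])
  (729 ⊢ 3 at 49 & 7 at 14 & 25 at 14 & 31 at 584 & []) (13122 ⊢ 0 at 9 & 5 at 454 & 3 at 24 & 13 at 1214 & [])
  (69984 ⊢ 0 at 24 & 3 at 1199 & 7 at 479 & 33 at 513944 & []))
  (refuted (0 at 15 & 13 at 314 & 15 at 944 & 27 at 2186 & 31 at 8504 & []))
  (refuted (1 at 15 & 13 at 278 & 15 at 3644 & 27 at 1214 & 31 at 3644 & [])))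
  (refuted (1 at 618 & 4 at 80 & 7 at 1130 & 15 at 809 & 30 at 107891 & []))
  (refuted (0 at 349 & 7 at 464 & 15 at 809 & 19 at 557 & 31 at 10880 & []))
  (refuted (2 at 15 & 14 at 278 & 22 at 134 & 26 at 404 & 31 at 3644 & []))
  (refuted (1 at 15 & 14 at 314 & 22 at 242 & 26 at 944 & 31 at 944 & []))
  (refuted (2 at 1626 & 0 at 2746 & 4 at 1364 & 22 at 28430 & 26 at 153089 & []))))
  (left (refuted (2 at 15 & 17 at 26 & 18 at 104 & 26 at 314 & 27 at 314 & []))
  (refuted (1 at 2746 & 0 at 1626 & 5 at 1364 & 17 at 3158 & 18 at 17009 & []))
  (left (refuted (1 at 15 & 14 at 314 & 22 at 242 & 26 at 944 & 31 at 944 & []))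
  (refuted (2 at 15 & 14 at 278 & 22 at 134 & 26 at 404 & 31 at 3644 & []))
  (refuted (2 at 4 & 8 at 47 & 29 at 728 & []))
  (refuted (0 at 69 & 8 at 92 & 11 at 818 & 17 at 80 & 26 at 3401 & []))
  (refuted (0 at 15 & 15 at 44 & 19 at 30 & 24 at 92 & 28 at 278 & []))
  (conclusion (suc (suc zero)) (167382 ⊢ 2 at 6249 & 3 at 104 & 15 at 17174 & 19 at 10619 & [])
  (72 ⊢ 1 at 4 & 28 at 134 & []) (735 ⊢ 4 at 12 & 8 at 34 & 15 at 69 & 19 at 80 & [])
  (1296 ⊢ 2 at 84 & 1 at 79 & 11 at 359 & 29 at 1214 & []) (2016 ⊢ 1 at 34 & 4 at 239 & 19 at 719 & 28 at 944 & [])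
  (144 ⊢ 2 at 4 & 29 at 134 & []))) (refuted (2 at 78 & 5 at 80 & 8 at 320 & 16 at 134 & 25 at 3158 & []))
  (refuted (2 at 4 & 1 at 9 & 14 at 0 & 26 at 665 & []))
  (refuted (0 at 15 & 17 at 14 & 18 at 44 & 26 at 1214 & 27 at 278 & [])))
  (refuted (2 at 120 & 5 at 104 & 6 at 524 & 11 at 2 & 18 at 944 & []))
  (refuted (1 at 105 & 0 at 49 & 4 at 14 & 18 at 809 & 22 at 242 & []))
  (refuted (0 at 47 & 9 at 8 & 13 at 34 & 18 at 104 & 22 at 314 & []))
  (refuted (1 at 47 & 9 at 4 & 13 at 14 & 18 at 404 & 22 at 278 & [])))
  (left (refuted (2 at 9 & 0 at 4 & 3 at 2 & 18 at 80 & []))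
  (refuted (1 at 47 & 9 at 4 & 13 at 14 & 18 at 404 & 22 at 278 & []))
  (refuted (0 at 47 & 9 at 8 & 13 at 34 & 18 at 104 & 22 at 314 & []))
  (refuted (2 at 2746 & 1 at 1626 & 3 at 1364 & 9 at 350 & 13 at 1889 & []))
  (left (refuted (1 at 9 & 6 at 14 & 14 at 1 & 26 at 926 & 25 at 404 & []))
  (conclusion (suc (suc zero)) (243 ⊢ 2 at 9 & 5 at 24 & 4 at 49 & 27 at 1214 & [])
  (45 ⊢ 6 at 89 & 14 at 0 & 23 at 134 & 26 at 395 & []) (243 ⊢ 2 at 19 & 0 at 9 & 5 at 74 & 4 at 74 & [])
  (189 ⊢ 2 at 34 & 5 at 185 & 6 at 1049 & 14 at 152 & []) (6939 ⊢ 2 at 129 & 5 at 1154 & 6 at 4439 & 12 at 179 & [])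
  (666 ⊢ 2 at 4 & 0 at 9 & 14 at 74 & [])) (refuted (2 at 15 & 17 at 26 & 18 at 104 & 26 at 314 & 27 at 314 & []))
  (refuted (0 at 15 & 17 at 14 & 18 at 44 & 26 at 1214 & 27 at 278 & []))
  (refuted (0 at 4 & 6 at 47 & 21 at 80 & [])) (refuted (1 at 9 & 6 at 47 & 9 at 116 & 18 at 53 & 21 at 80 & [])))
  (refuted (0 at 78 & 3 at 80 & 6 at 320 & 11 at 14 & 20 at 350 & [])))
  (refuted (0 at 4 & 3 at 2 & 13 at 4 & 12 at 0 & 22 at 14 & []))
  (refuted (2 at 17 & 1 at 9 & 13 at 14 & 17 at 5 & 22 at 14 & [])))
  (right (refuted (2 at 4 & 8 at 2 & 10 at 14 & 20 at 242 & 19 at 1214 & []))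
  (refuted (1 at 49 & 0 at 105 & 6 at 14 & 15 at 728 & 19 at 21869 & []))
  (left (left (refuted (1 at 4 & 10 at 47 & 19 at 8 & []))
  (refuted (2 at 9 & 10 at 47 & 16 at 5 & 19 at 8 & 28 at 116 & []))
  (refuted (2 at 89 & 6 at 1 & 10 at 134 & 23 at 404 & 21 at 926 & []))
  (conclusion (suc (suc zero)) (48 ⊢ 0 at 4 & 3 at 23 & 18 at 14 & 21 at 71 & []) (12 ⊢ 1 at 4 & 19 at 14 & [])
  (24 ⊢ 0 at 4 & 18 at 14 & []) (189 ⊢ 1 at 139 & 5 at 279 & 3 at 583 & 6 at 17 & [])
  (333 ⊢ 1 at 54 & 0 at 119 & 6 at 14 & 10 at 1109 & []) (189 ⊢ 1 at 34 & 5 at 69 & 3 at 361 & 6 at 8 & []))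
  (refuted (0 at 47 & 12 at 8 & 16 at 34 & 21 at 104 & 25 at 314 & []))
  (refuted (1 at 47 & 12 at 4 & 16 at 14 & 21 at 404 & 25 at 278 & [])))
  (refuted (1 at 236 & 3 at 4 & 7 at 242 & 15 at 116 & 25 at 962 & []))
  (refuted (1 at 4 & 0 at 9 & 7 at 2 & 16 at 8 & []))
  (refuted (2 at 431 & 4 at 4 & 11 at 14 & 16 at 404 & 20 at 278 & []))
  (refuted (1 at 431 & 4 at 8 & 11 at 34 & 16 at 104 & 20 at 314 & []))
  (refuted (2 at 1626 & 0 at 2746 & 4 at 38 & 7 at 1364 & 11 at 209 & [])))
  (refuted (2 at 0 & 4 at 116 & 12 at 14 & 15 at 53 & 19 at 98 & []))
  (refuted (2 at 22 & 1 at 12 & 12 at 44 & 15 at 161 & 19 at 4859 & []))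
  (refuted (0 at 4 & 5 at 161 & 13 at 23 & 12 at 38 & 19 at 809 & []))))
  (right (refuted (1 at 0 & 9 at 29 & 14 at 68 & 12 at 38 & 16 at 134 & []))
  (refuted (0 at 0 & 9 at 14 & 14 at 29 & 12 at 23 & 16 at 269 & []))
  (refuted (2 at 9 & 1 at 4 & 4 at 2 & 16 at 2186 & []))
  (refuted (1 at 9 & 0 at 22 & 9 at 44 & 12 at 161 & 16 at 4859 & []))
  (right (refuted (2 at 9 & 10 at 161 & 13 at 44 & 17 at 1349 & 22 at 5588 & []))
  (refuted (1 at 0 & 10 at 8 & 13 at 8 & 17 at 269 & 22 at 242 & []))
  (refuted (0 at 0 & 17 at 287 & 15 at 143 & 20 at 80 & 19 at 80 & []))
  (left (refuted (1 at 4319 & 5 at 4 & 8 at 31 & 20 at 1871 & 23 at 4724 & []))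
  (refuted (2 at 134 & 0 at 269 & 8 at 1 & 20 at 116 & []))
  (refuted (2 at 404 & 8 at 1 & 6 at 3 & 20 at 116 & 18 at 233 & []))
  (refuted (0 at 404 & 8 at 3 & 6 at 1 & 20 at 233 & 18 at 116 & []))
  (left (refuted (1 at 12 & 0 at 22 & 19 at 19 & 23 at 5 & 26 at 14 & []))
  (refuted (2 at 44 & 12 at 1 & 19 at 29 & 26 at 116 & 25 at 71 & []))
  (conclusion (suc (suc zero)) (2187 ⊢ 7 at 4 & 13 at 194 & [])
  (8505 ⊢ 2 at 13121 & 8 at 69 & 11 at 443 & 19 at 8189 & [])
  (323676 ⊢ 1 at 142154 & 8 at 2429 & 7 at 1584 & 13 at 14429 & [])
  (15309 ⊢ 2 at 69983 & 11 at 1387 & 9 at 69 & 13 at 3359 & []) (6561 ⊢ 8 at 79 & 11 at 64 & 9 at 129 & [])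
  (15309 ⊢ 2 at 34991 & 11 at 658 & 9 at 69 & 13 at 3359 & []))
  (refuted (0 at 14 & 13 at 1 & 23 at 29 & 26 at 74 & 25 at 32 & []))
  (refuted (0 at 9962 & 3 at 8504 & 8 at 69 & 9 at 200 & 19 at 4409 & []))
  (refuted (2 at 8018 & 1 at 4049 & 8 at 4 & 19 at 6659 & 23 at 1997 & [])))
  (refuted (1 at 44 & 10 at 0 & 22 at 143 & []))) (refuted (1 at 4 & 7 at 47 & 19 at 2186 & []))
  (refuted (0 at 9 & 7 at 47 & 10 at 116 & 19 at 2186 & 22 at 4373 & [])))
  (refuted (1 at 1 & 7 at 2 & 17 at 485 & 16 at 242 & [])))
  (refuted (1 at 22 & 0 at 12 & 11 at 44 & 14 at 161 & 15 at 1619 & []))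
  (refuted (2 at 0 & 11 at 14 & 9 at 29 & 14 at 53 & []))
  (refuted (1 at 4 & 4 at 2 & 6 at 14 & 16 at 80 & 15 at 404 & []))
  (refuted (2 at 105 & 0 at 49 & 5 at 14 & 14 at 728 & 15 at 7289 & [])))
  (right (refuted (1 at 9 & 0 at 4 & 3 at 2 & 15 at 728 & []))
  (refuted (2 at 22 & 0 at 9 & 11 at 44 & 14 at 161 & 15 at 1619 & []))
  (right (refuted (2 at 0 & 17 at 143 & 16 at 287 & 19 at 26 & 18 at 26 & []))
  (left (refuted (1 at 3644 & 4 at 17 & 3 at 22 & 9 at 194 & 17 at 1052 & []))
  (refuted (2 at 485 & 0 at 242 & 3 at 0 & 9 at 38 & []))
  (refuted (2 at 1457 & 1 at 728 & 4 at 15 & 8 at 25 & 7 at 12 & []))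
  (refuted (0 at 21869 & 4 at 241 & 3 at 81 & 8 at 194 & 17 at 9476 & []))
  (left (refuted (1 at 44 & 11 at 3 & 10 at 1 & 23 at 233 & 22 at 116 & []))
  (refuted (2 at 44 & 11 at 1 & 10 at 3 & 23 at 116 & 22 at 233 & []))
  (left (conclusion (suc (suc zero)) (333 ⊢ 1 at 119 & 10 at 4 & 9 at 9 & [])
  (729 ⊢ 0 at 4 & 6 at 194 & 13 at 149 & 15 at 44 & []) (486 ⊢ 1 at 566 & 10 at 24 & 13 at 65 & 15 at 479 & [])
  (21 ⊢ 0 at 1 & 14 at 3 & 13 at 3 & []) (23328 ⊢ 10 at 24 & 13 at 1199 & 15 at 479 & 28 at 171314 & [])
  (4374 ⊢ 10 at 9 & 14 at 454 & 13 at 24 & 21 at 1214 & []))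
  (refuted (2 at 4 & 15 at 5 & 25 at 89 & 28 at 74 & 27 at 32 & []))
  (refuted (2 at 1106 & 5 at 944 & 10 at 69 & 14 at 200 & 21 at 4409 & []))
  (refuted (1 at 890 & 0 at 449 & 10 at 4 & 21 at 6659 & 25 at 1997 & []))
  (refuted (2 at 22 & 0 at 12 & 21 at 179 & 25 at 53 & 28 at 44 & []))
  (refuted (1 at 4 & 17 at 1 & 21 at 29 & 28 at 38 & 27 at 23 & []))) (refuted (0 at 4 & 12 at 0 & 24 at 47 & []))
  (refuted (0 at 479 & 7 at 4 & 10 at 31 & 22 at 1871 & 25 at 1574 & []))
  (refuted (2 at 29 & 1 at 14 & 10 at 1 & 22 at 116 & [])))
  (left (refuted (0 at 479 & 7 at 4 & 10 at 31 & 22 at 1871 & 25 at 1574 & []))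
  (refuted (1 at 47 & 7 at 0 & 25 at 314 & [])) (refuted (1 at 14 & 0 at 29 & 10 at 1 & 22 at 116 & []))
  (refuted (2 at 44 & 11 at 1 & 10 at 3 & 23 at 116 & 22 at 233 & []))
  (refuted (1 at 44 & 11 at 3 & 10 at 1 & 23 at 233 & 22 at 116 & []))
  (refuted (2 at 44 & 11 at 1 & 10 at 3 & 23 at 116 & 22 at 233 & []))))
  (refuted (0 at 4 & 6 at 47 & 18 at 728 & [])) (refuted (2 at 1 & 6 at 5 & 9 at 44 & 14 at 107 & 18 at 242 & []))
  (refuted (1 at 4 & 4 at 2 & 7 at 29 & 9 at 89 & 16 at 242 & []))
  (refuted (0 at 0 & 7 at 2 & 9 at 8 & 16 at 242 & []))) (refuted (0 at 1 & 6 at 2 & 16 at 161 & 15 at 80 & []))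
  (refuted (0 at 7 & 7 at 68 & 11 at 170 & 14 at 242 & 15 at 566 & []))
  (refuted (2 at 4 & 1 at 21 & 3 at 29 & 11 at 404 & 13 at 1457 & []))))
  (right (right (refuted (2 at 6 & 0 at 1 & 4 at 11 & 8 at 53 & 11 at 80 & []))
  (refuted (1 at 1 & 4 at 2 & 8 at 5 & 11 at 53 & 13 at 80 & []))
  (refuted (0 at 4 & 3 at 2 & 6 at 29 & 11 at 89 & 15 at 80 & []))
  (refuted (2 at 0 & 6 at 2 & 11 at 8 & 15 at 80 & [])) (refuted (1 at 1 & 7 at 2 & 16 at 80 & 15 at 161 & []))
  (left (refuted (1 at 5 & 10 at 0 & 14 at 5 & 17 at 5 & 19 at 8 & []))
  (refuted (2 at 44 & 5 at 0 & 17 at 143 & [])) (refuted (2 at 8 & 6 at 0 & 14 at 2 & 15 at 8 & []))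
  (refuted (0 at 44 & 6 at 0 & 14 at 29 & 15 at 89 & 18 at 26 & []))
  (left (refuted (1 at 161 & 0 at 80 & 6 at 15 & 10 at 25 & 9 at 12 & []))
  (refuted (2 at 2429 & 8 at 81 & 6 at 241 & 10 at 194 & 19 at 9476 & []))
  (left (left (refuted (1 at 122 & 4 at 104 & 12 at 69 & 16 at 200 & 26 at 4409 & []))
  (refuted (2 at 49 & 0 at 98 & 12 at 4 & 26 at 6659 & 27 at 665 & []))
  (refuted (2 at 12 & 1 at 22 & 9 at 44 & 26 at 1619 & 27 at 161 & []))
  (refuted (0 at 4 & 11 at 23 & 9 at 38 & 19 at 17 & 26 at 269 & []))
  (conclusion (suc (suc zero)) (567 ⊢ 0 at 134 & 16 at 69 & 15 at 334 & 20 at 524 & [])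
  (432 ⊢ 11 at 134 & 14 at 84 & 12 at 79 & 23 at 359 & [])
  (567 ⊢ 0 at 134 & 16 at 139 & 15 at 264 & 20 at 1049 & []) (24 ⊢ 9 at 14 & 12 at 4 & [])
  (48 ⊢ 11 at 14 & 14 at 4 & []) (672 ⊢ 0 at 79 & 9 at 104 & 12 at 34 & 15 at 239 & []))
  (refuted (1 at 1 & 9 at 29 & 20 at 14 & 28 at 32 & 27 at 74 & []))) (refuted (2 at 2 & 11 at 0 & 23 at 62 & []))
  (refuted (2 at 159 & 6 at 524 & 9 at 14 & 12 at 95 & 24 at 1871 & []))
  (refuted (1 at 9 & 0 at 4 & 12 at 5 & 24 at 116 & []))
  (refuted (0 at 4 & 13 at 3 & 12 at 1 & 25 at 77 & 24 at 38 & []))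
  (refuted (1 at 4 & 13 at 1 & 12 at 3 & 25 at 38 & 24 at 77 & [])))
  (left (refuted (2 at 9 & 0 at 4 & 12 at 5 & 24 at 116 & []))
  (refuted (1 at 4 & 13 at 1 & 12 at 3 & 25 at 38 & 24 at 77 & []))
  (refuted (0 at 4 & 13 at 3 & 12 at 1 & 25 at 77 & 24 at 38 & []))
  (refuted (1 at 4 & 13 at 1 & 12 at 3 & 25 at 38 & 24 at 77 & []))
  (refuted (2 at 159 & 6 at 524 & 9 at 14 & 12 at 95 & 24 at 1871 & []))
  (refuted (0 at 15 & 6 at 104 & 9 at 2 & [])))
  (refuted (0 at 404 & 8 at 22 & 6 at 17 & 14 at 194 & 19 at 1052 & []))
  (refuted (2 at 26 & 1 at 53 & 8 at 0 & 14 at 38 & [])))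
  (refuted (1 at 242 & 5 at 0 & 3 at 0 & 7 at 15 & 6 at 31 & []))))
  (left (refuted (1 at 5 & 7 at 0 & 11 at 5 & 14 at 5 & 16 at 8 & [])) (refuted (2 at 2 & 8 at 0 & 14 at 14 & []))
  (refuted (2 at 8 & 8 at 1 & 11 at 4 & 9 at 9 & []))
  (refuted (0 at 62 & 4 at 1 & 11 at 29 & 12 at 98 & 15 at 26 & []))
  (refuted (2 at 8 & 0 at 17 & 5 at 1 & 11 at 2 & [])) (refuted (1 at 8 & 5 at 0 & 8 at 0 & 11 at 3 & 9 at 4 & [])))
  (refuted (2 at 0 & 11 at 14 & 10 at 29 & 13 at 17 & 12 at 17 & []))
  (refuted (1 at 0 & 0 at 1 & 10 at 44 & 13 at 17 & 12 at 35 & []))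
  (refuted (2 at 0 & 0 at 5 & 8 at 29 & 11 at 134 & 13 at 107 & []))
  (refuted (1 at 0 & 11 at 29 & 10 at 14 & 13 at 17 & [])))
  (refuted (2 at 0 & 1 at 0 & 6 at 5 & 10 at 5 & 9 at 2 & [])) (refuted (0 at 0 & 6 at 5 & 10 at 5 & 9 at 2 & [])))
  (right (refuted (1 at 0 & 4 at 5 & 8 at 11 & 10 at 20 & 9 at 5 & []))
  (refuted (0 at 0 & 4 at 5 & 8 at 5 & 10 at 23 & 9 at 2 & [])) (refuted (2 at 1 & 1 at 0 & 4 at 5 & 10 at 26 & []))
  (refuted (1 at 0 & 0 at 1 & 4 at 5 & 10 at 26 & []))
  (right (refuted (2 at 4 & 5 at 8 & 8 at 20 & 10 at 107 & 13 at 53 & []))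
  (refuted (1 at 0 & 11 at 29 & 10 at 14 & 13 at 17 & []))
  (right (refuted (2 at 0 & 3 at 1 & 10 at 2 & 9 at 26 & 16 at 53 & []))
  (refuted (1 at 0 & 10 at 14 & 9 at 29 & 13 at 53 & []))
  (refuted (0 at 9 & 8 at 38 & 10 at 71 & 13 at 161 & 17 at 566 & []))
  (refuted (2 at 7 & 1 at 0 & 3 at 5 & 8 at 53 & 10 at 80 & []))
  (refuted (2 at 1 & 1 at 0 & 10 at 8 & 16 at 161 & []))
  (refuted (0 at 0 & 3 at 0 & 8 at 4 & 6 at 3 & 16 at 80 & [])))
  (left (refuted (1 at 8 & 6 at 1 & 10 at 6 & 9 at 7 & 14 at 17 & []))
  (refuted (0 at 44 & 4 at 7 & 9 at 14 & 14 at 89 & 16 at 53 & []))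
  (refuted (2 at 9 & 1 at 4 & 4 at 0 & 16 at 2 & []))
  (refuted (1 at 89 & 0 at 206 & 4 at 19 & 6 at 5 & 9 at 14 & []))
  (left (refuted (1 at 0 & 11 at 0 & 16 at 2 & 20 at 2 & []))
  (refuted (2 at 4 & 5 at 2 & 11 at 0 & 16 at 29 & 20 at 29 & []))
  (left (left (refuted (1 at 159 & 8 at 524 & 11 at 1871 & 14 at 134 & 17 at 863 & []))
  (refuted (2 at 4 & 0 at 9 & 11 at 116 & 17 at 53 & []))
  (refuted (2 at 4 & 11 at 38 & 9 at 77 & 17 at 17 & 15 at 35 & []))
  (refuted (0 at 4 & 11 at 77 & 9 at 38 & 17 at 35 & 15 at 17 & []))
  (left (refuted (1 at 12 & 0 at 22 & 11 at 44 & 14 at 161 & 28 at 4859 & []))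
  (refuted (2 at 4 & 11 at 38 & 10 at 23 & 21 at 161 & 28 at 809 & []))
  (conclusion (suc (suc zero)) (81 ⊢ 17 at 19 & 16 at 9 & 20 at 74 & 18 at 74 & [])
  (63 ⊢ 2 at 16 & 17 at 34 & 20 at 185 & 22 at 1049 & []) (81 ⊢ 17 at 9 & 20 at 24 & 18 at 49 & 28 at 404 & [])
  (135 ⊢ 2 at 0 & 11 at 134 & 14 at 395 & 22 at 809 & []) (666 ⊢ 2 at 24 & 17 at 14 & 16 at 29 & [])
  (2313 ⊢ 1 at 19 & 17 at 129 & 20 at 1154 & 22 at 4439 & []))
  (refuted (0 at 0 & 11 at 14 & 14 at 53 & 22 at 116 & 28 at 98 & []))
  (refuted (0 at 40 & 3 at 34 & 17 at 209 & 18 at 602 & 28 at 4409 & []))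
  (refuted (2 at 98 & 1 at 49 & 14 at 665 & 17 at 44 & 28 at 19979 & [])))
  (refuted (1 at 0 & 19 at 44 & 25 at 143 & [])))
  (left (refuted (2 at 4 & 11 at 38 & 9 at 77 & 17 at 17 & 15 at 35 & []))
  (refuted (0 at 4 & 11 at 77 & 9 at 38 & 17 at 35 & 15 at 17 & []))
  (refuted (1 at 159 & 8 at 524 & 11 at 1871 & 14 at 134 & 17 at 863 & []))
  (refuted (2 at 15 & 8 at 104 & 14 at 26 & [])) (refuted (2 at 4 & 1 at 9 & 11 at 116 & 17 at 53 & []))
  (refuted (0 at 4 & 11 at 77 & 9 at 38 & 17 at 35 & 15 at 17 & [])))
  (refuted (2 at 44 & 11 at 17 & 10 at 22 & 16 at 194 & 21 at 350 & []))
  (refuted (1 at 2 & 0 at 5 & 10 at 0 & 16 at 38 & []))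
  (refuted (2 at 8 & 0 at 17 & 11 at 15 & 14 at 12 & 12 at 25 & []))
  (refuted (1 at 269 & 11 at 241 & 10 at 81 & 12 at 194 & 21 at 3158 & [])))
  (refuted (0 at 26 & 8 at 0 & 7 at 0 & 11 at 31 & 9 at 15 & []))
  (refuted (0 at 1 & 3 at 2 & 12 at 2 & 16 at 17 & 19 at 5 & [])) (refuted (1 at 4 & 7 at 0 & 19 at 47 & [])))
  (refuted (1 at 17 & 5 at 1 & 4 at 0 & 13 at 8 & [])))
  (refuted (2 at 1 & 1 at 6 & 3 at 11 & 7 at 53 & 10 at 80 & []))
  (refuted (0 at 1 & 3 at 2 & 7 at 5 & 10 at 53 & 12 at 26 & [])))
  (right (refuted (1 at 0 & 7 at 14 & 13 at 26 & [])) (right (refuted (1 at 0 & 7 at 14 & 13 at 80 & []))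
  (refuted (2 at 1 & 5 at 2 & 7 at 5 & 10 at 53 & 14 at 80 & []))
  (refuted (2 at 0 & 10 at 11 & 9 at 14 & 13 at 26 & 16 at 80 & []))
  (refuted (1 at 0 & 0 at 1 & 10 at 8 & 16 at 161 & []))
  (refuted (0 at 6 & 3 at 2 & 6 at 32 & 10 at 89 & 17 at 161 & []))
  (refuted (1 at 0 & 10 at 14 & 9 at 29 & 13 at 53 & [])))
  (refuted (2 at 0 & 4 at 2 & 11 at 14 & 10 at 47 & 13 at 8 & []))
  (refuted (1 at 0 & 0 at 1 & 4 at 5 & 10 at 80 & []))
  (refuted (2 at 0 & 0 at 0 & 11 at 29 & 10 at 14 & 13 at 17 & []))
  (refuted (1 at 0 & 11 at 29 & 10 at 14 & 13 at 17 & []))))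

-- The case of a centre and a neighbour with opposite signs; `tree⁺` is for equal signs.
tree⁻ : Tree
tree⁻ = orbitRight
  (right (refuted (2 at 6 & 0 at 1 & 4 at 11 & 8 at 53 & 11 at 26 & []))
  (refuted (1 at 0 & 4 at 0 & 8 at 6 & 6 at 4 & 11 at 5 & [])) (refuted (0 at 0 & 6 at 5 & 11 at 5 & 9 at 2 & []))
  (refuted (2 at 1 & 1 at 0 & 4 at 5 & 11 at 26 & 9 at 26 & []))
  (right (right (refuted (2 at 1 & 5 at 2 & 7 at 5 & 10 at 53 & 14 at 80 & []))
  (refuted (1 at 6 & 0 at 1 & 5 at 11 & 7 at 53 & 10 at 80 & []))
  (left (refuted (1 at 44 & 4 at 0 & 16 at 143 & []))
  (refuted (2 at 5 & 11 at 0 & 13 at 5 & 16 at 5 & 20 at 8 & []))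
  (refuted (2 at 242 & 3 at 0 & 8 at 16 & 6 at 30 & 10 at 8 & []))
  (left (refuted (2 at 161 & 0 at 80 & 6 at 15 & 11 at 25 & 9 at 12 & []))
  (refuted (1 at 2429 & 7 at 81 & 6 at 241 & 11 at 194 & 20 at 9476 & []))
  (refuted (0 at 404 & 7 at 22 & 6 at 17 & 13 at 194 & 20 at 1052 & []))
  (refuted (2 at 53 & 1 at 26 & 7 at 0 & 13 at 38 & [])) (left (refuted (1 at 2 & 10 at 0 & 22 at 62 & []))
  (left (refuted (2 at 122 & 5 at 104 & 12 at 69 & 17 at 200 & 25 at 4409 & []))
  (refuted (1 at 49 & 0 at 98 & 12 at 4 & 25 at 6659 & 27 at 665 & []))
  (conclusion (suc zero) (567 ⊢ 0 at 134 & 17 at 139 & 15 at 264 & 19 at 1049 & []) (24 ⊢ 9 at 14 & 12 at 4 & [])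
  (567 ⊢ 0 at 134 & 17 at 69 & 15 at 334 & 19 at 524 & []) (432 ⊢ 10 at 134 & 13 at 84 & 12 at 79 & 22 at 359 & [])
  (672 ⊢ 0 at 79 & 9 at 104 & 12 at 34 & 15 at 239 & []) (48 ⊢ 10 at 14 & 13 at 4 & []))
  (refuted (2 at 1 & 9 at 29 & 19 at 14 & 29 at 32 & 27 at 74 & []))
  (refuted (2 at 22 & 1 at 12 & 9 at 44 & 25 at 1619 & 27 at 161 & []))
  (refuted (0 at 4 & 10 at 23 & 9 at 38 & 20 at 17 & 25 at 269 & [])))
  (refuted (2 at 4 & 14 at 1 & 12 at 3 & 26 at 38 & 24 at 77 & []))
  (refuted (0 at 4 & 14 at 3 & 12 at 1 & 26 at 77 & 24 at 38 & []))
  (refuted (2 at 9 & 0 at 4 & 12 at 5 & 24 at 116 & []))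
  (refuted (1 at 159 & 6 at 524 & 9 at 14 & 12 at 95 & 24 at 1871 & [])))
  (left (refuted (2 at 4 & 14 at 1 & 12 at 3 & 26 at 38 & 24 at 77 & []))
  (refuted (1 at 9 & 0 at 4 & 12 at 5 & 24 at 116 & [])) (refuted (0 at 15 & 6 at 104 & 9 at 2 & []))
  (refuted (1 at 159 & 6 at 524 & 9 at 14 & 12 at 95 & 24 at 1871 & []))
  (refuted (2 at 4 & 14 at 1 & 12 at 3 & 26 at 38 & 24 at 77 & []))
  (refuted (0 at 4 & 14 at 3 & 12 at 1 & 26 at 77 & 24 at 38 & []))))
  (refuted (0 at 44 & 6 at 0 & 13 at 29 & 15 at 89 & 18 at 26 & []))
  (refuted (1 at 26 & 6 at 1 & 10 at 5 & 13 at 14 & 18 at 53 & [])))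
  (refuted (2 at 1 & 8 at 2 & 17 at 80 & 15 at 161 & [])) (refuted (1 at 0 & 6 at 2 & 10 at 8 & 15 at 80 & []))
  (refuted (0 at 4 & 3 at 2 & 6 at 29 & 10 at 89 & 15 at 80 & [])))
  (left (refuted (1 at 2 & 7 at 0 & 13 at 14 & [])) (refuted (2 at 5 & 8 at 0 & 10 at 5 & 13 at 5 & 17 at 8 & []))
  (refuted (2 at 8 & 4 at 0 & 7 at 0 & 10 at 3 & 9 at 4 & [])) (refuted (1 at 8 & 0 at 17 & 4 at 1 & 10 at 2 & []))
  (refuted (0 at 62 & 5 at 1 & 10 at 29 & 12 at 98 & 15 at 26 & []))
  (refuted (1 at 8 & 7 at 1 & 10 at 4 & 9 at 9 & [])))
  (refuted (1 at 0 & 0 at 5 & 7 at 29 & 10 at 134 & 14 at 107 & []))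
  (refuted (2 at 0 & 11 at 14 & 10 at 29 & 14 at 17 & []))
  (refuted (1 at 0 & 11 at 29 & 10 at 14 & 14 at 17 & 12 at 17 & []))
  (refuted (2 at 4 & 0 at 21 & 4 at 29 & 11 at 404 & 12 at 485 & [])))
  (right (refuted (1 at 0 & 0 at 0 & 11 at 14 & 10 at 29 & 14 at 17 & []))
  (refuted (2 at 0 & 11 at 14 & 10 at 29 & 14 at 17 & []))
  (right (right (refuted (2 at 0 & 7 at 5 & 11 at 20 & 9 at 23 & 12 at 53 & []))
  (refuted (1 at 9 & 0 at 2 & 7 at 59 & 9 at 134 & 12 at 161 & []))
  (right (refuted (2 at 0 & 11 at 8 & 14 at 8 & 16 at 269 & 23 at 242 & []))
  (refuted (1 at 9 & 11 at 161 & 14 at 44 & 16 at 1349 & 23 at 5588 & []))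
  (refuted (0 at 9 & 8 at 47 & 11 at 116 & 20 at 2186 & 23 at 4373 & []))
  (refuted (2 at 4 & 8 at 47 & 20 at 2186 & [])) (left (refuted (1 at 134 & 0 at 269 & 7 at 1 & 19 at 116 & []))
  (refuted (2 at 4319 & 4 at 4 & 7 at 31 & 19 at 1871 & 22 at 4724 & []))
  (refuted (2 at 80 & 11 at 4 & 17 at 47 & []))
  (left (refuted (2 at 12 & 0 at 22 & 20 at 19 & 22 at 5 & 25 at 14 & []))
  (refuted (1 at 44 & 12 at 1 & 20 at 29 & 26 at 71 & 25 at 116 & []))
  (refuted (0 at 9962 & 3 at 8504 & 7 at 69 & 9 at 200 & 20 at 4409 & []))
  (refuted (2 at 4049 & 1 at 8018 & 7 at 4 & 20 at 6659 & 22 at 1997 & []))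
  (conclusion (suc zero) (323676 ⊢ 2 at 142154 & 8 at 1584 & 7 at 2429 & 14 at 14429 & [])
  (15309 ⊢ 1 at 69983 & 10 at 1387 & 9 at 69 & 14 at 3359 & []) (2187 ⊢ 8 at 4 & 14 at 194 & [])
  (8505 ⊢ 1 at 13121 & 7 at 69 & 10 at 443 & 20 at 8189 & [])
  (15309 ⊢ 1 at 34991 & 8 at 69 & 10 at 728 & 14 at 2729 & []) (6561 ⊢ 7 at 79 & 10 at 64 & 9 at 129 & []))
  (refuted (0 at 14 & 14 at 1 & 22 at 29 & 26 at 32 & 25 at 74 & [])))
  (refuted (0 at 404 & 7 at 3 & 6 at 1 & 19 at 233 & 18 at 116 & []))
  (refuted (1 at 404 & 7 at 1 & 6 at 3 & 19 at 116 & 18 at 233 & [])))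
  (refuted (0 at 0 & 14 at 17 & 16 at 269 & 15 at 80 & 21 at 242 & [])))
  (refuted (2 at 1 & 8 at 2 & 17 at 242 & 16 at 485 & [])) (refuted (2 at 4 & 1 at 9 & 5 at 2 & 17 at 2186 & []))
  (refuted (2 at 9 & 0 at 22 & 9 at 44 & 12 at 161 & 17 at 4859 & [])))
  (left (refuted (1 at 49 & 0 at 105 & 7 at 9 & 9 at 2 & 18 at 14 & []))
  (refuted (2 at 44 & 8 at 0 & 7 at 4 & 16 at 44 & 20 at 26 & []))
  (right (refuted (1 at 4 & 7 at 2 & 11 at 14 & 20 at 1214 & 19 at 242 & []))
  (refuted (2 at 9 & 0 at 17 & 11 at 14 & 15 at 161 & 20 at 3644 & []))
  (refuted (2 at 12 & 1 at 22 & 12 at 44 & 15 at 161 & 20 at 4859 & []))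
  (refuted (0 at 4 & 4 at 161 & 14 at 23 & 12 at 38 & 20 at 809 & []))
  (left (left (refuted (1 at 9 & 11 at 47 & 17 at 5 & 20 at 8 & 29 at 116 & []))
  (refuted (2 at 4 & 11 at 47 & 20 at 8 & [])) (refuted (2 at 47 & 12 at 4 & 17 at 14 & 21 at 404 & 26 at 278 & []))
  (refuted (0 at 47 & 12 at 8 & 17 at 34 & 21 at 104 & 26 at 314 & []))
  (conclusion (suc zero) (24 ⊢ 0 at 4 & 18 at 14 & []) (63 ⊢ 4 at 139 & 3 at 147 & 6 at 5 & 11 at 419 & [])
  (48 ⊢ 0 at 4 & 3 at 23 & 18 at 14 & 21 at 71 & []) (12 ⊢ 2 at 4 & 20 at 14 & [])
  (189 ⊢ 2 at 34 & 4 at 69 & 3 at 361 & 6 at 8 & []) (333 ⊢ 2 at 54 & 0 at 119 & 6 at 14 & 11 at 1109 & []))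
  (refuted (1 at 89 & 6 at 1 & 11 at 134 & 22 at 404 & 21 at 926 & [])))
  (refuted (2 at 236 & 3 at 4 & 8 at 242 & 15 at 116 & 26 at 962 & []))
  (refuted (2 at 431 & 5 at 8 & 10 at 34 & 17 at 104 & 19 at 314 & []))
  (refuted (1 at 1626 & 0 at 2746 & 5 at 38 & 8 at 1364 & 10 at 209 & []))
  (refuted (2 at 4 & 0 at 9 & 8 at 2 & 17 at 8 & []))
  (refuted (1 at 431 & 5 at 4 & 10 at 14 & 17 at 404 & 19 at 278 & [])))
  (refuted (1 at 0 & 5 at 116 & 12 at 14 & 15 at 53 & 20 at 98 & [])))
  (left (refuted (2 at 269 & 7 at 22 & 14 at 149 & 16 at 44 & 19 at 1457 & []))
  (refuted (1 at 26 & 7 at 0 & 14 at 29 & 16 at 8 & 19 at 80 & []))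
  (refuted (0 at 4 & 3 at 2 & 14 at 4 & 12 at 0 & 23 at 14 & []))
  (refuted (2 at 49 & 1 at 105 & 4 at 14 & 14 at 89 & 16 at 26 & []))
  (left (left (refuted (1 at 15 & 16 at 26 & 18 at 104 & 25 at 314 & 27 at 314 & []))
  (refuted (2 at 2746 & 0 at 1626 & 4 at 1364 & 16 at 3158 & 18 at 17009 & []))
  (refuted (2 at 9 & 1 at 4 & 13 at 0 & 25 at 665 & []))
  (refuted (0 at 15 & 16 at 14 & 18 at 44 & 25 at 1214 & 27 at 278 & []))
  (left (refuted (1 at 15 & 13 at 278 & 23 at 134 & 25 at 404 & 32 at 3644 & []))
  (refuted (2 at 15 & 13 at 314 & 23 at 242 & 25 at 944 & 32 at 944 & []))
  (conclusion (suc zero) (735 ⊢ 5 at 12 & 7 at 34 & 15 at 69 & 20 at 80 & [])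
  (1296 ⊢ 2 at 79 & 1 at 84 & 10 at 359 & 28 at 1214 & [])
  (167382 ⊢ 1 at 6249 & 3 at 104 & 15 at 17174 & 20 at 10619 & []) (72 ⊢ 2 at 4 & 29 at 134 & [])
  (144 ⊢ 1 at 4 & 28 at 134 & []) (2016 ⊢ 2 at 34 & 5 at 239 & 20 at 719 & 29 at 944 & []))
  (refuted (0 at 15 & 15 at 44 & 20 at 30 & 24 at 92 & 29 at 278 & []))
  (refuted (0 at 69 & 7 at 92 & 10 at 818 & 16 at 80 & 25 at 3401 & []))
  (refuted (1 at 4 & 7 at 47 & 28 at 728 & [])))
  (refuted (1 at 78 & 4 at 80 & 7 at 320 & 17 at 134 & 26 at 3158 & [])))
  (left (refuted (2 at 31 & 7 at 104 & 13 at 13 & 17 at 53 & 25 at 818 & []))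
  (refuted (1 at 4 & 0 at 9 & 13 at 0 & 25 at 665 & []))
  (left (refuted (1 at 15 & 13 at 278 & 23 at 134 & 25 at 404 & 32 at 3644 & []))
  (refuted (2 at 15 & 13 at 314 & 23 at 242 & 25 at 944 & 32 at 944 & []))
  (refuted (2 at 4776 & 1 at 4373 & 8 at 6881 & 15 at 11987 & 20 at 7532 & []))
  (refuted (0 at 349 & 8 at 464 & 15 at 809 & 20 at 557 & 32 at 10880 & []))
  (left (refuted (1 at 349 & 6 at 464 & 15 at 10880 & 22 at 7289 & 24 at 5021 & []))
  (refuted (2 at 15 & 14 at 278 & 15 at 3644 & 27 at 1214 & 32 at 3644 & []))
  (conclusion (suc zero) (63 ⊢ 3 at 1 & 24 at 8 & []) (735 ⊢ 1 at 11 & 9 at 69 & 19 at 69 & 28 at 4553 & [])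
  (54 ⊢ 3 at 0 & 15 at 8 & 33 at 404 & []) (2205 ⊢ 1 at 51 & 3 at 139 & 26 at 629 & 28 at 26243 & [])
  (6831 ⊢ 2 at 9 & 1 at 4 & 19 at 719 & []) (2205 ⊢ 1 at 16 & 3 at 139 & 26 at 629 & 28 at 11123 & []))
  (refuted (0 at 618 & 3 at 80 & 6 at 1130 & 16 at 107891 & 22 at 7289 & []))
  (refuted (0 at 15 & 14 at 314 & 15 at 944 & 27 at 2186 & 32 at 8504 & []))
  (refuted (2 at 1626 & 1 at 2746 & 3 at 1364 & 27 at 255878 & 32 at 1377809 & [])))
  (right (refuted (1 at 349 & 7 at 809 & 11 at 557 & 23 at 464 & 32 at 10880 & []))
  (refuted (2 at 4776 & 0 at 4373 & 7 at 11987 & 11 at 7532 & 23 at 6881 & []))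
  (refuted (2 at 15 & 14 at 242 & 15 at 944 & 27 at 314 & 32 at 944 & []))
  (refuted (0 at 15 & 14 at 134 & 15 at 404 & 27 at 278 & 32 at 3644 & []))
  (right (refuted (2 at 29 & 7 at 34 & 16 at 242 & 19 at 1439 & 31 at 5993 & []))
  (refuted (1 at 2 & 7 at 6 & 19 at 287 & []))
  (conclusion (suc zero) (210 ⊢ 14 at 4 & 21 at 19 & 26 at 5 & 38 at 116 & [])
  (61236 ⊢ 0 at 1389 & 5 at 1109 & 10 at 3644 & 22 at 464 & [])
  (39366 ⊢ 0 at 12 & 8 at 1349 & 9 at 404 & 27 at 2276 & [])
  (7047 ⊢ 0 at 147 & 7 at 323 & 26 at 1439 & 29 at 5057 & [])
  (4383 ⊢ 0 at 31 & 5 at 38 & 14 at 311 & 36 at 26378 & [])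
  (65763 ⊢ 0 at 79 & 3 at 194 & 7 at 2079 & 38 at 98414 & []))
  (left (left (refuted (1 at 44 & 0 at 44 & 8 at 30 & 35 at 9710 & []))
  (refuted (2 at 44 & 8 at 30 & 35 at 9710 & []))
  (conclusion (suc zero) (118098 ⊢ 2 at 12 & 20 at 2276 & 27 at 12149 & 32 at 3644 & [])
  (21141 ⊢ 2 at 147 & 15 at 1439 & 18 at 5057 & 28 at 2915 & [])
  (630 ⊢ 14 at 19 & 15 at 5 & 33 at 44 & 42 at 350 & []) (2241 ⊢ 2 at 9 & 8 at 29 & [])
  (2187 ⊢ 7 at 4 & 28 at 194 & []) (13149 ⊢ 2 at 31 & 3 at 38 & 33 at 2807 & 44 at 79136 & []))
  (conclusion (suc zero) (210 ⊢ 20 at 4 & 27 at 19 & 32 at 5 & 44 at 116 & []) (729 ⊢ 0 at 3 & 18 at 233 & [])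
  (630 ⊢ 14 at 19 & 15 at 5 & 33 at 44 & 42 at 350 & []) (243 ⊢ 8 at 3 & 35 at 233 & [])
  (2187 ⊢ 7 at 4 & 28 at 194 & []) (6561 ⊢ 1 at 4 & 13 at 194 & []))
  (refuted (0 at 9 & 22 at 1997 & 28 at 104 & 37 at 728 & 40 at 4319 & []))
  (refuted (1 at 0 & 28 at 20 & 40 at 863 & [])))
  (conclusion (suc zero) (210 ⊢ 17 at 4 & 24 at 19 & 29 at 5 & 41 at 116 & [])
  (2187 ⊢ 1 at 26 & 4 at 4 & 19 at 3887 & 25 at 194 & []) (8766 ⊢ 1 at 11 & 11 at 318 & 29 at 116 & 37 at 1673 & [])
  (6561 ⊢ 1 at 127 & 19 at 2231 & 29 at 1619 & 32 at 12149 & []) (2187 ⊢ 4 at 4 & 25 at 194 & [])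
  (7101 ⊢ 1 at 4 & 6 at 29 & 10 at 239 & 41 at 2699 & [])) (refuted (0 at 2 & 6 at 6 & 33 at 287 & []))
  (refuted (2 at 29 & 6 at 34 & 21 at 5993 & 30 at 242 & 33 at 1439 & []))
  (refuted (1 at 349 & 12 at 464 & 21 at 10880 & 28 at 7289 & 30 at 5021 & []))
  (refuted (2 at 4373 & 0 at 4776 & 12 at 6881 & 28 at 107891 & 30 at 67796 & [])))
  (refuted (2 at 4373 & 1 at 4776 & 12 at 107891 & 16 at 67796 & 22 at 6881 & []))
  (refuted (0 at 349 & 12 at 7289 & 16 at 5021 & 22 at 464 & 31 at 10880 & [])))
  (left (conclusion (suc zero) (2922 ⊢ 4 at 11 & 9 at 12 & 19 at 185 & 21 at 318 & [])
  (2187 ⊢ 4 at 127 & 9 at 179 & 12 at 1349 & 31 at 2231 & []) (630 ⊢ 8 at 19 & 9 at 5 & 27 at 44 & 36 at 350 & [])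
  (1458 ⊢ 4 at 58 & 7 at 44 & 17 at 269 & 31 at 8090 & []) (7101 ⊢ 2 at 9 & 4 at 14 & 22 at 719 & 36 at 2699 & [])
  (1458 ⊢ 4 at 4 & 7 at 44 & 17 at 269 & 31 at 314 & []))
  (refuted (1 at 7260 & 4 at 22112 & 8 at 4439 & 9 at 1859 & 21 at 14579 & []))
  (refuted (0 at 15 & 17 at 314 & 18 at 944 & 30 at 2186 & 35 at 8504 & []))
  (refuted (2 at 15 & 17 at 278 & 18 at 3644 & 30 at 1214 & 35 at 3644 & []))
  (refuted (1 at 349 & 9 at 464 & 18 at 10880 & 25 at 7289 & 27 at 5021 & []))
  (refuted (2 at 4373 & 0 at 4776 & 9 at 6881 & 25 at 107891 & 27 at 67796 & [])))))
  (left (refuted (2 at 618 & 5 at 80 & 8 at 1130 & 15 at 809 & 30 at 107891 & []))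
  (left (refuted (2 at 4 & 8 at 47 & 35 at 2186 & []))
  (refuted (1 at 69 & 8 at 92 & 11 at 818 & 23 at 728 & 32 at 30617 & []))
  (refuted (0 at 15 & 14 at 314 & 15 at 944 & 27 at 2186 & 32 at 8504 & []))
  (refuted (2 at 15 & 14 at 278 & 15 at 3644 & 27 at 1214 & 32 at 3644 & []))
  (refuted (1 at 15 & 22 at 404 & 24 at 278 & 31 at 836 & 33 at 836 & []))
  (conclusion (suc zero) (6831 ⊢ 2 at 9 & 0 at 4 & 18 at 719 & [])
  (729 ⊢ 3 at 49 & 8 at 14 & 26 at 14 & 32 at 584 & []) (1458 ⊢ 0 at 24 & 3 at 65 & 8 at 479 & 24 at 5102 & [])
  (63 ⊢ 4 at 3 & 3 at 3 & 26 at 17 & []) (69984 ⊢ 0 at 24 & 3 at 1199 & 8 at 479 & 33 at 513944 & [])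
  (13122 ⊢ 0 at 9 & 4 at 454 & 3 at 24 & 14 at 1214 & [])))
  (refuted (1 at 1626 & 0 at 2746 & 5 at 1364 & 23 at 28430 & 25 at 153089 & []))
  (refuted (2 at 15 & 13 at 314 & 23 at 242 & 25 at 944 & 32 at 944 & []))
  (refuted (1 at 15 & 13 at 278 & 23 at 134 & 25 at 404 & 32 at 3644 & []))
  (refuted (0 at 349 & 8 at 464 & 15 at 809 & 20 at 557 & 32 at 10880 & [])))
  (refuted (1 at 15 & 16 at 26 & 18 at 104 & 25 at 314 & 27 at 314 & []))
  (refuted (0 at 15 & 16 at 14 & 18 at 44 & 25 at 1214 & 27 at 278 & [])))
  (refuted (2 at 47 & 9 at 4 & 14 at 14 & 18 at 404 & 23 at 278 & []))
  (refuted (0 at 47 & 9 at 8 & 14 at 34 & 18 at 104 & 23 at 314 & []))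
  (refuted (2 at 17 & 0 at 9 & 6 at 14 & 18 at 134 & 23 at 53 & []))
  (refuted (1 at 120 & 4 at 104 & 6 at 524 & 10 at 2 & 18 at 944 & [])))
  (left (refuted (2 at 47 & 9 at 4 & 14 at 14 & 18 at 404 & 23 at 278 & []))
  (refuted (1 at 9 & 0 at 4 & 3 at 2 & 18 at 80 & []))
  (refuted (0 at 78 & 3 at 80 & 6 at 320 & 10 at 14 & 19 at 350 & []))
  (left (refuted (2 at 9 & 6 at 14 & 13 at 1 & 26 at 404 & 25 at 926 & []))
  (conclusion (suc zero) (243 ⊢ 1 at 19 & 0 at 9 & 5 at 74 & 4 at 74 & [])
  (189 ⊢ 1 at 34 & 4 at 185 & 6 at 1049 & 13 at 152 & []) (243 ⊢ 1 at 9 & 5 at 49 & 4 at 24 & 27 at 1214 & [])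
  (45 ⊢ 6 at 89 & 13 at 0 & 22 at 134 & 25 at 395 & []) (666 ⊢ 1 at 4 & 0 at 9 & 13 at 74 & [])
  (6939 ⊢ 1 at 129 & 4 at 1154 & 6 at 4439 & 12 at 179 & [])) (refuted (0 at 4 & 6 at 47 & 21 at 80 & []))
  (refuted (2 at 9 & 6 at 47 & 9 at 116 & 18 at 53 & 21 at 80 & []))
  (refuted (1 at 15 & 16 at 26 & 18 at 104 & 25 at 314 & 27 at 314 & []))
  (refuted (0 at 15 & 16 at 14 & 18 at 44 & 25 at 1214 & 27 at 278 & [])))
  (refuted (2 at 1626 & 1 at 2746 & 3 at 1364 & 9 at 350 & 14 at 1889 & []))
  (refuted (0 at 47 & 9 at 8 & 14 at 34 & 18 at 104 & 23 at 314 & []))))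
  (refuted (0 at 80 & 7 at 9 & 11 at 9 & 9 at 7 & 12 at 44 & []))
  (refuted (2 at 206 & 1 at 116 & 7 at 19 & 9 at 5 & 12 at 14 & [])))
  (refuted (1 at 17 & 0 at 9 & 6 at 14 & 13 at 161 & 15 at 1214 & []))
  (refuted (2 at 4 & 5 at 2 & 6 at 14 & 17 at 80 & 15 at 404 & []))
  (refuted (1 at 3 & 8 at 14 & 10 at 44 & 13 at 80 & 15 at 404 & []))
  (refuted (2 at 22 & 0 at 12 & 10 at 44 & 13 at 161 & 15 at 1619 & [])))
  (right (refuted (1 at 22 & 0 at 9 & 10 at 44 & 13 at 161 & 15 at 1619 & []))
  (refuted (2 at 9 & 0 at 4 & 3 at 2 & 15 at 728 & []))
  (refuted (1 at 4 & 3 at 7 & 10 at 74 & 14 at 269 & 15 at 593 & []))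
  (refuted (0 at 0 & 10 at 29 & 14 at 68 & 13 at 38 & 15 at 44 & []))
  (refuted (0 at 1 & 6 at 2 & 17 at 161 & 15 at 80 & []))
  (right (refuted (1 at 0 & 12 at 8 & 17 at 278 & 16 at 152 & 20 at 26 & []))
  (left (refuted (1 at 485 & 0 at 242 & 3 at 0 & 9 at 38 & []))
  (refuted (2 at 3644 & 5 at 17 & 3 at 22 & 9 at 194 & 16 at 1052 & []))
  (left (refuted (0 at 479 & 8 at 4 & 11 at 31 & 23 at 1871 & 26 at 1574 & []))
  (refuted (2 at 47 & 8 at 0 & 26 at 314 & [])) (refuted (2 at 44 & 11 at 1 & 10 at 3 & 23 at 116 & 22 at 233 & []))
  (refuted (1 at 44 & 11 at 3 & 10 at 1 & 23 at 233 & 22 at 116 & []))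
  (refuted (2 at 14 & 0 at 29 & 11 at 1 & 23 at 116 & []))
  (refuted (1 at 44 & 11 at 3 & 10 at 1 & 23 at 233 & 22 at 116 & [])))
  (left (refuted (2 at 44 & 11 at 1 & 10 at 3 & 23 at 116 & 22 at 233 & []))
  (refuted (1 at 44 & 11 at 3 & 10 at 1 & 23 at 233 & 22 at 116 & []))
  (refuted (0 at 479 & 8 at 4 & 11 at 31 & 23 at 1871 & 26 at 1574 & []))
  (refuted (2 at 14 & 1 at 29 & 11 at 1 & 23 at 116 & []))
  (left (refuted (1 at 5 & 15 at 4 & 26 at 74 & 25 at 32 & 29 at 89 & []))
  (conclusion (suc zero) (486 ⊢ 2 at 566 & 11 at 24 & 14 at 65 & 15 at 479 & [])
  (21 ⊢ 0 at 1 & 14 at 3 & 13 at 3 & []) (333 ⊢ 2 at 119 & 11 at 4 & 9 at 9 & [])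
  (729 ⊢ 0 at 4 & 6 at 194 & 14 at 149 & 15 at 44 & []) (4374 ⊢ 11 at 9 & 14 at 24 & 13 at 454 & 21 at 1214 & [])
  (23328 ⊢ 11 at 24 & 14 at 1199 & 15 at 479 & 29 at 171314 & []))
  (refuted (2 at 4 & 16 at 1 & 21 at 29 & 29 at 38 & 27 at 23 & []))
  (refuted (1 at 22 & 0 at 12 & 21 at 179 & 26 at 53 & 29 at 44 & []))
  (refuted (2 at 890 & 0 at 449 & 11 at 4 & 21 at 6659 & 26 at 1997 & []))
  (refuted (1 at 1106 & 4 at 944 & 11 at 69 & 13 at 200 & 21 at 4409 & [])))
  (refuted (0 at 8 & 12 at 4 & 18 at 47 & [])))
  (refuted (0 at 21869 & 5 at 241 & 3 at 81 & 7 at 194 & 16 at 9476 & []))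
  (refuted (2 at 728 & 1 at 1457 & 5 at 15 & 8 at 12 & 7 at 25 & [])))
  (refuted (2 at 4 & 5 at 2 & 8 at 29 & 9 at 89 & 17 at 242 & []))
  (refuted (0 at 0 & 8 at 2 & 9 at 8 & 17 at 242 & [])) (refuted (0 at 4 & 6 at 47 & 18 at 728 & []))
  (refuted (1 at 1 & 4 at 2 & 6 at 5 & 9 at 53 & 13 at 80 & []))))
  (refuted (0 at 7 & 3 at 2 & 7 at 50 & 10 at 188 & 14 at 134 & []))
  (refuted (2 at 5 & 1 at 4 & 7 at 29 & 10 at 134 & 14 at 107 & []))))
  (right (refuted (0 at 0 & 5 at 5 & 7 at 5 & 11 at 23 & 9 at 2 & []))
  (refuted (2 at 0 & 5 at 5 & 7 at 11 & 11 at 20 & 9 at 5 & [])) (right (refuted (2 at 0 & 8 at 14 & 14 at 26 & []))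
  (right (refuted (1 at 1 & 4 at 2 & 8 at 5 & 11 at 53 & 13 at 80 & []))
  (refuted (2 at 6 & 0 at 1 & 4 at 11 & 8 at 53 & 11 at 80 & []))
  (refuted (2 at 0 & 11 at 14 & 9 at 29 & 14 at 53 & []))
  (refuted (0 at 6 & 3 at 2 & 6 at 32 & 11 at 89 & 16 at 161 & []))
  (refuted (2 at 0 & 0 at 1 & 11 at 8 & 17 at 161 & []))
  (refuted (1 at 0 & 11 at 11 & 9 at 14 & 14 at 26 & 17 at 80 & [])))
  (refuted (1 at 0 & 0 at 0 & 11 at 14 & 10 at 29 & 14 at 17 & []))
  (refuted (2 at 0 & 11 at 14 & 10 at 29 & 14 at 17 & []))
  (refuted (1 at 0 & 5 at 2 & 11 at 47 & 10 at 14 & 14 at 8 & []))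
  (refuted (2 at 0 & 0 at 1 & 5 at 5 & 11 at 80 & [])))
  (right (refuted (1 at 4 & 4 at 8 & 7 at 20 & 11 at 107 & 14 at 53 & []))
  (refuted (2 at 0 & 11 at 14 & 10 at 29 & 14 at 17 & [])) (refuted (2 at 0 & 8 at 14 & 14 at 26 & []))
  (refuted (0 at 1 & 3 at 2 & 8 at 5 & 11 at 53 & 12 at 26 & []))
  (right (refuted (2 at 0 & 11 at 14 & 9 at 29 & 14 at 53 & []))
  (refuted (1 at 0 & 3 at 1 & 11 at 2 & 9 at 26 & 17 at 53 & []))
  (refuted (0 at 0 & 3 at 0 & 7 at 4 & 6 at 3 & 17 at 80 & []))
  (refuted (2 at 0 & 1 at 1 & 11 at 8 & 17 at 161 & []))
  (refuted (2 at 0 & 3 at 5 & 11 at 14 & 9 at 65 & 13 at 53 & []))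
  (refuted (0 at 0 & 11 at 29 & 9 at 14 & 14 at 53 & 13 at 53 & [])))
  (left (refuted (0 at 44 & 5 at 7 & 9 at 14 & 13 at 89 & 17 at 53 & []))
  (refuted (2 at 71 & 5 at 6 & 6 at 8 & 9 at 56 & 13 at 206 & []))
  (refuted (2 at 17 & 5 at 0 & 4 at 1 & 14 at 8 & [])) (left (refuted (2 at 0 & 10 at 0 & 17 at 2 & 19 at 2 & []))
  (refuted (1 at 4 & 4 at 2 & 10 at 0 & 17 at 29 & 19 at 29 & []))
  (refuted (0 at 5 & 8 at 0 & 12 at 11 & 17 at 44 & 20 at 17 & [])) (refuted (2 at 4 & 8 at 0 & 20 at 47 & []))
  (left (left (refuted (1 at 4 & 10 at 38 & 9 at 77 & 16 at 17 & 15 at 35 & []))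
  (refuted (0 at 4 & 10 at 77 & 9 at 38 & 16 at 35 & 15 at 17 & []))
  (refuted (2 at 9 & 1 at 4 & 10 at 116 & 16 at 53 & []))
  (refuted (0 at 4 & 10 at 77 & 9 at 38 & 16 at 35 & 15 at 17 & []))
  (refuted (2 at 159 & 7 at 524 & 10 at 1871 & 13 at 134 & 16 at 863 & []))
  (refuted (1 at 15 & 7 at 104 & 13 at 26 & [])))
  (left (refuted (2 at 159 & 7 at 524 & 10 at 1871 & 13 at 134 & 16 at 863 & []))
  (refuted (1 at 4 & 0 at 9 & 10 at 116 & 16 at 53 & []))
  (left (refuted (1 at 4 & 11 at 23 & 10 at 38 & 21 at 161 & 29 at 809 & []))
  (refuted (2 at 12 & 0 at 22 & 10 at 44 & 13 at 161 & 29 at 4859 & []))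
  (refuted (2 at 49 & 1 at 98 & 13 at 665 & 16 at 44 & 29 at 19979 & []))
  (refuted (0 at 40 & 3 at 34 & 16 at 209 & 18 at 602 & 29 at 4409 & []))
  (refuted (0 at 1 & 10 at 29 & 13 at 74 & 12 at 32 & 23 at 134 & []))
  (conclusion (suc zero) (81 ⊢ 16 at 9 & 19 at 24 & 18 at 49 & 29 at 404 & [])
  (135 ⊢ 1 at 0 & 10 at 134 & 13 at 395 & 23 at 809 & []) (81 ⊢ 16 at 19 & 19 at 64 & 18 at 84 & 23 at 89 & [])
  (63 ⊢ 1 at 16 & 16 at 34 & 19 at 185 & 23 at 1049 & [])
  (2313 ⊢ 2 at 19 & 16 at 129 & 19 at 1154 & 23 at 4439 & []) (666 ⊢ 1 at 24 & 17 at 29 & 16 at 14 & [])))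
  (refuted (2 at 0 & 14 at 2 & 26 at 62 & [])) (refuted (1 at 4 & 10 at 38 & 9 at 77 & 16 at 17 & 15 at 35 & []))
  (refuted (0 at 4 & 10 at 77 & 9 at 38 & 16 at 35 & 15 at 17 & [])))
  (refuted (2 at 269 & 11 at 81 & 10 at 241 & 12 at 194 & 21 at 3158 & []))
  (refuted (1 at 8 & 0 at 17 & 10 at 15 & 13 at 12 & 12 at 25 & []))
  (refuted (2 at 2 & 0 at 5 & 11 at 0 & 17 at 38 & []))
  (refuted (1 at 44 & 11 at 22 & 10 at 17 & 17 at 194 & 21 at 350 & [])))
  (refuted (0 at 26 & 8 at 0 & 7 at 0 & 10 at 31 & 9 at 15 & [])))
  (refuted (2 at 89 & 0 at 206 & 5 at 19 & 6 at 5 & 9 at 14 & []))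
  (refuted (2 at 4 & 1 at 9 & 5 at 0 & 17 at 2 & [])))) (refuted (2 at 0 & 0 at 1 & 5 at 5 & 11 at 26 & []))
  (refuted (2 at 0 & 1 at 1 & 5 at 5 & 11 at 26 & [])))

module Proof (em : ExcludedMiddle 0ℓ) (ℝ : RealNumbers) where

  open RealNumbers ℝ
  open Rotations ℝ renaming (fromℕ to ι)
  open CommutativeRing commutativeRing
    using (refl; sym; trans; reflexive; setoid; +-cong; +-congˡ; +-congʳ; *-cong; *-congˡ; *-congʳ; -‿cong
          ; +-identityˡ; +-identityʳ; *-identityˡ; *-identityʳ; zeroˡ; zeroʳ; +-assoc; +-comm; *-comm; *-assoc; -‿inverseʳ; ring)
  open IsTotalOrder isTotalOrder using (total; antisym; ≤-respˡ-≈; ≤-respʳ-≈)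
    renaming (trans to ≤-trans; reflexive to ≤-reflexive; refl to ≤-refl)
  import Algebra.Properties.Ring ring as Ringₚ
  import Algebra.Properties.Semiring.Exp semiring as Expₚ
  import Algebra.Properties.Semiring.Mult semiring as Multₚ
  import Algebra.Properties.Semiring.Sum semiring as Sumₚ

  -- The embedding of the integers and the ring solver

  byContradiction : {P : Set} → (¬ P → ⊥) → P
  byContradiction {P} f with em {P}
  ... | yes p = p
  ... | no ¬p = ⊥-elim (f ¬p)

  fromℕ-+ : ∀ m n → ι (m ℕ.+ n) ≈ ι m + ι n
  fromℕ-+ = Multₚ.×-homo-+ 1#

  fromℕ-* : ∀ m n → ι (m ℕ.* n) ≈ ι m * ι n
  fromℕ-* m n = sym (Multₚ.idem-×-homo-* m n (*-identityˡ 1#))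

  fromℤ-neg : ∀ i → fromℤ (ℤ.- i) ≈ - fromℤ i
  fromℤ-neg (+ zero)  = sym Ringₚ.-0#≈0#
  fromℤ-neg (+ suc n) = refl
  fromℤ-neg -[1+ n ]  = sym (Ringₚ.-‿involutive _)

  private
    cancel-suc : ∀ x y → (1# + x) - (1# + y) ≈ x - y
    cancel-suc x y = begin
      (1# + x) + - (1# + y)      ≈⟨ +-cong (+-comm 1# x) (sym (Ringₚ.-‿+-comm 1# y)) ⟩
      (x + 1#) + (- 1# + - y)    ≈⟨ +-assoc _ _ _ ⟩
      x + (1# + (- 1# + - y))    ≈⟨ +-congˡ (sym (+-assoc _ _ _)) ⟩
      x + ((1# + - 1#) + - y)    ≈⟨ +-congˡ (+-congʳ (-‿inverseʳ 1#)) ⟩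
      x + (0# + - y)             ≈⟨ +-congˡ (+-identityˡ _) ⟩
      x - y                      ∎
      where
      open import Relation.Binary.Reasoning.Setoid setoid

  fromℤ-⊖ : ∀ m n → fromℤ (m ℤ.⊖ n) ≈ ι m - ι n
  fromℤ-⊖ zero    zero    = sym (-‿inverseʳ 0#)
  fromℤ-⊖ zero    (suc n) = sym (+-identityˡ _)
  fromℤ-⊖ (suc m) zero    = sym (trans (+-congˡ Ringₚ.-0#≈0#) (+-identityʳ _))
  fromℤ-⊖ (suc m) (suc n) =
    trans (reflexive (≡.cong fromℤ (ℤ.[1+m]⊖[1+n]≡m⊖n m n)))
    (trans (fromℤ-⊖ m n) (sym (cancel-suc (ι m) (ι n))))

  fromℤ-+ : ∀ i j → fromℤ (i ℤ.+ j) ≈ fromℤ i + fromℤ j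
  fromℤ-+ (+ m)    (+ n)    = fromℕ-+ m n
  fromℤ-+ (+ m)    -[1+ n ] = fromℤ-⊖ m (suc n)
  fromℤ-+ -[1+ m ] (+ n)    = trans (fromℤ-⊖ n (suc m)) (+-comm _ _)
  fromℤ-+ -[1+ m ] -[1+ n ] = trans
    (-‿cong (trans (reflexive (≡.cong ι (≡.cong suc (≡.sym (ℕ.+-suc m n))))) (fromℕ-+ (suc m) (suc n))))
    (sym (Ringₚ.-‿+-comm _ _))

  fromℤ-* : ∀ i j → fromℤ (i ℤ.* j) ≈ fromℤ i * fromℤ j
  fromℤ-* (+ m) (+ n) = trans (reflexive (≡.cong fromℤ (≡.sym (ℤ.pos-* m n)))) (fromℕ-* m n)
  fromℤ-* (+ m) -[1+ n ] = trans (reflexive (≡.cong fromℤ (≡.sym (ℤ.neg-distribʳ-* (+ m) (+ suc n)))))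
    (trans (fromℤ-neg (+ m ℤ.* + suc n)) (trans (-‿cong (fromℤ-* (+ m) (+ suc n))) (Ringₚ.-‿distribʳ-* _ _)))
  fromℤ-* -[1+ m ] j = trans (reflexive (≡.cong fromℤ (≡.sym (ℤ.neg-distribˡ-* (+ suc m) j))))
    (trans (fromℤ-neg (+ suc m ℤ.* j)) (trans (-‿cong (pos-case j)) (Ringₚ.-‿distribˡ-* _ _)))
    where
    pos-case : ∀ j → fromℤ (+ suc m ℤ.* j) ≈ ι (suc m) * fromℤ j
    pos-case (+ n) = trans (reflexive (≡.cong fromℤ (≡.sym (ℤ.pos-* (suc m) n)))) (fromℕ-* (suc m) n)
    pos-case -[1+ n ] = trans (reflexive (≡.cong fromℤ (≡.sym (ℤ.neg-distribʳ-* (+ suc m) (+ suc n)))))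
      (trans (fromℤ-neg (+ suc m ℤ.* + suc n))
      (trans (-‿cong (trans (reflexive (≡.cong fromℤ (≡.sym (ℤ.pos-* (suc m) (suc n))))) (fromℕ-* (suc m) (suc n))))
        (Ringₚ.-‿distribʳ-* _ _)))

  private
    -- With integer coefficients, whose equality is decidable, the solver computes with numerals
    -- instead of treating them as atoms.
    morphism : ℤ.+-*-rawRing -Raw-AlmostCommutative⟶ fromCommutativeRing commutativeRing
    morphism = record
      { ⟦_⟧ = fromℤ ; +-homo = fromℤ-+ ; *-homo = fromℤ-* ; -‿homo = fromℤ-neg
      ; 0-homo = refl ; 1-homo = +-identityʳ 1# }

    weaklyDec : ∀ i j → _
    weaklyDec i j with i ℤ.≟ j
    ... | yes i≡j = just (reflexive (≡.cong fromℤ i≡j))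
    ... | no  _   = nothing

  open import Algebra.Solver.Ring ℤ.+-*-rawRing (fromCommutativeRing commutativeRing) morphism weaklyDec
    using (Polynomial; solve; con; _:=_; _:+_; _:*_; _:-_; :-_)

  infix 10 #_
  #_ : ∀ {n} → ℕ → Polynomial n
  # k = con (+ k)

  -- Ordered fields

  ≤-by : ∀ {x y z} → 0# ≤ z → y ≈ x + z → x ≤ y
  ≤-by {x} {y} {z} 0≤z eq = ≤-respʳ-≈ (trans (+-comm z x) (sym eq)) (≤-respˡ-≈ (+-identityˡ x) (+-monoˡ-≤ x 0≤z))

  ≤⇒0≤- : ∀ {x y} → x ≤ y → 0# ≤ y - x
  ≤⇒0≤- {x} x≤y = ≤-respˡ-≈ (-‿inverseʳ x) (+-monoˡ-≤ (- x) x≤y)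

  <⇒≤ : ∀ {x y} → x < y → x ≤ y
  <⇒≤ = proj₁

  <-by : ∀ {x y z} → 0# < z → y ≈ x + z → x < y
  <-by {x} {y} {z} (0≤z , 0≉z) eq = ≤-by 0≤z eq , λ x≈y →
    0≉z (trans (sym (-‿inverseʳ x)) (trans (+-congʳ (trans x≈y eq))
      (solve 2 (λ x z → (x :+ z) :- x := z) refl x z)))

  <⇒0<- : ∀ {x y} → x < y → 0# < y - x
  <⇒0<- {x} {y} (x≤y , x≉y) = ≤⇒0≤- x≤y , λ 0≈ → x≉y
    (trans (sym (+-identityʳ x)) (trans (+-congˡ 0≈) (solve 2 (λ x y → x :+ (y :- x) := y) refl x y)))

  ≮⇒≥ : ∀ {x y} → ¬ x < y → y ≤ x
  ≮⇒≥ {x} {y} x≮y with total x y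
  ... | inj₂ y≤x = y≤x
  ... | inj₁ x≤y = ≤-reflexive (sym (byContradiction λ x≉y → x≮y (x≤y , x≉y)))

  ≰⇒> : ∀ {x y} → ¬ x ≤ y → y < x
  ≰⇒> {x} {y} x≰y with total x y
  ... | inj₁ x≤y = ⊥-elim (x≰y x≤y)
  ... | inj₂ y≤x = y≤x , λ y≈x → x≰y (≤-reflexive (sym y≈x))

  <⇒≱ : ∀ {x y} → x < y → ¬ y ≤ x
  <⇒≱ (x≤y , x≉y) y≤x = x≉y (antisym x≤y y≤x)

  ≤-<-trans : ∀ {x y z} → x ≤ y → y < z → x < z
  ≤-<-trans x≤y y<z = ≰⇒> λ z≤x → <⇒≱ y<z (≤-trans z≤x x≤y)

  <-≤-trans : ∀ {x y z} → x < y → y ≤ z → x < z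
  <-≤-trans x<y y≤z = ≰⇒> λ z≤x → <⇒≱ x<y (≤-trans y≤z z≤x)

  <-resp : ∀ {x y x′ y′} → x ≈ x′ → y ≈ y′ → x < y → x′ < y′
  <-resp x≈ y≈ x<y = ≤-<-trans (≤-reflexive (sym x≈)) (<-≤-trans x<y (≤-reflexive y≈))

  ≤-resp : ∀ {x y x′ y′} → x ≈ x′ → y ≈ y′ → x ≤ y → x′ ≤ y′
  ≤-resp x≈ y≈ x≤y = ≤-respˡ-≈ x≈ (≤-respʳ-≈ y≈ x≤y)

  ≤∨> : ∀ x y → x ≤ y ⊎ y < x
  ≤∨> x y with em {x ≤ y}
  ... | yes p = inj₁ p
  ... | no ¬p = inj₂ (≰⇒> ¬p)

  infixl 6 _⊕_ _⊕<_
  _⊕_ : ∀ {x y} → 0# ≤ x → 0# ≤ y → 0# ≤ x + y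
  _⊕_ {x} {y} 0≤x 0≤y = ≤-trans 0≤x (≤-by 0≤y refl)

  _⊕<_ : ∀ {x y} → 0# ≤ x → 0# < y → 0# < x + y
  _⊕<_ {x} {y} 0≤x 0<y = ≤-<-trans 0≤x (<-by 0<y refl)

  infixl 7 _⊛_
  _⊛_ : ∀ {x y} → 0# ≤ x → 0# ≤ y → 0# ≤ x * y
  _⊛_ = *-nonNegative

  -- The axioms give only the weak inequality. If the product vanished, multiplication by `x ⁻¹`
  -- would make `y` vanish.
  *-pos : ∀ {x y} → 0# < x → 0# < y → 0# < x * y
  *-pos {x} {y} (0≤x , 0≉x) (0≤y , 0≉y) = *-nonNegative 0≤x 0≤y , λ 0≈xy → 0≉y
    (trans (sym (zeroʳ (x ⁻¹))) (trans (*-congˡ 0≈xy) (trans (sym (*-assoc _ _ _))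
      (trans (*-congʳ (trans (*-comm _ _) (⁻¹-inverseʳ x (λ x≈0 → 0≉x (sym x≈0))))) (*-identityˡ y)))))

  0<1 : 0# < 1#
  0<1 with total 0# 1#
  ... | inj₁ 0≤1 = 0≤1 , 0≉1
  ... | inj₂ 1≤0 = ⊥-elim (0≉1 (antisym (≤-respʳ-≈
    (trans (solve 0 ((# 0 :- # 1) :* (# 0 :- # 1) := # 1) refl) (+-identityʳ 1#))
    (0≤-1 ⊛ 0≤-1)) 1≤0))
    where
    0≤-1 : 0# ≤ 0# - ι 1
    0≤-1 = ≤-respʳ-≈ (+-congˡ (-‿cong (sym (+-identityʳ 1#)))) (≤⇒0≤- 1≤0)

  0≤fromℕ : ∀ n → 0# ≤ ι n
  0≤fromℕ zero    = ≤-refl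
  0≤fromℕ (suc n) = <⇒≤ 0<1 ⊕ 0≤fromℕ n

  0<fromℕ : ∀ n → 0# < ι (suc n)
  0<fromℕ n = <-≤-trans 0<1 (≤-by (0≤fromℕ n) refl)

  fromℕ-mono : ∀ {m n} → m ℕ.≤ n → ι m ≤ ι n
  fromℕ-mono {m} {n} m≤n = ≤-by (0≤fromℕ (n ℕ.∸ m))
    (trans (reflexive (≡.cong ι (≡.sym (ℕ.m+[n∸m]≡n m≤n)))) (fromℕ-+ m (n ℕ.∸ m)))

  0≤x² : ∀ x → 0# ≤ x * x
  0≤x² x with total 0# x
  ... | inj₁ 0≤x = 0≤x ⊛ 0≤x
  ... | inj₂ x≤0 = ≤-respʳ-≈ (solve 1 (λ x → (# 0 :- x) :* (# 0 :- x) := x :* x) refl x) (≤⇒0≤- x≤0 ⊛ ≤⇒0≤- x≤0)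

  inverse-pos : ∀ {x} → 0# < x → 0# < x ⁻¹
  inverse-pos {x} 0<x = ≰⇒> λ x⁻¹≤0 → <⇒≱ 0<1 (≤-by (<⇒≤ 0<x ⊛ ≤⇒0≤- x⁻¹≤0)
    (sym (trans (+-congˡ (trans (solve 2 (λ x y → x :* (# 0 :- y) := :- (x :* y)) refl x (x ⁻¹))
      (-‿cong (⁻¹-inverseʳ x (λ x≈0 → proj₂ 0<x (sym x≈0)))))) (-‿inverseʳ 1#))))

  -- Consequences of completeness

  -- `ι 1` unfolds to `1# + 0#`, so the solver's numeral 1 and the unit of the field have to be
  -- exchanged by hand.
  fromℕ1≈1 : ι 1 ≈ 1#
  fromℕ1≈1 = +-identityʳ 1#

  -- The standard shape of the estimates below: the solver rewrites `y - x` as a sum of products of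
  -- nonnegative terms, and `_⊕_` and `_⊛_` assemble their signs.
  0≤-⇒≤ : ∀ {x y} → 0# ≤ y - x → x ≤ y
  0≤-⇒≤ {x} {y} p = ≤-by p (solve 2 (λ x y → y := x :+ (y :- x)) refl x y)

  0<-⇒< : ∀ {x y} → 0# < y - x → x < y
  0<-⇒< {x} {y} p = <-by p (solve 2 (λ x y → y := x :+ (y :- x)) refl x y)

  -- Otherwise the natural numbers have a supremum `s`. As n + 1 ≤ s for every n, also s - 1 is an
  -- upper bound, which is absurd.
  archimedean : ∀ x → ∃[ n ] (x < ι n)
  archimedean x = byContradiction λ none →
    let P = λ y → ∃[ n ] (y ≈ ι n)
        bounded : IsUpperBound _≤_ P x
        bounded = λ { y (n , y≈n) → ≮⇒≥ λ x<y → none (n , <-≤-trans x<y (≤-reflexive y≈n)) }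
        s , upper , least = complete P (0# , 0 , refl) (x , bounded)
        s≤s-1 : s ≤ s - ι 1
        s≤s-1 = least (s - ι 1) λ { y (n , y≈n) → 0≤-⇒≤ (≤-resp refl
          (trans (+-congˡ (-‿cong (trans (fromℕ-+ 1 n) (+-congˡ (sym y≈n)))))
            (solve 2 (λ s y → s :- (# 1 :+ y) := (s :- # 1) :- y) refl s y))
          (≤⇒0≤- (upper (ι (suc n)) (suc n , refl)))) }
    in <⇒≱ (0<fromℕ 0) (0≤-⇒≤ (≤-resp refl
         (solve 1 (λ s → (s :- # 1) :- s := # 0 :- # 1) refl s) (≤⇒0≤- s≤s-1)))

  archimedean-* : ∀ {x} K → 0# < x → ∃[ n ] (K < ι n * x)
  archimedean-* {x} K 0<x =
    let n , p = archimedean (K * x ⁻¹)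
    in n , 0<-⇒< (<-resp refl
         (trans (solve 4 (λ n K x y → (n :- K :* y) :* x := n :* x :- K :* (x :* y)) refl (ι n) K x (x ⁻¹))
           (+-congˡ (-‿cong (trans (*-congˡ (⁻¹-inverseʳ x (λ x≈0 → proj₂ 0<x (sym x≈0)))) (*-identityʳ K)))))
         (*-pos (<⇒0<- p) 0<x))

  half : Carrier
  half = ι 2 ⁻¹

  half+half : ∀ x → half * x + half * x ≈ x
  half+half x = trans (solve 2 (λ h x → h :* x :+ h :* x := (# 2 :* h) :* x) refl half x)
    (trans (*-congʳ (⁻¹-inverseʳ (ι 2) λ eq → proj₂ (0<fromℕ 1) (sym eq))) (*-identityˡ x))

  0<half : 0# < half
  0<half = inverse-pos (0<fromℕ 1)

  half^ : ℕ → Carrier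
  half^ zero    = ι 1
  half^ (suc n) = half * half^ n

  0<half^ : ∀ n → 0# < half^ n
  0<half^ zero    = 0<fromℕ 0
  0<half^ (suc n) = *-pos 0<half (0<half^ n)

  0≤half^ : ∀ n → 0# ≤ half^ n
  0≤half^ n = <⇒≤ (0<half^ n)

  half^-anti : ∀ k n → half^ (k ℕ.+ n) ≤ half^ n
  half^-anti zero n = ≤-refl
  half^-anti (suc k) n = ≤-trans (≤-by (0≤half^ (suc k ℕ.+ n)) (sym (half+half (half^ (k ℕ.+ n))))) (half^-anti k n)

  half^-small : ∀ n → ι (suc n) * half^ n ≤ ι 1
  half^-small zero    = ≤-reflexive (solve 0 (# 1 :* # 1 := # 1) refl)
  half^-small (suc n) = ≤-trans (≤-by (0≤fromℕ n ⊛ 0≤half^ (suc n))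
    (trans (*-cong (fromℕ-+ 1 n) (sym (half+half (half^ n))))
      (trans (solve 2 (λ n g → (# 1 :+ n) :* (g :+ g) := (# 2 :+ n) :* g :+ n :* g) refl (ι n) (half^ (suc n)))
        (+-congʳ (*-congʳ (sym (fromℕ-+ 2 n))))))) (half^-small n)

  -- If x were positive, n x would exceed K for some n. But (n + 1) 2⁻ⁿ ≤ 1, so (n + 1) x ≤ K.
  half^-limit : ∀ {x} K → 0# ≤ K → (∀ n → x ≤ K * half^ n) → x ≤ 0#
  half^-limit {x} K 0≤K bound = ≮⇒≥ λ 0<x →
    let n , K<nx = archimedean-* K 0<x
    in <⇒≱ (<-≤-trans K<nx (≤-by (<⇒≤ 0<x) (trans (*-congʳ (fromℕ-+ 1 n))
         (solve 2 (λ n x → (# 1 :+ n) :* x := n :* x :+ x) refl (ι n) x))))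
       (0≤-⇒≤ (≤-resp refl
         (solve 4 (λ n x K g → n :* (K :* g :- x) :+ K :* (# 1 :- n :* g) := K :- n :* x) refl (ι (suc n)) x K (half^ n))
         (0≤fromℕ (suc n) ⊛ ≤⇒0≤- (bound n) ⊕ 0≤K ⊛ ≤⇒0≤- (half^-small n))))

  -- Two-sided bounds and limits

  infix 4 _∈±_
  _∈±_ : Carrier → Carrier → Set
  x ∈± b = (- b ≤ x) × (x ≤ b)

  ±-resp : ∀ {x y b c} → x ≈ y → b ≈ c → x ∈± b → y ∈± c
  ±-resp x≈y b≈c (p , q) = ≤-resp (-‿cong b≈c) x≈y p , ≤-resp x≈y b≈c q

  ±-+ : ∀ {x y b c} → x ∈± b → y ∈± c → x + y ∈± b + c
  ±-+ {x} {y} {b} {c} (p , p′) (q , q′) =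
    0≤-⇒≤ (≤-resp refl (solve 4 (λ x y b c → (x :- (:- b)) :+ (y :- (:- c)) := (x :+ y) :- (:- (b :+ c))) refl x y b c) (≤⇒0≤- p ⊕ ≤⇒0≤- q)) ,
    0≤-⇒≤ (≤-resp refl (solve 4 (λ x y b c → (b :- x) :+ (c :- y) := (b :+ c) :- (x :+ y)) refl x y b c) (≤⇒0≤- p′ ⊕ ≤⇒0≤- q′))

  ±-neg : ∀ {x b} → x ∈± b → - x ∈± b
  ±-neg {x} {b} (p , q) =
    0≤-⇒≤ (≤-resp refl (solve 2 (λ x b → b :- x := (:- x) :- (:- b)) refl x b) (≤⇒0≤- q)) ,
    0≤-⇒≤ (≤-resp refl (solve 2 (λ x b → x :- (:- b) := b :- (:- x)) refl x b) (≤⇒0≤- p))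

  -- No case distinction on signs is needed: 2(bc - xy) = (b - x)(c + y) + (b + x)(c - y), and 2(bc
  -- + xy) = (b - x)(c - y) + (b + x)(c + y).
  ±-* : ∀ {x y b c} → x ∈± b → y ∈± c → x * y ∈± b * c
  ±-* {x} {y} {b} {c} (p , p′) (q , q′) = 0≤2⇒≤ lower , 0≤2⇒≤ upper
    where
    b+x = ≤⇒0≤- p
    b-x = ≤⇒0≤- p′
    c+y = ≤⇒0≤- q
    c-y = ≤⇒0≤- q′
    0≤2⇒≤ : ∀ {u v} → 0# ≤ (v - u) + (v - u) → u ≤ v
    0≤2⇒≤ {u} {v} h = 0≤-⇒≤ (≤-resp refl (trans (solve 2 (λ h w → h :* (w :+ w) := h :* w :+ h :* w) refl half (v - u)) (half+half (v - u))) (<⇒≤ 0<half ⊛ h))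
    upper : 0# ≤ (b * c - x * y) + (b * c - x * y)
    upper = ≤-resp refl (solve 4 (λ x y b c → (b :- x) :* (c :- (:- y)) :+ (x :- (:- b)) :* (c :- y) := (b :* c :- x :* y) :+ (b :* c :- x :* y)) refl x y b c)
      (b-x ⊛ (≤-resp refl (solve 2 (λ y c → y :- (:- c) := c :- (:- y)) refl y c) c+y) ⊕ b+x ⊛ c-y)
    lower : 0# ≤ (x * y - - (b * c)) + (x * y - - (b * c))
    lower = ≤-resp refl (solve 4 (λ x y b c → (b :- x) :* (c :- y) :+ (x :- (:- b)) :* (y :- (:- c)) := (x :* y :- (:- (b :* c))) :+ (x :* y :- (:- (b :* c)))) refl x y b c)
      (b-x ⊛ c-y ⊕ b+x ⊛ c+y)

  ±-weaken : ∀ {x b c} → b ≤ c → x ∈± b → x ∈± c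
  ±-weaken {x} {b} {c} b≤c (p , q) = ≤-trans (0≤-⇒≤ (≤-resp refl (solve 2 (λ b c → c :- b := (:- b) :- (:- c)) refl b c) (≤⇒0≤- b≤c))) p , ≤-trans q b≤c

  ±⇒∣∣≤ : ∀ {x b} → x ∈± b → ∣ x ∣ ≤ b
  ±⇒∣∣≤ {x} x∈ with total (- x) x
  ... | inj₁ _ = proj₂ x∈
  ... | inj₂ _ = proj₂ (±-neg x∈)

  -- Nested intervals: since g at least halves, the lower ends a - 2g increase and the upper ends a
  -- + 2g decrease. The limit is the supremum of the lower ends.
  converge : (a g : ℕ → Carrier) → (∀ n → 0# ≤ g n) → (∀ n → g (suc n) + g (suc n) ≤ g n) →
    (∀ n → a (suc n) - a n ∈± g n) → ∃[ L ] (∀ n → L - a n ∈± g n + g n)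
  converge a g 0≤g halving step = L , λ n →
      0≤-⇒≤ (≤-resp refl (solve 3 (λ L a g → L :- (a :- (g :+ g)) := (L :- a) :- (:- (g :+ g))) refl L (a n) (g n)) (≤⇒0≤- (upper (lo n) (n , refl)))) ,
      0≤-⇒≤ (≤-resp refl (solve 3 (λ L a g → (a :+ (g :+ g)) :- L := (g :+ g) :- (L :- a)) refl L (a n) (g n)) (≤⇒0≤- (least (hi n) λ { x (m , x≈) → ≤-resp (sym x≈) refl (lo≤hi m n) })))
    where
    lo hi : ℕ → Carrier
    lo n = a n - (g n + g n)
    hi n = a n + (g n + g n)
    lo-step : ∀ n → lo n ≤ lo (suc n)
    lo-step n = 0≤-⇒≤ (≤-resp refl (solve 4 (λ a a′ g g′ → ((a′ :- a) :- (:- g)) :+ (g :- (g′ :+ g′)) := (a′ :- (g′ :+ g′)) :- (a :- (g :+ g))) refl (a n) (a (suc n)) (g n) (g (suc n)))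
      (≤⇒0≤- (proj₁ (step n)) ⊕ ≤⇒0≤- (halving n)))
    hi-step : ∀ n → hi (suc n) ≤ hi n
    hi-step n = 0≤-⇒≤ (≤-resp refl (solve 4 (λ a a′ g g′ → (g :- (a′ :- a)) :+ (g :- (g′ :+ g′)) := (a :+ (g :+ g)) :- (a′ :+ (g′ :+ g′))) refl (a n) (a (suc n)) (g n) (g (suc n)))
      (≤⇒0≤- (proj₂ (step n)) ⊕ ≤⇒0≤- (halving n)))
    lo-mono : ∀ k n → lo n ≤ lo (k ℕ.+ n)
    lo-mono zero n = ≤-refl
    lo-mono (suc k) n = ≤-trans (lo-mono k n) (lo-step (k ℕ.+ n))
    hi-mono : ∀ k n → hi (k ℕ.+ n) ≤ hi n
    hi-mono zero n = ≤-refl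
    hi-mono (suc k) n = ≤-trans (hi-step (k ℕ.+ n)) (hi-mono k n)
    lo≤hi′ : ∀ n → lo n ≤ hi n
    lo≤hi′ n = ≤-by (0≤g n ⊕ 0≤g n ⊕ (0≤g n ⊕ 0≤g n)) (solve 2 (λ a g → a :+ (g :+ g) := (a :- (g :+ g)) :+ (g :+ g :+ (g :+ g))) refl (a n) (g n))
    lo≤hi : ∀ m n → lo m ≤ hi n
    lo≤hi m n = ≤-trans (lo-mono n m) (≤-trans (lo≤hi′ (n ℕ.+ m))
      (≤-respˡ-≈ (reflexive (≡.cong hi (ℕ.+-comm m n))) (hi-mono m n)))
    sup = complete (λ x → ∃[ n ] (x ≈ lo n)) (lo 0 , 0 , refl) (hi 0 , λ { x (m , x≈) → ≤-resp (sym x≈) refl (lo≤hi m 0) })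
    L = proj₁ sup
    upper = proj₁ (proj₂ sup)
    least = proj₂ (proj₂ sup)

  ⟶-intro : ∀ {a L} K → 0# ≤ K → (∀ n → L - a n ∈± K * half^ n) → a ⟶ L
  ⟶-intro {a} {L} K 0≤K bound δ 0<δ = N , λ n N≤n → ≤-<-trans
      (±⇒∣∣≤ (±-resp (solve 2 (λ L a → :- (L :- a) := a :- L) refl L (a n)) refl (±-neg (bound n))))
      (≤-<-trans (mono N n N≤n) small)
    where
    found : ∃[ N ] (K * half^ N < δ)
    found = byContradiction λ none → <⇒≱ 0<δ (half^-limit K 0≤K λ n → ≮⇒≥ λ p → none (n , p))
    N = proj₁ found
    small = proj₂ found

    mono : ∀ N n → N ℕ.≤ n → K * half^ n ≤ K * half^ N
    mono N n N≤n = 0≤-⇒≤ (≤-resp refl (solve 3 (λ K a b → K :* (a :- b) := K :* a :- K :* b) refl K (half^ N) (half^ n))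
      (0≤K ⊛ ≤⇒0≤- (≤-respˡ-≈ (reflexive (≡.cong half^ (ℕ.m∸n+n≡m N≤n))) (half^-anti (n ℕ.∸ N) N))))

  abstract
   -- Upward search from an integer -M below x; it ends because x lies below N, which is N + M steps
   -- away.
   floor : ∀ x → ∃[ i ] (fromℤ i ≤ x × x < fromℤ i + ι 1)
   floor x = let N , x<N = archimedean x
                 M , -x<M = archimedean (- x)
     in search (N ℕ.+ M) (ℤ.- (+ M))
          (≤-resp (sym (fromℤ-neg (+ M))) refl (0≤-⇒≤ (≤-resp refl (solve 2 (λ m x → m :- (:- x) := x :- (:- m)) refl (ι M) x) (≤⇒0≤- (<⇒≤ -x<M)))))
          (<-resp refl (trans (solve 2 (λ m n → n := (:- m) :+ (n :+ m)) refl (ι M) (ι N)) (+-cong (sym (fromℤ-neg (+ M))) (sym (fromℕ-+ N M)))) x<N)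
     where
     search : ∀ m i → fromℤ i ≤ x → x < fromℤ i + ι m → ∃[ i ] (fromℤ i ≤ x × x < fromℤ i + ι 1)
     search zero i p q = ⊥-elim (<⇒≱ (<-resp refl (+-identityʳ _) q) p)
     search (suc m) i p q with ≤∨> (fromℤ i + ι 1) x
     ... | inj₂ r = i , p , r
     ... | inj₁ r = search m (i ℤ.+ + 1) (≤-resp (sym (fromℤ-+ i (+ 1))) refl r)
           (<-resp refl (trans (+-congˡ (fromℕ-+ 1 m)) (trans (solve 2 (λ i m → i :+ (# 1 :+ m) := (i :+ # 1) :+ m) refl (fromℤ i) (ι m)) (+-congʳ (sym (fromℤ-+ i (+ 1)))))) q)

  -- Intermediate values and constancy on the interval from 0 to 2

  Interval : Set
  Interval = ∃[ x ] (0# ≤ x × x ≤ ι 2)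

  origin two : Interval
  origin = 0# , ≤-refl , 0≤fromℕ 2
  two    = ι 2 , 0≤fromℕ 2 , ≤-refl

  *-cancel-inverse : ∀ {L} z → 0# < L → L * (z * L ⁻¹) ≈ z
  *-cancel-inverse {L} z 0<L = trans (solve 3 (λ L z i → L :* (z :* i) := z :* (L :* i)) refl L z (L ⁻¹))
    (trans (*-congˡ (⁻¹-inverseʳ L λ L≈0 → proj₂ 0<L (sym L≈0))) (*-identityʳ z))

  *-cancel-≤ : ∀ {L x y} → 0# < L → L * x ≤ L * y → x ≤ y
  *-cancel-≤ {L} {x} {y} 0<L p = ≮⇒≥ λ y<x → <⇒≱ (0<-⇒< (<-resp refl
    (solve 3 (λ L x y → L :* (x :- y) := L :* x :- L :* y) refl L x y) (*-pos 0<L (<⇒0<- y<x)))) p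

  -- Take the supremum s of the points where f is at least c. If f(s) missed c by z, the Lipschitz
  -- bound would keep f from crossing c at distance less than z/L from s: below c this makes s - z/L
  -- an upper bound, above c it puts s + z/L into the set.
  intermediateValue : (f : Interval → Carrier) (L : Carrier) → 0# < L →
    (∀ d d′ → proj₁ d ≤ proj₁ d′ → f d′ - f d ∈± L * (proj₁ d′ - proj₁ d)) →
    ∀ c → c ≤ f origin → f two ≤ c → ∃[ d ] (f d ≈ c)
  intermediateValue f L 0<L lipschitz c c≤left right≤c = d , antisym fd≤c c≤fd
    where
    -- Membership in the interval is part of the predicate because `f` takes the bounds as
    -- arguments.
    P : Carrier → Set
    P x = Σ[ p ∈ (0# ≤ x × x ≤ ι 2) ] (c ≤ f (x , p))
    sup = complete P (0# , proj₂ origin , c≤left) (ι 2 , λ { x ((_ , x≤2) , _) → x≤2 })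
    s = proj₁ sup
    upper = proj₁ (proj₂ sup)
    least = proj₂ (proj₂ sup)
    0≤s = upper 0# (proj₂ origin , c≤left)
    s≤2 = least (ι 2) λ { x ((_ , x≤2) , _) → x≤2 }
    d : Interval
    d = s , 0≤s , s≤2
    η : Carrier → Carrier
    η z = z * L ⁻¹
    c≤fd : c ≤ f d
    c≤fd = ≮⇒≥ λ fd<c →
      let z = c - f d
          0<η = *-pos (<⇒0<- fd<c) (inverse-pos 0<L)
          s≤s-η : s ≤ s - η z
          s≤s-η = least (s - η z) λ { x (p , c≤fx) →
            let x≤s = upper x (p , c≤fx)
                η≤ : η z ≤ s - x
                η≤ = *-cancel-≤ 0<L (≤-resp (sym (*-cancel-inverse z 0<L)) refl (0≤-⇒≤ (≤-resp refl
                  (solve 4 (λ m c u v → (v :- (:- m)) :+ (u :- c) := m :- (c :- (v :+ u))) refl (L * (s - x)) c (f (x , p)) (f d - f (x , p)) ⟨≈⟩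
                   solve 4 (λ m c u w → m :- (c :- ((w :- u) :+ u)) := m :- (c :- w)) refl (L * (s - x)) c (f (x , p)) (f d))
                  (≤⇒0≤- (proj₁ (lipschitz (x , p) d x≤s)) ⊕ ≤⇒0≤- c≤fx))))
            in 0≤-⇒≤ (≤-resp refl (solve 3 (λ s x e → (s :- x) :- e := (s :- e) :- x) refl s x (η z)) (≤⇒0≤- η≤)) }
      in <⇒≱ 0<η (0≤-⇒≤ (≤-resp refl (solve 2 (λ s e → (s :- e) :- s := # 0 :- e) refl s (η z)) (≤⇒0≤- s≤s-η)))
      where
      _⟨≈⟩_ : ∀ {a b c} → a ≈ b → b ≈ c → a ≈ c
      _⟨≈⟩_ = trans
    fd≤c : f d ≤ c
    fd≤c = ≮⇒≥ λ c<fd →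
      let 0<η = *-pos (<⇒0<- c<fd) (inverse-pos 0<L)
      in case-split 0<η (≤∨> (s + η (f d - c)) (ι 2))
      where
      case-split : 0# < η (f d - c) → s + η (f d - c) ≤ ι 2 ⊎ ι 2 < s + η (f d - c) → ⊥
      case-split 0<η (inj₁ s+η≤2) = <⇒≱ 0<η (0≤-⇒≤ (≤-resp refl (solve 2 (λ s e → s :- (s :+ e) := # 0 :- e) refl s e)
          (≤⇒0≤- (upper (s + e) (proj₂ y , c≤fy)))))
        where
        e = η (f d - c)
        y : Interval
        y = s + e , (0≤s ⊕ <⇒≤ 0<η) , s+η≤2
        c≤fy : c ≤ f y
        c≤fy = 0≤-⇒≤ (≤-resp refl (trans
          (+-congˡ (-‿cong (-‿cong (trans (solve 3 (λ L s e → L :* ((s :+ e) :- s) := L :* e) refl L s e) (*-cancel-inverse (f d - c) 0<L)))))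
          (solve 3 (λ u w c → (u :- w) :- (:- (w :- c)) := u :- c) refl (f y) (f d) c))
          (≤⇒0≤- (proj₁ (lipschitz d y (≤-by (<⇒≤ 0<η) refl)))))
      -- Here s + η lies outside the interval. The end point 2 takes the place of s + η: as f has
      -- dropped to c there, 2 is at least η away from s.
      case-split 0<η (inj₂ 2<s+η) = <⇒≱ 2<s+η (0≤-⇒≤ (≤-resp refl
          (solve 3 (λ t s e → (t :- s) :- e := t :- (s :+ e)) refl (ι 2) s e) (≤⇒0≤- η≤)))
        where
        e = η (f d - c)
        η≤ : e ≤ ι 2 - s
        η≤ = *-cancel-≤ 0<L (≤-resp (sym (*-cancel-inverse (f d - c) 0<L)) refl (0≤-⇒≤ (≤-resp refl
          (solve 4 (λ m u w c → ((u :- w) :- (:- m)) :+ (c :- u) := m :- (w :- c)) refl (L * (ι 2 - s)) (f two) (f d) c)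
          (≤⇒0≤- (proj₁ (lipschitz d two s≤2)) ⊕ ≤⇒0≤- right≤c))))

  -- Bisecting n times improves the quadratic bound by a factor 2ⁿ.
  quadratic⇒constant : (f : Interval → Carrier) (K : Carrier) → 0# ≤ K →
    (∀ d d′ → proj₁ d ≤ proj₁ d′ → f d′ - f d ∈± K * ((proj₁ d′ - proj₁ d) * (proj₁ d′ - proj₁ d))) →
    ∀ d → f d ≈ f origin
  quadratic⇒constant f K 0≤K quadratic d = antisym (0≤-⇒≤ (≤-resp refl (swap (f d) (f origin)) (≤⇒0≤- (small (proj₂ ∘ bisect′)))))
    (0≤-⇒≤ (≤-resp refl (swap′ (f d) (f origin)) (≤⇒0≤- (small λ n → proj₂ (±-neg (bisect′ n))))))
    where
    δ² : Interval → Interval → Carrier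
    δ² d d′ = (proj₁ d′ - proj₁ d) * (proj₁ d′ - proj₁ d)
    swap : ∀ u v → 0# - (u - v) ≈ v - u
    swap = solve 2 (λ u v → # 0 :- (u :- v) := v :- u) refl
    swap′ : ∀ u v → 0# - - (u - v) ≈ u - v
    swap′ = solve 2 (λ u v → # 0 :- (:- (u :- v)) := u :- v) refl
    bisect : ∀ n d d′ → proj₁ d ≤ proj₁ d′ → f d′ - f d ∈± (K * δ² d d′) * half^ n
    bisect zero d d′ d≤d′ = ±-resp refl (solve 1 (λ z → z := z :* # 1) refl _) (quadratic d d′ d≤d′)
    bisect (suc n) d@(x , 0≤x , x≤2) d′@(y , 0≤y , y≤2) x≤y = ±-resp
      (solve 3 (λ u v w → (v :- u) :+ (w :- v) := w :- u) refl (f d) (f m) (f d′))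
      (trans (+-cong (*-congʳ (*-congˡ (*-cong m-x m-x))) (*-congʳ (*-congˡ (*-cong y-m y-m))))
        (trans (solve 4 (λ K z h g → (K :* ((h :* z) :* (h :* z))) :* g :+ (K :* ((h :* z) :* (h :* z))) :* g := h :* (K :* (z :* z) :* (h :* g)) :+ h :* (K :* (z :* z) :* (h :* g))) refl K (y - x) half (half^ n))
          (half+half _)))
      (±-+ (bisect n d m x≤m) (bisect n m d′ m≤y))
      where
      z = y - x
      m-x : (x + half * z) - x ≈ half * z
      m-x = solve 2 (λ x h → (x :+ h) :- x := h) refl x (half * z)
      y-m : y - (x + half * z) ≈ half * z
      y-m = trans (solve 3 (λ x y h → y :- (x :+ h) := (y :- x) :- h) refl x y (half * z))
        (trans (+-congʳ (sym (half+half z))) (solve 1 (λ h → (h :+ h) :- h := h) refl (half * z)))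
      0≤hz = <⇒≤ 0<half ⊛ ≤⇒0≤- x≤y
      x≤m′ : x ≤ x + half * z
      x≤m′ = ≤-by 0≤hz refl
      m≤y′ : x + half * z ≤ y
      m≤y′ = 0≤-⇒≤ (≤-resp refl (sym y-m) 0≤hz)
      m : Interval
      m = x + half * z , ≤-trans 0≤x x≤m′ , ≤-trans m≤y′ y≤2
      x≤m : proj₁ d ≤ proj₁ m
      x≤m = x≤m′
      m≤y : proj₁ m ≤ proj₁ d′
      m≤y = m≤y′
    bisect′ : ∀ n → f d - f origin ∈± (K * δ² origin d) * half^ n
    bisect′ n = bisect n origin d (proj₁ (proj₂ d))
    small : ∀ {u} → (∀ n → u ≤ (K * δ² origin d) * half^ n) → u ≤ 0#
    small = half^-limit (K * δ² origin d) (0≤K ⊛ 0≤x² _)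

  -- The intermediate value theorem above is for functions that fall through the value, hence it is
  -- applied to -x², which has Lipschitz constant 4 on the interval.
  sqrt : ∀ a → 0# ≤ a → a ≤ ι 4 → ∃[ x ] (x * x ≈ a)
  sqrt a 0≤a a≤4 =
    let d , eq = intermediateValue (λ d → - (proj₁ d * proj₁ d)) (ι 4) (0<fromℕ 3) lipschitz (- a)
          (0≤-⇒≤ (≤-resp refl (solve 1 (λ a → a := (:- (# 0 :* # 0)) :- (:- a)) refl a) 0≤a))
          (0≤-⇒≤ (≤-resp refl (solve 1 (λ a → # 4 :- a := (:- a) :- (:- (# 2 :* # 2))) refl a) (≤⇒0≤- a≤4)))
    in proj₁ d , trans (solve 1 (λ x → x :* x := :- (:- (x :* x))) refl (proj₁ d)) (trans (-‿cong eq) (solve 1 (λ a → :- (:- a) := a) refl a))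
    where
    lipschitz : ∀ (d d′ : Interval) → proj₁ d ≤ proj₁ d′ →
      - (proj₁ d′ * proj₁ d′) - - (proj₁ d * proj₁ d) ∈± ι 4 * (proj₁ d′ - proj₁ d)
    lipschitz (x , 0≤x , x≤2) (y , 0≤y , y≤2) x≤y =
      0≤-⇒≤ (≤-resp refl (solve 2 (λ x y → (y :- x) :* ((# 2 :- y) :+ (# 2 :- x)) := ((:- (y :* y)) :- (:- (x :* x))) :- (:- (# 4 :* (y :- x)))) refl x y)
        (≤⇒0≤- x≤y ⊛ (≤⇒0≤- y≤2 ⊕ ≤⇒0≤- x≤2))) ,
      0≤-⇒≤ (≤-resp refl (solve 2 (λ x y → (y :- x) :* (# 4 :+ (x :+ y)) := # 4 :* (y :- x) :- ((:- (y :* y)) :- (:- (x :* x)))) refl x y)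
        (≤⇒0≤- x≤y ⊛ (0≤fromℕ 4 ⊕ (0≤x ⊕ 0≤y))))

  -- The cosine and sine series

  1/_! : ℕ → Carrier
  1/ n ! = ι (n !) ⁻¹

  power : ℕ → Carrier → Carrier
  power m x = x ^ m * 1/ m !

  cosTerm sinTerm : Carrier → ℕ → Carrier
  cosTerm x k = (- 1#) ^ k * power (2 ℕ.* k) x
  sinTerm x k = (- 1#) ^ k * power (1 ℕ.+ 2 ℕ.* k) x

  -- `sum` unfolds at the front, whereas partial sums of a series grow at the end.
  sum-suc : ∀ (f : ℕ → Carrier) n → sum {suc n} (f ∘ toℕ) ≈ sum {n} (f ∘ toℕ) + f n
  sum-suc f n = trans (Sumₚ.sum-init-last {n} (f ∘ toℕ))
    (+-cong (Sumₚ.sum-cong-≋ {n} λ i → reflexive (≡.cong f (Fin.toℕ-inject₁ i)))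
            (reflexive (≡.cong f (Fin.toℕ-fromℕ n))))

  cosSum-suc : ∀ x n → cosSum x (suc n) ≈ cosSum x n + cosTerm x n
  cosSum-suc x = sum-suc (cosTerm x)

  sinSum-suc : ∀ x n → sinSum x (suc n) ≈ sinSum x n + sinTerm x n
  sinSum-suc x = sum-suc (sinTerm x)

  0<! : ∀ n → 0# < ι (n !)
  0<! n = <-≤-trans (0<fromℕ 0) (fromℕ-mono (ℕ.1≤n! n))

  !-inverse : ∀ n → ι (n !) * 1/ n ! ≈ 1#
  !-inverse n = ⁻¹-inverseʳ _ λ eq → proj₂ (0<! n) (sym eq)

  0<1/! : ∀ n → 0# < 1/ n !
  0<1/! n = inverse-pos (0<! n)

  1/!-suc : ∀ n → 1/ n ! ≈ ι (suc n) * 1/ (suc n) !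
  1/!-suc n = sym (trans (sym (*-identityʳ _)) (trans (*-congˡ (sym (!-inverse n)))
    (trans (solve 4 (λ s i f j → (s :* i) :* (f :* j) := ((s :* f) :* i) :* j) refl (ι (suc n)) (1/ (suc n) !) (ι (n !)) (1/ n !))
    (trans (*-congʳ (trans (*-congʳ (sym (fromℕ-* (suc n) (n !)))) (!-inverse (suc n)))) (*-identityˡ _)))))

  2^ : ℕ → Carrier
  2^ n = ι 2 ^ n

  0≤2^ : ∀ n → 0# ≤ 2^ n
  0≤2^ zero = <⇒≤ 0<1
  0≤2^ (suc n) = 0≤fromℕ 2 ⊛ 0≤2^ n

  2^*half^ : ∀ n → 2^ n * half^ n ≈ 1#
  2^*half^ zero = trans (*-identityˡ _) fromℕ1≈1
  2^*half^ (suc n) = trans (solve 3 (λ w h g → (# 2 :* w) :* (h :* g) := w :* (h :* g :+ h :* g)) refl (2^ n) half (half^ n))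
    (trans (*-congˡ (half+half (half^ n))) (2^*half^ n))

  -- The quotient 4ⁿ / n! is largest at n = 3 and n = 4, where it is 32/3; from there on each new
  -- factor of the factorial is at least 4.
  4^≤16! : ∀ n → 4 ℕ.^ n ℕ.≤ 16 ℕ.* n !
  4^≤16! 0 = ℕ.m≤m+n 1 15
  4^≤16! 1 = ℕ.m≤m+n 4 12
  4^≤16! 2 = ℕ.m≤m+n 16 16
  4^≤16! 3 = ℕ.m≤m+n 64 32
  4^≤16! (suc n@(suc (suc (suc _)))) = ℕ.≤-trans
    (ℕ.*-mono-≤ {4} {suc n} {4 ℕ.^ n} {16 ℕ.* n !} (ℕ.s≤s (ℕ.s≤s (ℕ.s≤s (ℕ.s≤s ℕ.z≤n)))) (4^≤16! n))
    (ℕ.≤-reflexive (*-left-comm (suc n) 16 (n !)))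
    where
    *-left-comm : ∀ a b c → a ℕ.* (b ℕ.* c) ≡ b ℕ.* (a ℕ.* c)
    *-left-comm a b c = ≡.trans (≡.sym (ℕ.*-assoc a b c)) (≡.trans (≡.cong (ℕ._* c) (ℕ.*-comm a b)) (ℕ.*-assoc b a c))

  2^*2^ : ∀ n → ι (4 ℕ.^ n) ≈ 2^ n * 2^ n
  2^*2^ zero = trans fromℕ1≈1 (sym (*-identityˡ 1#))
  2^*2^ (suc n) = trans (fromℕ-* 4 (4 ℕ.^ n)) (trans (*-congˡ (2^*2^ n))
    (solve 1 (λ w → # 4 :* (w :* w) := (# 2 :* w) :* (# 2 :* w)) refl (2^ n)))

  16half^ : ℕ → Carrier
  16half^ n = ι 16 * half^ n

  -- This replaces the factorial decay of the terms, for arguments up to 2, by a geometric one; it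
  -- is 4ⁿ ≤ 16 n! divided by 2ⁿ n!.
  2^/!≤16half^ : ∀ n → 2^ n * 1/ n ! ≤ 16half^ n
  2^/!≤16half^ n = 0≤-⇒≤ (≤-resp refl
    (trans (solve 4 (λ w i g f → (g :* i) :* (# 16 :* f :- w :* w) := # 16 :* g :* (f :* i) :- w :* (w :* g) :* i) refl (2^ n) (1/ n !) (half^ n) (ι (n !)))
      (+-cong (trans (*-congˡ (!-inverse n)) (*-identityʳ _)) (-‿cong (*-congʳ (trans (*-congˡ (2^*half^ n)) (*-identityʳ _))))))
    (0≤half^ n ⊛ <⇒≤ (0<1/! n) ⊛ ≤⇒0≤- (≤-resp (2^*2^ n) (fromℕ-* 16 (n !)) (fromℕ-mono (4^≤16! n)))))

  ^-bounds : ∀ {x} → 0# ≤ x → x ≤ ι 2 → ∀ n → (0# ≤ x ^ n) × (x ^ n ≤ 2^ n)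
  ^-bounds {x} 0≤x x≤2 zero = <⇒≤ 0<1 , ≤-refl
  ^-bounds {x} 0≤x x≤2 (suc n) = let p , q = ^-bounds 0≤x x≤2 n in
    0≤x ⊛ p , 0≤-⇒≤ (≤-resp refl (solve 3 (λ x u w → (# 2 :- x) :* u :+ # 2 :* (w :- u) := # 2 :* w :- x :* u) refl x (x ^ n) (2^ n))
      (≤⇒0≤- x≤2 ⊛ p ⊕ 0≤fromℕ 2 ⊛ ≤⇒0≤- q))

  nonneg⇒± : ∀ {x b} → 0# ≤ x → x ≤ b → x ∈± b
  nonneg⇒± {x} {b} 0≤x x≤b = ≤-trans (0≤-⇒≤ (≤-resp refl (solve 1 (λ b → b := # 0 :- (:- b)) refl b) (≤-trans 0≤x x≤b))) 0≤x , x≤b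

  *-monoʳ-≤ : ∀ {x y z} → 0# ≤ z → x ≤ y → x * z ≤ y * z
  *-monoʳ-≤ {x} {y} {z} 0≤z x≤y = 0≤-⇒≤ (≤-resp refl (solve 3 (λ x y z → (y :- x) :* z := y :* z :- x :* z) refl x y z) (≤⇒0≤- x≤y ⊛ 0≤z))

  *-monoˡ-≤ : ∀ {x y z} → 0# ≤ z → x ≤ y → z * x ≤ z * y
  *-monoˡ-≤ 0≤z x≤y = ≤-resp (*-comm _ _) (*-comm _ _) (*-monoʳ-≤ 0≤z x≤y)

  power-± : ∀ (d : Interval) m → power m (proj₁ d) ∈± 16half^ m
  power-± (x , 0≤x , x≤2) m = let p , q = ^-bounds 0≤x x≤2 m in
    nonneg⇒± (p ⊛ <⇒≤ (0<1/! m)) (≤-trans (*-monoʳ-≤ (<⇒≤ (0<1/! m)) q) (2^/!≤16half^ m))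

  -- The first-order Taylor remainder of the power with exponent n + 2; powers of exponent 0 and 1
  -- have none.
  remainder : ℕ → Carrier → Carrier → Carrier
  remainder n x y = y ^ (2 ℕ.+ n) - x ^ (2 ℕ.+ n) - ι (2 ℕ.+ n) * (y - x) * x ^ (1 ℕ.+ n)

  -- Induction along R(n+1) = y R(n) + (n + 2)(y - x)² xⁿ⁺¹. Both summands are nonnegative, and x
  -- and y are at most 2.
  remainder-bounds : ∀ (d d′ : Interval) n → let x = proj₁ d; y = proj₁ d′ in
    (0# ≤ remainder n x y) × (remainder n x y ≤ ι (2 ℕ.+ n) * ι (1 ℕ.+ n) * 2^ n * ((y - x) * (y - x)))
  remainder-bounds (x , _) (y , _) zero =
    ≤-resp refl (sym eq) (0≤x² (y - x)) , ≤-by (0≤x² (y - x)) (trans rhs (+-congʳ (sym eq)))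
    where
    eq : remainder 0 x y ≈ (y - x) * (y - x)
    eq = trans (+-cong (+-cong (*-congˡ (*-identityʳ y)) (-‿cong (*-congˡ (*-identityʳ x)))) (-‿cong (*-congˡ (*-identityʳ x))))
      (solve 2 (λ x y → y :* y :- x :* x :- # 2 :* (y :- x) :* x := (y :- x) :* (y :- x)) refl x y)
    rhs : ι 2 * ι 1 * 1# * ((y - x) * (y - x)) ≈ (y - x) * (y - x) + (y - x) * (y - x)
    rhs = trans (*-congʳ (*-identityʳ _)) (solve 1 (λ z → # 2 :* # 1 :* z := z :+ z) refl ((y - x) * (y - x)))
  remainder-bounds d@(x , 0≤x , x≤2) d′@(y , 0≤y , y≤2) (suc n) =
    ≤-resp refl (sym eq) (0≤y ⊛ p ⊕ 0≤fromℕ (2 ℕ.+ n) ⊛ 0≤δ² ⊛ px) ,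
    0≤-⇒≤ (≤-resp refl
      (trans (solve 6 (λ y w δ² n e u →
           (# 2 :- y) :* e :+ # 2 :* ((# 2 :+ n) :* (# 1 :+ n) :* w :* δ² :- e)
             :+ (# 2 :+ n) :* δ² :* (# 2 :* w :- u) :+ (# 2 :+ n) :* (# 2 :* w) :* δ²
           := (# 3 :+ n) :* (# 2 :+ n) :* (# 2 :* w) :* δ² :- (y :* e :+ (# 2 :+ n) :* δ² :* u))
         refl y (2^ n) δ² (ι n) (remainder n x y) (x ^ (1 ℕ.+ n)))
       (+-cong (*-congʳ (*-congʳ (*-cong (sym (fromℕ-+ 3 n)) (sym (fromℕ-+ 2 n)))))
         (-‿cong (trans (+-congˡ (*-congʳ (*-congʳ (sym (fromℕ-+ 2 n))))) (sym eq)))))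
      (≤⇒0≤- y≤2 ⊛ p ⊕ 0≤fromℕ 2 ⊛ ≤⇒0≤- (≤-resp refl (*-congʳ (*-congʳ (*-cong (fromℕ-+ 2 n) (fromℕ-+ 1 n)))) q)
        ⊕ 0≤2+n ⊛ 0≤δ² ⊛ ≤⇒0≤- qx ⊕ 0≤2+n ⊛ (0≤fromℕ 2 ⊛ 0≤2^ n) ⊛ 0≤δ²))
    where
    δ² = (y - x) * (y - x)
    0≤δ² = 0≤x² (y - x)
    0≤2+n : 0# ≤ ι 2 + ι n
    0≤2+n = 0≤fromℕ 2 ⊕ 0≤fromℕ n
    ih = remainder-bounds d d′ n
    p = proj₁ ih
    q = proj₂ ih
    px = proj₁ (^-bounds 0≤x x≤2 (1 ℕ.+ n))
    qx = proj₂ (^-bounds 0≤x x≤2 (1 ℕ.+ n))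
    eq : remainder (suc n) x y ≈ y * remainder n x y + ι (2 ℕ.+ n) * δ² * x ^ (1 ℕ.+ n)
    eq = trans (+-congˡ (-‿cong (*-congʳ (*-congʳ (fromℕ-+ 1 (2 ℕ.+ n))))))
      (solve 5 (λ x y m u v → y :* (y :* v) :- x :* (x :* u) :- (# 1 :+ m) :* (y :- x) :* (x :* u)
          := y :* (y :* v :- x :* u :- m :* (y :- x) :* u) :+ m :* ((y :- x) :* (y :- x)) :* u)
        refl x y (ι (2 ℕ.+ n)) (x ^ (1 ℕ.+ n)) (y ^ (1 ℕ.+ n)))

  -- Division by (n + 2)! turns the linear term into the preceding power over its factorial, and it
  -- cancels the factor (n + 2)(n + 1) of the bound. What remains is 2ⁿ / n!.
  power-remainder : ∀ (d d′ : Interval) n → let x = proj₁ d; y = proj₁ d′ in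
    power (2 ℕ.+ n) y - power (2 ℕ.+ n) x - (y - x) * power (1 ℕ.+ n) x ∈± 16half^ n * ((y - x) * (y - x))
  power-remainder d@(x , _) d′@(y , _) n = ±-resp (sym eq) refl (nonneg⇒± (p ⊛ 0≤i)
      (≤-trans (*-monoʳ-≤ 0≤i q) (≤-trans (≤-reflexive scaled) (*-monoʳ-≤ (0≤x² (y - x)) (2^/!≤16half^ n)))))
    where
    p = proj₁ (remainder-bounds d d′ n)
    q = proj₂ (remainder-bounds d d′ n)
    i = 1/ (2 ℕ.+ n) !
    0≤i = <⇒≤ (0<1/! (2 ℕ.+ n))
    eq : power (2 ℕ.+ n) y - power (2 ℕ.+ n) x - (y - x) * power (1 ℕ.+ n) x ≈ remainder n x y * i
    eq = trans (+-congˡ (-‿cong (*-congˡ (*-congˡ (1/!-suc (1 ℕ.+ n))))))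
      (solve 6 (λ v u i δ m w → v :* i :- u :* i :- δ :* (w :* (m :* i)) := (v :- u :- m :* δ :* w) :* i) refl
        (y ^ (2 ℕ.+ n)) (x ^ (2 ℕ.+ n)) i (y - x) (ι (2 ℕ.+ n)) (x ^ (1 ℕ.+ n)))
    scaled : ι (2 ℕ.+ n) * ι (1 ℕ.+ n) * 2^ n * ((y - x) * (y - x)) * i ≈ 2^ n * 1/ n ! * ((y - x) * (y - x))
    scaled = trans (solve 5 (λ a b w z i → a :* b :* w :* z :* i := w :* (b :* (a :* i)) :* z) refl (ι (2 ℕ.+ n)) (ι (1 ℕ.+ n)) (2^ n) ((y - x) * (y - x)) i)
      (*-congʳ (*-congˡ (trans (*-congˡ (sym (1/!-suc (1 ℕ.+ n)))) (sym (1/!-suc n)))))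

  sign-± : ∀ k {z b} → z ∈± b → (- 1#) ^ k * z ∈± b
  sign-± zero z∈ = ±-resp (sym (*-identityˡ _)) refl z∈
  sign-± (suc k) {z} z∈ = ±-resp (trans (sym (Ringₚ.-1*x≈-x _)) (sym (*-assoc _ _ _))) refl (±-neg (sign-± k z∈))

  increment : ∀ {x y z} → y ≈ x + z → y - x ≈ z
  increment {x} {y} {z} eq = trans (+-congʳ eq) (solve 2 (λ x z → (x :+ z) :- x := z) refl x z)

  2*suc : ∀ n → 2 ℕ.* suc n ≡ 2 ℕ.+ 2 ℕ.* n
  2*suc n = ℕ.*-suc 2 n

  0≤16half^ : ∀ n → 0# ≤ 16half^ n
  0≤16half^ n = 0≤fromℕ 16 ⊛ 0≤half^ n

  16half^-anti : ∀ k n → 16half^ (k ℕ.+ n) ≤ 16half^ n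
  16half^-anti k n = *-monoˡ-≤ (0≤fromℕ 16) (half^-anti k n)

  16half^-double : ∀ n → 16half^ (suc n) + 16half^ (suc n) ≈ 16half^ n
  16half^-double n = trans (solve 2 (λ c g → c :* g :+ c :* g := c :* (g :+ g)) refl (ι 16) (half^ (suc n)))
    (*-congˡ (half+half (half^ n)))

  -- Both series are dominated by the geometric series with terms 16 · 2⁻²ᵏ.
  halving : ∀ n → 16half^ (2 ℕ.* suc n) + 16half^ (2 ℕ.* suc n) ≤ 16half^ (2 ℕ.* n)
  halving n = ≤-trans (≤-reflexive (trans (reflexive (≡.cong (λ m → 16half^ m + 16half^ m) (2*suc n))) (16half^-double (1 ℕ.+ 2 ℕ.* n))))
    (16half^-anti 1 (2 ℕ.* n))

  abstract
   -- Kept abstract: everything later rests on the error bound, and the supremum behind the limit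
   -- should not be unfolded.
   cosine : ∀ (d : Interval) → ∃[ c ] (∀ n → c - cosSum (proj₁ d) n ∈± 16half^ (2 ℕ.* n) + 16half^ (2 ℕ.* n))
   cosine d = converge (cosSum (proj₁ d)) (λ n → 16half^ (2 ℕ.* n)) (λ n → 0≤16half^ (2 ℕ.* n)) halving
     λ n → ±-resp (sym (increment (cosSum-suc (proj₁ d) n))) refl (sign-± n (power-± d (2 ℕ.* n)))

   sine : ∀ (d : Interval) → ∃[ s ] (∀ n → s - sinSum (proj₁ d) n ∈± 16half^ (2 ℕ.* n) + 16half^ (2 ℕ.* n))
   sine d = converge (sinSum (proj₁ d)) (λ n → 16half^ (2 ℕ.* n)) (λ n → 0≤16half^ (2 ℕ.* n)) halving
     λ n → ±-resp (sym (increment (sinSum-suc (proj₁ d) n))) refl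
       (±-weaken (16half^-anti 1 (2 ℕ.* n)) (sign-± n (power-± d (1 ℕ.+ 2 ℕ.* n))))

  cos sin : Interval → Carrier
  cos d = proj₁ (cosine d)
  sin d = proj₁ (sine d)

  -- Weakened from 4⁻ⁿ to 2⁻ⁿ, the shape in which `⟶-intro` and `limit-±` take their errors.
  tail-bound : ∀ n → 16half^ (2 ℕ.* n) + 16half^ (2 ℕ.* n) ≤ ι 32 * half^ n
  tail-bound n = ≤-trans (≤-reflexive (solve 1 (λ g → # 16 :* g :+ # 16 :* g := # 32 :* g) refl (half^ (2 ℕ.* n))))
    (*-monoˡ-≤ (0≤fromℕ 32) (≤-resp (reflexive (≡.cong half^ (≡.cong (n ℕ.+_) (≡.sym (ℕ.+-identityʳ n))))) refl (half^-anti n n)))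

  cos-tail : ∀ d n → cos d - cosSum (proj₁ d) n ∈± ι 32 * half^ n
  cos-tail d n = ±-weaken (tail-bound n) (proj₂ (cosine d) n)

  sin-tail : ∀ d n → sin d - sinSum (proj₁ d) n ∈± ι 32 * half^ n
  sin-tail d n = ±-weaken (tail-bound n) (proj₂ (sine d) n)

  isCos : ∀ d → IsCos (proj₁ d) (cos d)
  isCos d = ⟶-intro (ι 32) (0≤fromℕ 32) (cos-tail d)

  isSin : ∀ d → IsSin (proj₁ d) (sin d)
  isSin d = ⟶-intro (ι 32) (0≤fromℕ 32) (sin-tail d)

  limit-± : ∀ {v B} (r : ℕ → Carrier) K → 0# ≤ K → (∀ n → r n ∈± B) → (∀ n → v - r n ∈± K * half^ n) → v ∈± B
  limit-± {v} {B} r K 0≤K r∈ v-r∈ =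
    0≤-⇒≤ (≤-resp refl (solve 2 (λ v b → # 0 :- ((:- b) :- v) := v :- (:- b)) refl v B) (≤⇒0≤- (half^-limit K 0≤K λ n →
      0≤-⇒≤ (≤-resp refl (solve 4 (λ v r b k → (r :- (:- b)) :+ ((v :- r) :- (:- k)) := k :- ((:- b) :- v)) refl v (r n) B (K * half^ n))
        (≤⇒0≤- (proj₁ (r∈ n)) ⊕ ≤⇒0≤- (proj₁ (v-r∈ n))))))) ,
    0≤-⇒≤ (≤-resp refl (solve 2 (λ v b → # 0 :- (v :- b) := b :- v) refl v B) (≤⇒0≤- (half^-limit K 0≤K λ n →
      0≤-⇒≤ (≤-resp refl (solve 4 (λ v r b k → (b :- r) :+ (k :- (v :- r)) := k :- (v :- b)) refl v (r n) B (K * half^ n))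
        (≤⇒0≤- (proj₂ (r∈ n)) ⊕ ≤⇒0≤- (proj₂ (v-r∈ n)))))))

  geometric-± : ∀ {B} (r : ℕ → Carrier) → 0# ≤ B → r 0 ≈ 0# → (∀ n → r (suc n) - r n ∈± B * half^ n) → ∀ n → r n ∈± B + B
  geometric-± {B} r 0≤B r0 step n = ±-weaken
    (≤-by (0≤B ⊛ 0≤half^ n ⊕ 0≤B ⊛ 0≤half^ n) (solve 2 (λ b g → b :+ b := (b :+ b :- (b :* g :+ b :* g)) :+ (b :* g :+ b :* g)) refl B (half^ n)))
    (strong n)
    where
    -- The induction needs the room 2B · 2⁻ⁿ for the steps still to come.
    strong : ∀ n → r n ∈± B + B - (B * half^ n + B * half^ n)
    strong zero = ±-resp (sym r0) (solve 1 (λ b → # 0 := b :+ b :- (b :* # 1 :+ b :* # 1)) refl B)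
      (≤-reflexive (solve 0 (:- # 0 := # 0) refl) , ≤-refl)
    strong (suc n) = ±-resp (solve 2 (λ u v → u :+ (v :- u) := v) refl (r n) (r (suc n)))
      (trans (+-congˡ (*-congˡ (sym (half+half (half^ n)))))
        (trans (+-congʳ (+-congˡ (-‿cong (+-cong (*-congˡ (sym (half+half (half^ n)))) (*-congˡ (sym (half+half (half^ n))))))))
        (solve 2 (λ b g → b :+ b :- (b :* (g :+ g) :+ b :* (g :+ g)) :+ b :* (g :+ g) := b :+ b :- (b :* g :+ b :* g)) refl B (half^ (suc n)))))
      (±-+ (strong n) (step n))

  sign-suc : ∀ n → (- 1#) ^ n ≈ - ((- 1#) ^ suc n)
  sign-suc n = sym (trans (-‿cong (Ringₚ.-1*x≈-x _)) (Ringₚ.-‿involutive _))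

  -- Second-order Taylor expansion of the two series, term by term.
  module _ (d d′ : Interval) where
    private
      x = proj₁ d
      y = proj₁ d′
      δ = y - x
      B = ι 16 * (δ * δ)
      0≤B = 0≤fromℕ 16 ⊛ 0≤x² δ
      bound : ∀ k n → 16half^ (k ℕ.+ n) * (δ * δ) ≤ B * half^ n
      bound k n = ≤-trans (*-monoʳ-≤ (0≤x² δ) (16half^-anti k n))
        (≤-reflexive (solve 3 (λ c g z → c :* g :* z := c :* z :* g) refl (ι 16) (half^ n) (δ * δ)))
      double : ∀ k n → 16half^ (k ℕ.+ 2 ℕ.* n) * (δ * δ) ≤ B * half^ n
      double k n = ≤-trans (≤-reflexive (*-congʳ (reflexive (≡.cong 16half^
        (≡.trans (≡.cong (λ m → k ℕ.+ (n ℕ.+ m)) (ℕ.+-identityʳ n)) (≡.sym (ℕ.+-assoc k n n))))))) (bound (k ℕ.+ n) n)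
      B+B≈ : B + B ≈ ι 32 * (δ * δ)
      B+B≈ = solve 1 (λ z → # 16 :* z :+ # 16 :* z := # 32 :* z) refl (δ * δ)
      -- The constant term of the cosine has derivative 0, so n + 1 cosine terms are matched with n
      -- sine terms, but n + 1 sine terms with n + 1 cosine terms.
      cosRem sinRem : ℕ → Carrier
      cosRem n = cosSum y (suc n) - cosSum x (suc n) + δ * sinSum x n
      sinRem n = sinSum y (suc n) - sinSum x (suc n) - δ * cosSum x (suc n)

      cosRem-step : ∀ n → cosRem (suc n) - cosRem n ∈± B * half^ n
      cosRem-step n = ±-weaken (double 0 n) (±-resp (sym eq) refl (sign-± (suc n) (power-remainder d d′ (2 ℕ.* n))))
        where
        eq : cosRem (suc n) - cosRem n ≈ (- 1#) ^ suc n * (power (2 ℕ.+ 2 ℕ.* n) y - power (2 ℕ.+ 2 ℕ.* n) x - δ * power (1 ℕ.+ 2 ℕ.* n) x)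
        eq = trans (+-congʳ (+-cong (+-cong
            (trans (cosSum-suc y (suc n)) (+-congˡ (*-congˡ (reflexive (≡.cong (λ m → power m y) (2*suc n))))))
            (-‿cong (trans (cosSum-suc x (suc n)) (+-congˡ (*-congˡ (reflexive (≡.cong (λ m → power m x) (2*suc n))))))))
            (*-congˡ (trans (sinSum-suc x n) (+-congˡ (*-congʳ (sign-suc n)))))))
          (solve 8 (λ cy cx m t δ u v w → (cy :+ m :* u :- (cx :+ m :* v) :+ δ :* (t :+ (:- m) :* w)) :- (cy :- cx :+ δ :* t)
              := m :* (u :- v :- δ :* w)) refl
            (cosSum y (suc n)) (cosSum x (suc n)) ((- 1#) ^ suc n) (sinSum x n) δ
            (power (2 ℕ.+ 2 ℕ.* n) y) (power (2 ℕ.+ 2 ℕ.* n) x) (power (1 ℕ.+ 2 ℕ.* n) x))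

      sinRem-step : ∀ n → sinRem (suc n) - sinRem n ∈± B * half^ n
      sinRem-step n = ±-weaken (double 1 n) (±-resp (sym eq) refl (sign-± (suc n) (power-remainder d d′ (1 ℕ.+ 2 ℕ.* n))))
        where
        eq : sinRem (suc n) - sinRem n ≈ (- 1#) ^ suc n * (power (3 ℕ.+ 2 ℕ.* n) y - power (3 ℕ.+ 2 ℕ.* n) x - δ * power (2 ℕ.+ 2 ℕ.* n) x)
        eq = trans (+-congʳ (+-cong (+-cong
            (trans (sinSum-suc y (suc n)) (+-congˡ (*-congˡ (reflexive (≡.cong (λ m → power (suc m) y) (2*suc n))))))
            (-‿cong (trans (sinSum-suc x (suc n)) (+-congˡ (*-congˡ (reflexive (≡.cong (λ m → power (suc m) x) (2*suc n))))))))
            (-‿cong (*-congˡ (trans (cosSum-suc x (suc n)) (+-congˡ (*-congˡ (reflexive (≡.cong (λ m → power m x) (2*suc n))))))))))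
          (solve 8 (λ cy cx m t δ u v w → (cy :+ m :* u :- (cx :+ m :* v) :- δ :* (t :+ m :* w)) :- (cy :- cx :- δ :* t)
              := m :* (u :- v :- δ :* w)) refl
            (sinSum y (suc n)) (sinSum x (suc n)) ((- 1#) ^ suc n) (cosSum x (suc n)) δ
            (power (3 ℕ.+ 2 ℕ.* n) y) (power (3 ℕ.+ 2 ℕ.* n) x) (power (2 ℕ.+ 2 ℕ.* n) x))

      cosRem-0 : cosRem 0 ≈ 0#
      cosRem-0 = solve 2 (λ a δ → (a :- a) :+ δ :* # 0 := # 0) refl (cosSum x 1) δ

      sinRem-0 : sinRem 0 ≈ 0#
      sinRem-0 = trans (+-cong (+-cong (+-congʳ (*-congˡ (*-congʳ (*-identityʳ y)))) (-‿cong (+-congʳ (*-congˡ (*-congʳ (*-identityʳ x))))))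
          (-‿cong (*-congˡ (+-congʳ (*-congˡ (*-identityˡ _))))))
        (solve 4 (λ o x y i → (o :* (y :* i) :+ # 0) :- (o :* (x :* i) :+ # 0) :- (y :- x) :* (o :* i :+ # 0) := # 0) refl 1# x y (1/ 1 !))

      -- Three truncation errors of 32 · 2⁻ⁿ each; the last one is multiplied by the increment,
      -- which is at most 2.
      K = (ι 32 + ι 32) + ι 2 * ι 32
      K-half^ : ∀ n → (ι 32 * half^ n + ι 32 * half^ n) + ι 2 * (ι 32 * half^ n) ≈ K * half^ n
      K-half^ n = solve 3 (λ c t g → c :* g :+ c :* g :+ t :* (c :* g) := (c :+ c :+ t :* c) :* g) refl (ι 32) (ι 2) (half^ n)

      cos-split : ∀ c′ c s a b e δ → (c′ - a) + - (c - b) + δ * (s - e) ≈ (c′ - c + δ * s) - (a - b + δ * e)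
      cos-split = solve 7 (λ c′ c s a b e δ → (c′ :- a) :+ (:- (c :- b)) :+ δ :* (s :- e) := (c′ :- c :+ δ :* s) :- (a :- b :+ δ :* e)) refl

      sin-split : ∀ c′ c s a b e δ → (c′ - a) + - (c - b) + δ * - (s - e) ≈ (c′ - c - δ * s) - (a - b - δ * e)
      sin-split = solve 7 (λ c′ c s a b e δ → (c′ :- a) :+ (:- (c :- b)) :+ δ :* (:- (s :- e)) := (c′ :- c :- δ :* s) :- (a :- b :- δ :* e)) refl

      half^-suc≤ : ∀ n → ι 32 * half^ (suc n) ≤ ι 32 * half^ n
      half^-suc≤ n = *-monoˡ-≤ (0≤fromℕ 32) (half^-anti 1 n)

    δ-± : proj₁ d′ - proj₁ d ∈± ι 2
    δ-± = 0≤-⇒≤ (≤-resp refl (solve 2 (λ x y → y :+ (# 2 :- x) := (y :- x) :- (:- # 2)) refl x y) (proj₁ (proj₂ d′) ⊕ ≤⇒0≤- (proj₂ (proj₂ d)))) ,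
      0≤-⇒≤ (≤-resp refl (solve 2 (λ x y → x :+ (# 2 :- y) := # 2 :- (y :- x)) refl x y) (proj₁ (proj₂ d) ⊕ ≤⇒0≤- (proj₂ (proj₂ d′))))

    cos-expand : cos d′ - cos d + (proj₁ d′ - proj₁ d) * sin d ∈± ι 32 * ((proj₁ d′ - proj₁ d) * (proj₁ d′ - proj₁ d))
    cos-expand = limit-± cosRem K (0≤fromℕ 32 ⊕ 0≤fromℕ 32 ⊕ 0≤fromℕ 2 ⊛ 0≤fromℕ 32)
      (λ n → ±-resp refl B+B≈ (geometric-± cosRem 0≤B cosRem-0 cosRem-step n))
      λ n → ±-resp (cos-split (cos d′) (cos d) (sin d) (cosSum y (suc n)) (cosSum x (suc n)) (sinSum x n) δ) (K-half^ n)
        (cosErr n)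
      where
      cosErr : ∀ n → (cos d′ - cosSum y (suc n)) + - (cos d - cosSum x (suc n)) + δ * (sin d - sinSum x n)
        ∈± (ι 32 * half^ n + ι 32 * half^ n) + ι 2 * (ι 32 * half^ n)
      cosErr n = ±-+ (±-+ (±-weaken (half^-suc≤ n) (cos-tail d′ (suc n))) (±-neg (±-weaken (half^-suc≤ n) (cos-tail d (suc n))))) (±-* δ-± (sin-tail d n))

    sin-expand : sin d′ - sin d - (proj₁ d′ - proj₁ d) * cos d ∈± ι 32 * ((proj₁ d′ - proj₁ d) * (proj₁ d′ - proj₁ d))
    sin-expand = limit-± sinRem K (0≤fromℕ 32 ⊕ 0≤fromℕ 32 ⊕ 0≤fromℕ 2 ⊛ 0≤fromℕ 32)
      (λ n → ±-resp refl B+B≈ (geometric-± sinRem 0≤B sinRem-0 sinRem-step n))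
      λ n → ±-resp (sin-split (sin d′) (sin d) (cos d) (sinSum y (suc n)) (sinSum x (suc n)) (cosSum x (suc n)) δ) (K-half^ n)
        (sinErr n)
      where
      sinErr : ∀ n → (sin d′ - sinSum y (suc n)) + - (sin d - sinSum x (suc n)) + δ * - (cos d - cosSum x (suc n))
        ∈± (ι 32 * half^ n + ι 32 * half^ n) + ι 2 * (ι 32 * half^ n)
      sinErr n = ±-+ (±-+ (±-weaken (half^-suc≤ n) (sin-tail d′ (suc n))) (±-neg (±-weaken (half^-suc≤ n) (sin-tail d (suc n)))))
        (±-* δ-± (±-neg (±-weaken (half^-suc≤ n) (cos-tail d (suc n)))))

  ±-cast : ∀ {x y b c} → x ∈± b → x ≈ y → b ≈ c → y ∈± c
  ±-cast x∈ x≈y b≈c = ±-resp x≈y b≈c x∈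

  x-0 : ∀ x → x - 0# ≈ x
  x-0 = solve 1 (λ c → c :- # 0 := c) refl

  -- The error bound of the empty partial sum. It is crude, but the bound 1 becomes available only
  -- through cos² + sin² = 1, whose proof uses this one.
  cos-± : ∀ d → cos d ∈± ι 32
  cos-± d = ±-cast (cos-tail d 0) (x-0 (cos d)) (trans (*-congˡ fromℕ1≈1) (*-identityʳ _))

  sin-± : ∀ d → sin d ∈± ι 32
  sin-± d = ±-cast (sin-tail d 0) (x-0 (sin d)) (trans (*-congˡ fromℕ1≈1) (*-identityʳ _))

  ±-δ : ∀ {x y} → x ≤ y → y - x ∈± y - x
  ±-δ x≤y = nonneg⇒± (≤⇒0≤- x≤y) ≤-refl

  -- The quadratic error 32 δ² is at most 64 δ because δ ≤ 2, and the linear term is at most 32 δ.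
  cos-lipschitz : ∀ d d′ → proj₁ d ≤ proj₁ d′ → cos d′ - cos d ∈± (ι 32 * ι 3) * (proj₁ d′ - proj₁ d)
  cos-lipschitz d d′ d≤d′ = ±-cast
    (±-+ (±-weaken (*-monoˡ-≤ (0≤fromℕ 32) (*-monoˡ-≤ (≤⇒0≤- d≤d′) (proj₂ (δ-± d d′)))) (cos-expand d d′))
         (±-neg (±-* (±-δ d≤d′) (sin-± d))))
    (value (cos d′) (cos d) (sin d) δ) (bound (ι 32) δ)
    where
    δ = proj₁ d′ - proj₁ d
    value : ∀ c′ c s δ → (c′ - c + δ * s) + - (δ * s) ≈ c′ - c
    value = solve 4 (λ c′ c s δ → (c′ :- c :+ δ :* s) :+ (:- (δ :* s)) := c′ :- c) refl
    bound : ∀ b δ → b * (δ * ι 2) + δ * b ≈ (b * ι 3) * δ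
    bound = solve 2 (λ b δ → b :* (δ :* # 2) :+ δ :* b := (b :* # 3) :* δ) refl

  norm² : Interval → Carrier
  norm² d = cos d * cos d + sin d * sin d

  -- To first order, (c, s) moves to (c - δs, s + δc), whose squared norm is (1 + δ²)(c² + s²). The
  -- difference is thus δ²(c² + s²) plus two products that each contain a second-order remainder.
  -- The factor 10 is 2 + 4 + 4.
  norm²-quadratic : ∀ d d′ → proj₁ d ≤ proj₁ d′ → norm² d′ - norm² d ∈±
    (ι 32 * ι 32 * ι 10) * ((proj₁ d′ - proj₁ d) * (proj₁ d′ - proj₁ d))
  norm²-quadratic d d′ d≤d′ = ±-cast
    (±-+ (±-+ (±-* (nonneg⇒± (0≤x² δ) ≤-refl) (±-+ (±-* (cos-± d) (cos-± d)) (±-* (sin-± d) (sin-± d))))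
              (±-* (cos-expand d d′) (±-+ (±-+ (cos-± d′) (cos-± d)) (±-neg (±-* (δ-± d d′) (sin-± d))))))
         (±-* (sin-expand d d′) (±-+ (±-+ (sin-± d′) (sin-± d)) (±-* (δ-± d d′) (cos-± d)))))
    (algebra (cos d) (sin d) (cos d′) (sin d′) δ) (bound (ι 32) (δ * δ))
    where
    δ = proj₁ d′ - proj₁ d
    bound : ∀ b z → (z * (b * b + b * b) + (b * z) * (b + b + ι 2 * b)) + (b * z) * (b + b + ι 2 * b) ≈ (b * b * ι 10) * z
    bound = solve 2 (λ b z → (z :* (b :* b :+ b :* b) :+ (b :* z) :* (b :+ b :+ # 2 :* b)) :+ (b :* z) :* (b :+ b :+ # 2 :* b)
       := (b :* b :* # 10) :* z) refl
    algebra : ∀ c s c′ s′ δ → (δ * δ) * (c * c + s * s) + (c′ - c + δ * s) * (c′ + c + - (δ * s)) + (s′ - s - δ * c) * (s′ + s + δ * c)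
      ≈ (c′ * c′ + s′ * s′) - (c * c + s * s)
    algebra = solve 5 (λ c s c′ s′ δ → (δ :* δ) :* (c :* c :+ s :* s) :+ (c′ :- c :+ δ :* s) :* (c′ :+ c :+ (:- (δ :* s))) :+ (s′ :- s :- δ :* c) :* (s′ :+ s :+ δ :* c)
      := (c′ :* c′ :+ s′ :* s′) :- (c :* c :+ s :* s)) refl

  0^-suc : ∀ n → 0# ^ suc n ≈ 0#
  0^-suc n = zeroˡ _

  power-0 : ∀ n → power (suc n) 0# ≈ 0#
  power-0 n = trans (*-congʳ (0^-suc n)) (zeroˡ _)

  cosSum-0 : ∀ n → cosSum 0# (suc n) ≈ 1#
  cosSum-0 zero = trans (+-identityʳ _) (trans (*-identityˡ _) (trans (*-congʳ (sym fromℕ1≈1)) (!-inverse 0)))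
  -- The exponent `2 ℕ.* suc n` computes to the successor of the number given to `power-0`.
  cosSum-0 (suc n) = trans (cosSum-suc 0# (suc n)) (trans (+-cong (cosSum-0 n) (trans (*-congˡ (power-0 (n ℕ.+ 1 ℕ.* suc n))) (zeroʳ _))) (+-identityʳ 1#))

  sinSum-0 : ∀ n → sinSum 0# n ≈ 0#
  sinSum-0 zero = refl
  sinSum-0 (suc n) = trans (sinSum-suc 0# n) (trans (+-cong (sinSum-0 n) (trans (*-congˡ (power-0 (2 ℕ.* n))) (zeroʳ _))) (+-identityʳ 0#))

  ±-zero : ∀ {x} → x ∈± 0# → x ≈ 0#
  ±-zero (p , q) = antisym q (≤-resp Ringₚ.-0#≈0# refl p)

  cos-0 : cos origin ≈ 1#
  cos-0 = trans (sym (cancel (cos origin) 1#)) (trans (+-congʳ (±-zero difference)) (+-identityˡ 1#))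
    where
    cancel : ∀ c o → (c - o) + o ≈ c
    cancel = solve 2 (λ c o → (c :- o) :+ o := c) refl
    shift : ∀ c a o → c - a ≈ (c - o) - (a - o)
    shift = solve 3 (λ c a o → c :- a := (c :- o) :- (a :- o)) refl
    constant : ∀ n → cosSum 0# (suc n) - 1# ∈± 0#
    constant n = ±-cast (≤-reflexive Ringₚ.-0#≈0# , ≤-refl) (sym (trans (+-congʳ (cosSum-0 n)) (-‿inverseʳ 1#))) refl
    close : ∀ n → (cos origin - 1#) - (cosSum 0# (suc n) - 1#) ∈± ι 32 * half^ n
    close n = ±-weaken (*-monoˡ-≤ (0≤fromℕ 32) (half^-anti 1 n))
      (±-cast (cos-tail origin (suc n)) (shift (cos origin) (cosSum 0# (suc n)) 1#) refl)
    difference : cos origin - 1# ∈± 0#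
    difference = limit-± (λ n → cosSum 0# (suc n) - 1#) (ι 32) (0≤fromℕ 32) constant close

  sin-0 : sin origin ≈ 0#
  sin-0 = ±-zero (limit-± (sinSum 0#) (ι 32) (0≤fromℕ 32) constant (sin-tail origin))
    where
    constant : ∀ n → sinSum 0# n ∈± 0#
    constant n = ±-cast (≤-reflexive Ringₚ.-0#≈0# , ≤-refl) (sym (sinSum-0 n)) refl

  norm²≈1 : ∀ d → norm² d ≈ 1#
  norm²≈1 d = trans (quadratic⇒constant norm² (ι 32 * ι 32 * ι 10) (0≤fromℕ 32 ⊛ 0≤fromℕ 32 ⊛ 0≤fromℕ 10) norm²-quadratic d)
    (trans (+-cong (trans (*-cong cos-0 cos-0) (*-identityʳ 1#)) (trans (*-congˡ sin-0) (zeroʳ _))) (+-identityʳ 1#))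

  sign-step : ∀ n {z} → (- 1#) ^ n ≈ z → (- 1#) ^ suc n ≈ - z
  sign-step n eq = trans (Ringₚ.-1*x≈-x _) (-‿cong eq)

  2^≈fromℕ : ∀ n → 2^ n ≈ ι (2 ℕ.^ n)
  2^≈fromℕ zero = sym fromℕ1≈1
  2^≈fromℕ (suc n) = trans (*-congˡ (2^≈fromℕ n)) (sym (fromℕ-* 2 (2 ℕ.^ n)))

  -- cos 2 ≤ 1 − 2²/2! + 2⁴/4! − 2⁶/6! + 32 · 2⁻⁸ ≤ 0
  cos2≤0 : cos two ≤ 0#
  cos2≤0 = ≤-trans upper (0≤-⇒≤ (≤-resp refl final (0≤fromℕ 214 ⊛ <⇒≤ (0<1/! 6))))
    where
    v = 1/ 6 !
    w = half^ 8
    up2 : ∀ n → 1/ n ! ≈ ι (suc n) * (ι (suc (suc n)) * 1/ (suc (suc n)) !)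
    up2 n = trans (1/!-suc n) (*-congˡ (1/!-suc (suc n)))
    fold : ∀ a b x → ι a * (ι b * x) ≈ ι (a ℕ.* b) * x
    fold a b x = trans (sym (*-assoc _ _ _)) (*-congʳ (sym (fromℕ-* a b)))
    i4 : 1/ 4 ! ≈ ι 30 * v
    i4 = trans (up2 4) (fold 5 6 v)
    i2 : 1/ 2 ! ≈ ι 360 * v
    i2 = trans (up2 2) (trans (*-congˡ (*-congˡ i4)) (trans (*-congˡ (fold 4 30 v)) (fold 3 120 v)))
    i0 : 1/ 0 ! ≈ ι 720 * v
    i0 = trans (up2 0) (trans (*-congˡ (*-congˡ i2)) (trans (*-congˡ (fold 2 360 v)) (fold 1 720 v)))
    720v≈1 : ι 720 * v ≈ 1#
    720v≈1 = trans (sym i0) (trans (sym (*-identityˡ _)) (trans (*-congʳ (sym fromℕ1≈1)) (!-inverse 0)))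
    256w≈1 : ι 256 * w ≈ 1#
    256w≈1 = trans (*-congʳ (sym (2^≈fromℕ 8))) (2^*half^ 8)
    expand : ∀ a b c d → ι 1 * (ι 1 * a) + (- ι 1 * (ι 4 * b) + (- - ι 1 * (ι 16 * c) + (- - - ι 1 * (ι 64 * d) + 0#)))
      ≈ a - ι 4 * b + ι 16 * c - ι 64 * d
    expand = solve 4 (λ a b c d → # 1 :* (# 1 :* a) :+ ((:- # 1) :* (# 4 :* b) :+ ((:- (:- # 1)) :* (# 16 :* c) :+ ((:- (:- (:- # 1))) :* (# 64 :* d) :+ # 0)))
      := a :- # 4 :* b :+ # 16 :* c :- # 64 :* d) refl
    s0 = sym fromℕ1≈1
    s1 = sign-step 0 s0
    s2 = sign-step 1 s1
    s3 = sign-step 2 s2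
    polynomial : cosSum (ι 2) 4 ≈ 1/ 0 ! - ι 4 * 1/ 2 ! + ι 16 * 1/ 4 ! - ι 64 * v
    polynomial = trans
      (+-cong (*-cong s0 (*-congʳ (2^≈fromℕ 0))) (+-cong (*-cong s1 (*-congʳ (2^≈fromℕ 2)))
        (+-cong (*-cong s2 (*-congʳ (2^≈fromℕ 4))) (+-congʳ (*-cong s3 (*-congʳ (2^≈fromℕ 6)))))))
      (expand (1/ 0 !) (1/ 2 !) (1/ 4 !) v)
    value : cosSum (ι 2) 4 ≈ ι 720 * v - ι 1440 * v + ι 480 * v - ι 64 * v
    value = trans polynomial (+-congʳ (+-cong (+-cong i0 (-‿cong (trans (*-congˡ i2) (fold 4 360 v)))) (trans (*-congˡ i4) (fold 16 30 v))))
    -- Both sides are 1/8, as w = 1/256 and v = 1/720; everything is brought to the denominator 6!.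
    32w≈90v : ι 32 * w ≈ ι 90 * v
    32w≈90v = trans (sym (*-identityʳ _)) (trans (*-congˡ (sym 720v≈1)) (trans (rearrange (ι 32) w (ι 720) v)
      (trans (*-congʳ (trans (*-congʳ (sym (fromℕ-* 32 720))) (*-congʳ (fromℕ-* 90 256)))) (trans (regroup (ι 90) (ι 256) w v)
      (trans (*-congˡ 256w≈1) (*-identityʳ _))))))
      where
      rearrange : ∀ a w b v → (a * w) * (b * v) ≈ ((a * b) * w) * v
      rearrange = solve 4 (λ a w b v → (a :* w) :* (b :* v) := ((a :* b) :* w) :* v) refl
      regroup : ∀ a b w v → ((a * b) * w) * v ≈ (a * v) * (b * w)
      regroup = solve 4 (λ a b w v → ((a :* b) :* w) :* v := (a :* v) :* (b :* w)) refl
    bound : Carrier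
    bound = ι 720 * v - ι 1440 * v + ι 480 * v - ι 64 * v + ι 90 * v
    upper : cos two ≤ bound
    -- The sharper error of `cosine` is essential here: with four terms it is 1/8, whereas
    -- `cos-tail` would only give 2.
    upper = 0≤-⇒≤ (≤-resp refl (trans (move (cos two) (cosSum (ι 2) 4) (16half^ 8))
        (+-congʳ (+-cong value (trans (merge w) 32w≈90v))))
      (≤⇒0≤- (proj₂ (proj₂ (cosine two) 4))))
      where
      move : ∀ c p g → (g + g) - (c - p) ≈ (p + (g + g)) - c
      move = solve 3 (λ c p g → (g :+ g) :- (c :- p) := (p :+ (g :+ g)) :- c) refl
      merge : ∀ g → ι 16 * g + ι 16 * g ≈ ι 32 * g
      merge = solve 1 (λ g → # 16 :* g :+ # 16 :* g := # 32 :* g) refl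
    final : ι 214 * v ≈ 0# - bound
    final = collect v
      where
      collect : ∀ v → ι 214 * v ≈ 0# - (ι 720 * v - ι 1440 * v + ι 480 * v - ι 64 * v + ι 90 * v)
      collect = solve 1 (λ v → # 214 :* v := # 0 :- (# 720 :* v :- # 1440 :* v :+ # 480 :* v :- # 64 :* v :+ # 90 :* v)) refl

  neg-^-even : ∀ x k → (- x) ^ (2 ℕ.* k) ≈ x ^ (2 ℕ.* k)
  neg-^-even x k = trans (sym (Expₚ.^-assocʳ (- x) 2 k)) (trans (Expₚ.^-congˡ k square) (Expₚ.^-assocʳ x 2 k))
    where
    square : (- x) ^ 2 ≈ x ^ 2
    square = trans (*-congˡ (*-identityʳ _)) (trans (solve 1 (λ x → (:- x) :* (:- x) := x :* x) refl x) (*-congˡ (sym (*-identityʳ x))))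

  cosSum-neg : ∀ x n → cosSum (- x) n ≈ cosSum x n
  cosSum-neg x n = Sumₚ.sum-cong-≋ {n} λ i → *-congˡ (*-congʳ (neg-^-even x (toℕ i)))

  sinSum-neg : ∀ x n → sinSum (- x) n ≈ - sinSum x n
  sinSum-neg x zero = sym Ringₚ.-0#≈0#
  sinSum-neg x (suc n) = trans (sinSum-suc (- x) n) (trans (+-cong (sinSum-neg x n) (*-congˡ (*-congʳ (*-congˡ (neg-^-even x n)))))
    (trans (neg-term (sinSum x n) ((- 1#) ^ n) x (x ^ (2 ℕ.* n)) (1/ (1 ℕ.+ 2 ℕ.* n) !)) (-‿cong (sym (sinSum-suc x n)))))
    where
    neg-term : ∀ t s x p i → - t + s * (((- x) * p) * i) ≈ - (t + s * ((x * p) * i))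
    neg-term = solve 5 (λ t s x p i → (:- t) :+ s :* (((:- x) :* p) :* i) := :- (t :+ s :* ((x :* p) :* i))) refl

  -- Negated angles serve the case in which the angle found from its cosine has a sine of the wrong
  -- sign.
  isCos-neg : ∀ d → IsCos (- proj₁ d) (cos d)
  isCos-neg d = ⟶-intro (ι 32) (0≤fromℕ 32) λ n → ±-cast (cos-tail d n) (+-congˡ (-‿cong (sym (cosSum-neg (proj₁ d) n)))) refl

  isSin-neg : ∀ d → IsSin (- proj₁ d) (- sin d)
  isSin-neg d = ⟶-intro (ι 32) (0≤fromℕ 32) λ n → ±-cast (±-neg (sin-tail d n))
    (trans (flip (sin d) (sinSum (proj₁ d) n)) (+-congˡ (-‿cong (sym (sinSum-neg (proj₁ d) n))))) refl
    where
    flip : ∀ s t → - (s - t) ≈ - s - - t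
    flip = solve 2 (λ s t → :- (s :- t) := (:- s) :- (:- t)) refl

  -- From unit vectors to angles

  zero-product : ∀ {x y} → x * y ≈ 0# → x ≈ 0# ⊎ y ≈ 0#
  zero-product {x} {y} xy≈0 with em {x ≈ 0#}
  ... | yes x≈0 = inj₁ x≈0
  ... | no x≉0 = inj₂ (trans (sym (*-identityʳ y)) (trans (*-congˡ (sym (⁻¹-inverseʳ x x≉0)))
    (trans (rearrange x y (x ⁻¹)) (trans (*-congʳ xy≈0) (zeroˡ _)))))
    where
    rearrange : ∀ x y i → y * (x * i) ≈ (x * y) * i
    rearrange = solve 3 (λ x y i → y :* (x :* i) := (x :* y) :* i) refl

  square-roots : ∀ {x y} → x * x ≈ y * y → x ≈ y ⊎ x ≈ - y
  square-roots {x} {y} eq with zero-product (trans (factor x y) (trans (+-congʳ eq) (-‿inverseʳ (y * y))))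
    where
    factor : ∀ x y → (x - y) * (x + y) ≈ x * x - y * y
    factor = solve 2 (λ x y → (x :- y) :* (x :+ y) := x :* x :- y :* y) refl
  ... | inj₁ z = inj₁ (trans (solve 2 (λ x y → x := (x :- y) :+ y) refl x y) (trans (+-congʳ z) (+-identityˡ y)))
  ... | inj₂ z = inj₂ (trans (solve 2 (λ x y → x := (x :+ y) :+ (:- y)) refl x y) (trans (+-congʳ z) (+-identityˡ _)))

  Angle : Carrier → Carrier → Set
  Angle c s = ∃[ θ ] ∃[ c′ ] ∃[ s′ ] (IsCos θ c′ × IsSin θ s′ × ((c′ ≈ c × s′ ≈ s) ⊎ (c′ ≈ - c × s′ ≈ - s)))

  unit⇒≤1 : ∀ c s → 0# ≤ c → c * c + s * s ≈ 1# → c ≤ 1#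
  unit⇒≤1 c s 0≤c unit = ≮⇒≥ λ 1<c → <⇒≱ (*-pos (<⇒0<- 1<c) (≤-<-trans 0≤c (<-by 0<1 refl)))
      (0≤-⇒≤ (≤-resp refl s²≈ (0≤x² s)))
    where
    complement : ∀ a b → b ≈ (a + b) - a
    complement = solve 2 (λ a b → b := (a :+ b) :- a) refl
    factor : ∀ c o → o * o - c * c ≈ 0# - (c - o) * (c + o)
    factor = solve 2 (λ c o → o :* o :- c :* c := # 0 :- (c :- o) :* (c :+ o)) refl
    s²≈ : s * s ≈ 0# - (c - 1#) * (c + 1#)
    s²≈ = trans (complement (c * c) (s * s)) (trans (+-congʳ (trans unit (sym (*-identityʳ 1#)))) (factor c 1#))

  root⇒angle : ∀ c s → c * c + s * s ≈ 1# → ∃[ d ] (cos d ≈ c) → Angle c s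
  root⇒angle c s unit (d , cos≈c) = from-square (square-roots sin²≈)
    where
    isolate : ∀ a b → b ≈ (a + b) - a
    isolate = solve 2 (λ a b → b := (a :+ b) :- a) refl
    sin²≈ : sin d * sin d ≈ s * s
    sin²≈ = trans (isolate (cos d * cos d) (sin d * sin d))
      (trans (+-cong (trans (norm²≈1 d) (sym unit)) (-‿cong (*-cong cos≈c cos≈c))) (sym (isolate (c * c) (s * s))))
    from-square : sin d ≈ s ⊎ sin d ≈ - s → Angle c s
    from-square (inj₁ sin≈s) = proj₁ d , cos d , sin d , isCos d , isSin d , inj₁ (cos≈c , sin≈s)
    from-square (inj₂ sin≈-s) = - proj₁ d , cos d , - sin d , isCos-neg d , isSin-neg d ,
      inj₁ (cos≈c , trans (-‿cong sin≈-s) (Ringₚ.-‿involutive s))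

  angle⁺ : ∀ c s → 0# ≤ c → c * c + s * s ≈ 1# → Angle c s
  angle⁺ c s 0≤c unit = root⇒angle c s unit (intermediateValue cos (ι 32 * ι 3) (*-pos (0<fromℕ 31) (0<fromℕ 2)) cos-lipschitz c
      (≤-resp refl (sym cos-0) (unit⇒≤1 c s 0≤c unit)) (≤-trans cos2≤0 0≤c))

  angle : ∀ c s → c * c + s * s ≈ 1# → Angle c s
  angle c s unit with total 0# c
  ... | inj₁ 0≤c = angle⁺ c s 0≤c unit
  ... | inj₂ c≤0 = flip (angle⁺ (- c) (- s) (≤-resp refl (+-identityˡ _) (≤⇒0≤- c≤0)) (trans (squares c s) unit))
    where
    squares : ∀ c s → - c * - c + - s * - s ≈ c * c + s * s
    squares = solve 2 (λ c s → (:- c) :* (:- c) :+ (:- s) :* (:- s) := c :* c :+ s :* s) refl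
    flip : Angle (- c) (- s) → Angle c s
    flip (θ , c′ , s′ , isC , isS , inj₁ same) = θ , c′ , s′ , isC , isS , inj₂ same
    flip (θ , c′ , s′ , isC , isS , inj₂ (c≈ , s≈)) = θ , c′ , s′ , isC , isS ,
      inj₁ (trans c≈ (Ringₚ.-‿involutive c) , trans s≈ (Ringₚ.-‿involutive s))

  -- Nearest integers, coverings by strips, and the infimum

  fromℤ-- : ∀ i j → fromℤ (i ℤ.- j) ≈ fromℤ i - fromℤ j
  fromℤ-- i j = trans (fromℤ-+ i (ℤ.- j)) (+-congˡ (fromℤ-neg j))

  fromℤ-mono : ∀ {i j} → i ℤ.≤ j → fromℤ i ≤ fromℤ j
  fromℤ-mono {i} {j} i≤j = 0≤-⇒≤ (≤-resp refl
    (trans (reflexive (≡.cong fromℤ (ℤ.0≤i⇒+∣i∣≡i (ℤ.i≤j⇒0≤j-i i≤j)))) (fromℤ-- j i)) (0≤fromℕ ℤ.∣ j ℤ.- i ∣))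

  fromℤ-<⇒+1≤ : ∀ {i j} → i ℤ.< j → fromℤ i + ι 1 ≤ fromℤ j
  fromℤ-<⇒+1≤ {i} {j} i<j = ≤-resp (trans (fromℤ-+ (+ 1) i) (+-comm _ _)) refl (fromℤ-mono (ℤ.i<j⇒suc[i]≤j i<j))

  x≤∣x∣ : ∀ x → x ≤ ∣ x ∣
  x≤∣x∣ x with total (- x) x
  ... | inj₁ _ = ≤-refl
  ... | inj₂ x≤-x = x≤-x

  -x≤∣x∣ : ∀ x → - x ≤ ∣ x ∣
  -x≤∣x∣ x with total (- x) x
  ... | inj₁ -x≤x = -x≤x
  ... | inj₂ _ = ≤-refl

  -- Any other integer is at distance at least 1 - ε from x, which is no less than ε.
  nearest : ∀ {x ε} i → ε + ε ≤ ι 1 → x - fromℤ i ∈± ε → IsDistanceToℤ x ∣ x - fromℤ i ∣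
  nearest {x} {ε} i 2ε≤1 near = i , refl , minimal
    where
    minimal : ∀ m → ∣ x - fromℤ i ∣ ≤ ∣ x - fromℤ m ∣
    minimal m with ℤ.<-cmp i m
    ... | tri≈ _ ≡.refl _ = ≤-refl
    ... | tri< i<m _ _ = ≤-trans (±⇒∣∣≤ near) (≤-trans (0≤-⇒≤ (≤-resp refl (gap x (fromℤ i) (fromℤ m) ε)
        (≤⇒0≤- 2ε≤1 ⊕ ≤⇒0≤- (fromℤ-<⇒+1≤ i<m) ⊕ ≤⇒0≤- (proj₂ near)))) (-x≤∣x∣ _))
      where
      gap : ∀ x i m e → (ι 1 - (e + e)) + (m - (i + ι 1)) + (e - (x - i)) ≈ - (x - m) - e
      gap = solve 4 (λ x i m e → (# 1 :- (e :+ e)) :+ (m :- (i :+ # 1)) :+ (e :- (x :- i)) := (:- (x :- m)) :- e) refl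
    ... | tri> _ _ m<i = ≤-trans (±⇒∣∣≤ near) (≤-trans (0≤-⇒≤ (≤-resp refl (gap x (fromℤ i) (fromℤ m) ε)
        (≤⇒0≤- 2ε≤1 ⊕ ≤⇒0≤- (fromℤ-<⇒+1≤ m<i) ⊕ ≤⇒0≤- (proj₁ near)))) (x≤∣x∣ _))
      where
      gap : ∀ x i m e → (ι 1 - (e + e)) + (i - (m + ι 1)) + ((x - i) - - e) ≈ (x - m) - e
      gap = solve 4 (λ x i m e → (# 1 :- (e :+ e)) :+ (i :- (m :+ # 1)) :+ ((x :- i) :- (:- e)) := (x :- m) :- e) refl

  dot : ℝ² → ℝ² → Carrier
  dot (x , y) (c , s) = c * x + s * y

  IsUnit : ℝ² → Set
  IsUnit (c , s) = c * c + s * s ≈ 1#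

  -- Rotating q back by the angle gives a point whose first coordinate is `dot q u` up to sign; for
  -- the negative sign the integer is negated too.
  covered : ∀ {ε} u (unit : IsUnit u) q i → ε + ε ≤ ι 1 → dot q u - fromℤ i ∈± ε →
    q ∈ R[ proj₁ (angle (proj₁ u) (proj₂ u) unit) ] (E ε)
  covered {ε} (c , s) unit q@(x , y) i 2ε≤1 near with angle c s unit
  ... | θ , c′ , s′ , isC , isS , same = p , (∣ px - fromℤ (proj₁ near′) ∣ , nearest (proj₁ near′) 2ε≤1 (proj₂ near′) , ±⇒∣∣≤ (proj₂ near′)) ,
      c′ , s′ , isC , isS , trans (sym (*-identityˡ x)) (trans (*-congʳ (sym unit′)) (fst c′ s′ x y)) ,
        trans (sym (*-identityˡ y)) (trans (*-congʳ (sym unit′)) (snd c′ s′ x y))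
    where
    px = c′ * x + s′ * y
    p = px , c′ * y - s′ * x
    fst : ∀ c s x y → (c * c + s * s) * x ≈ c * (c * x + s * y) - s * (c * y - s * x)
    fst = solve 4 (λ c s x y → (c :* c :+ s :* s) :* x := c :* (c :* x :+ s :* y) :- s :* (c :* y :- s :* x)) refl
    snd : ∀ c s x y → (c * c + s * s) * y ≈ s * (c * x + s * y) + c * (c * y - s * x)
    snd = solve 4 (λ c s x y → (c :* c :+ s :* s) :* y := s :* (c :* x :+ s :* y) :+ c :* (c :* y :- s :* x)) refl
    squares : ∀ c s → - c * - c + - s * - s ≈ c * c + s * s
    squares = solve 2 (λ c s → (:- c) :* (:- c) :+ (:- s) :* (:- s) := c :* c :+ s :* s) refl
    flipped : ∀ c s x y i → - (c * x + s * y - i) ≈ - c * x + - s * y - - i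
    flipped = solve 5 (λ c s x y i → :- (c :* x :+ s :* y :- i) := (:- c) :* x :+ (:- s) :* y :- (:- i)) refl
    unit′ : c′ * c′ + s′ * s′ ≈ 1#
    unit′ = [ (λ (c≈ , s≈) → trans (+-cong (*-cong c≈ c≈) (*-cong s≈ s≈)) unit)
            , (λ (c≈ , s≈) → trans (+-cong (*-cong c≈ c≈) (*-cong s≈ s≈)) (trans (squares c s) unit)) ]′ same
    near′ : ∃[ j ] (px - fromℤ j ∈± ε)
    near′ = [ (λ (c≈ , s≈) → i , ±-cast near (+-congʳ (sym (+-cong (*-congʳ c≈) (*-congʳ s≈)))) refl)
            , (λ (c≈ , s≈) → ℤ.- i , ±-cast (±-neg near) (trans (flipped c s x y (fromℤ i))
                (+-cong (sym (+-cong (*-congʳ c≈) (*-congʳ s≈))) (-‿cong (sym (fromℤ-neg i))))) refl) ]′ same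

  finiteRotationProperty : ∀ {ε} n (u : Fin (suc n) → ℝ²) → (∀ j → IsUnit (u j)) → 0# < ε → ε + ε ≤ ι 1 →
    (∀ q → ¬ (∀ j i → ¬ (dot q (u j) - fromℤ i ∈± ε))) → FiniteRotationProperty ε
  finiteRotationProperty {ε} n u unit 0<ε 2ε≤1 dense = 0<ε , n , (λ j → proj₁ (angle (proj₁ (u j)) (proj₂ (u j)) (unit j))) ,
    λ q → let j , i , near = found q in j , covered (u j) (unit j) q i 2ε≤1 near
    where
    found : ∀ q → ∃[ j ] ∃[ i ] (dot q (u j) - fromℤ i ∈± ε)
    found q = byContradiction λ none → dense q λ j i near → none (j , i , near)

  -- Completeness speaks of suprema, so the infimum is the supremum of the lower bounds: 0 is one of
  -- them, and `b` bounds them all.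
  infimum : ∀ {b} → FiniteRotationProperty b → ∃[ m ] (IsInfimum _≤_ FiniteRotationProperty m × m ≤ b)
  infimum {b} frp = proj₁ sup , ((λ x x∈ → proj₂ (proj₂ sup) x λ l lower → lower x x∈) , λ l lower → proj₁ (proj₂ sup) l lower) ,
      proj₂ (proj₂ sup) b λ l lower → lower b frp
    where
    sup = complete (IsLowerBound _≤_ FiniteRotationProperty) (0# , λ x x∈ → proj₁ (proj₁ x∈)) (b , λ l lower → lower b frp)

  -- Soundness of the certificates

  σ⟦_⟧ : Sign → Carrier
  σ⟦ σ ⟧ = fromℤ (toℤ σ)

  -- A one-sided condition suffices: in a triple of sum zero it implies σa < 4 for every entry.
  Positive : Sign → Triple Carrier → Set
  Positive σ ⟨ a , b , c ⟩ = (0# < σ⟦ σ ⟧ * a + ι 2) × (0# < σ⟦ σ ⟧ * b + ι 2) × (0# < σ⟦ σ ⟧ * c + ι 2)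

  StepEq : Sign → Sign → ℤ → (a b b′ c : Carrier) → Set
  StepEq dir σ k a b b′ c = ι 3 * c ≈ ι 3 * a + σ⟦ dir ⟧ * (ι 15 * (σ⟦ σ ⟧ * fromℤ k) - (b′ - b))

  Step : Sign → Fin 3 → Sign → (a b c : Triple Carrier) → Set
  Step dir j σ ⟨ a₀ , a₁ , a₂ ⟩ ⟨ b₀ , b₁ , b₂ ⟩ ⟨ c₀ , c₁ , c₂ ⟩ =
    StepEq dir σ (Triple.t₀ (spike j)) a₀ b₁ b₂ c₀ × StepEq dir σ (Triple.t₁ (spike j)) a₁ b₂ b₀ c₁ × StepEq dir σ (Triple.t₂ (spike j)) a₂ b₀ b₁ c₂

  -- The continuation of a chain beyond its last two triples `a`, `b`. A step involves the sign of
  -- its middle triple, hence `σ` is the sign of `b`.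
  Run : Sign → ℕ → Triple Carrier → Sign → Triple Carrier → Set
  Run dir zero    a σ b = ⊤
  Run dir (suc n) a σ b = ∃[ c ] ∃[ σ′ ] ∃[ j ] (Positive σ′ c × Step dir j σ a b c × Run dir n b σ′ c)

  Less : Sign → ℕ → ℤ → Carrier → Carrier → Set
  Less σ k c u v = ι k * (σ⟦ σ ⟧ * (u - v)) < fromℤ c

  -- For fractional parts (1/2, 1/4, 1/4) the deviations are (5/2, -5/4, -5/4), so x - y and x - z
  -- equal 15/4. The bounds 21/10 and 27/5 are 15/4 ∓ 33/20, and y - z is kept within 7/5 of 0.
  Hexagon′ : Sign → Triple Carrier → Set
  Hexagon′ σ ⟨ x , y , z ⟩ = Less σ 5 (+ 27) x y × Less σ 10 (ℤ.- + 21) y x × Less σ 5 (+ 27) x z × Less σ 10 (ℤ.- + 21) z x ×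
    Less σ 5 (+ 7) y z × Less σ 5 (+ 7) z y

  Hexagon : Sign → Triple Carrier → Set
  Hexagon σ e = ∃[ h ] Hexagon′ σ (rotate h e)

  eval : ∀ {n} → Vec Carrier n → Vec ℤ n → Carrier
  eval []       []       = 0#
  eval (x ∷ xs) (a ∷ as) = fromℤ a * x + eval xs as

  eval-zipWith-+ : ∀ {n} (xs : Vec Carrier n) as bs → eval xs (zipWith ℤ._+_ as bs) ≈ eval xs as + eval xs bs
  eval-zipWith-+ [] [] [] = sym (+-identityˡ 0#)
  eval-zipWith-+ (x ∷ xs) (a ∷ as) (b ∷ bs) = trans (+-cong (*-congʳ (fromℤ-+ a b)) (eval-zipWith-+ xs as bs))
    (solve 5 (λ a b x u v → (a :+ b) :* x :+ (u :+ v) := (a :* x :+ u) :+ (b :* x :+ v)) refl (fromℤ a) (fromℤ b) x (eval xs as) (eval xs bs))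

  eval-zipWith-- : ∀ {n} (xs : Vec Carrier n) as bs → eval xs (zipWith ℤ._-_ as bs) ≈ eval xs as - eval xs bs
  eval-zipWith-- [] [] [] = sym (-‿inverseʳ 0#)
  eval-zipWith-- (x ∷ xs) (a ∷ as) (b ∷ bs) = trans (+-cong (*-congʳ (fromℤ-- a b)) (eval-zipWith-- xs as bs))
    (solve 5 (λ a b x u v → (a :- b) :* x :+ (u :- v) := (a :* x :+ u) :- (b :* x :+ v)) refl (fromℤ a) (fromℤ b) x (eval xs as) (eval xs bs))

  eval-map-* : ∀ {n} (xs : Vec Carrier n) k as → eval xs (map (k ℤ.*_) as) ≈ fromℤ k * eval xs as
  eval-map-* [] k [] = sym (zeroʳ _)
  eval-map-* (x ∷ xs) k (a ∷ as) = trans (+-cong (*-congʳ (fromℤ-* k a)) (eval-map-* xs k as))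
    (solve 4 (λ k a x u → k :* a :* x :+ k :* u := k :* (a :* x :+ u)) refl (fromℤ k) (fromℤ a) x (eval xs as))

  ∧-true : ∀ {a b} → a ∧ b ≡ true → (a ≡ true) × (b ≡ true)
  ∧-true {true} {true} _ = ≡.refl , ≡.refl

  every-sound : ∀ p → every p ≡ true → ∀ j σ → p j σ ≡ true
  every-sound p ok zero pos = proj₁ (∧-true ok)
  every-sound p ok zero neg = proj₁ (∧-true (proj₂ (∧-true {p zero pos} ok)))
  every-sound p ok (suc zero) pos = proj₁ (∧-true (proj₂ (∧-true {p zero neg} (proj₂ (∧-true {p zero pos} ok)))))
  every-sound p ok (suc zero) neg = proj₁ (∧-true (proj₂ (∧-true {p (suc zero) pos} (proj₂ (∧-true {p zero neg} (proj₂ (∧-true {p zero pos} ok)))))))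
  every-sound p ok (suc (suc zero)) pos = proj₁ (∧-true (proj₂ (∧-true {p (suc zero) neg} (proj₂ (∧-true {p (suc zero) pos} (proj₂ (∧-true {p zero neg} (proj₂ (∧-true {p zero pos} ok)))))))))
  every-sound p ok (suc (suc zero)) neg = proj₂ (∧-true {p (suc (suc zero)) pos} (proj₂ (∧-true {p (suc zero) neg} (proj₂ (∧-true {p (suc zero) pos} (proj₂ (∧-true {p zero neg} (proj₂ (∧-true {p zero pos} ok)))))))))

  isZero-sound : ∀ {i} → isZero i ≡ true → i ≡ + 0
  isZero-sound {+ 0} _ = ≡.refl

  isNonPositive-sound : ∀ i → isNonPositive i ≡ true → fromℤ i ≤ 0#
  isNonPositive-sound (+ 0) _ = ≤-refl
  isNonPositive-sound -[1+ n ] _ = 0≤-⇒≤ (≤-resp refl (flip (ι (suc n))) (0≤fromℕ (suc n)))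
    where
    flip : ∀ x → x ≈ 0# - - x
    flip = solve 1 (λ x → x := # 0 :- (:- x)) refl

  module Soundness (p q r s : Carrier) where

    ρ : Vec Carrier 5
    ρ = p ∷ q ∷ r ∷ s ∷ 1# ∷ []

    ⟦_⟧ : Form → Carrier
    ⟦_⟧ = eval ρ

    private
      drop : ∀ x u → 0# * x + u ≈ u
      drop x u = trans (+-congʳ (zeroˡ x)) (+-identityˡ u)

    ⟦constant⟧ : ∀ k → ⟦ constantForm k ⟧ ≈ fromℤ k
    ⟦constant⟧ k = trans (drop p _) (trans (drop q _) (trans (drop r _) (trans (drop s _) (trans (+-identityʳ _) (*-identityʳ _)))))

    ⟦⊞⟧ : ∀ u v → ⟦ u ⊞ v ⟧ ≈ ⟦ u ⟧ + ⟦ v ⟧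
    ⟦⊞⟧ = eval-zipWith-+ ρ

    ⟦⊟⟧ : ∀ u v → ⟦ u ⊟ v ⟧ ≈ ⟦ u ⟧ - ⟦ v ⟧
    ⟦⊟⟧ = eval-zipWith-- ρ

    ⟦⊡⟧ : ∀ k u → ⟦ k ⊡ u ⟧ ≈ fromℤ k * ⟦ u ⟧
    ⟦⊡⟧ = eval-map-* ρ

    isNonPositiveConstant-sound : ∀ u → isNonPositiveConstant u ≡ true → ⟦ u ⟧ ≤ 0#
    isNonPositiveConstant-sound (a ∷ b ∷ c ∷ d ∷ e ∷ []) ok
      with a≡0 , ok₁ ← ∧-true {isZero a} ok
      with b≡0 , ok₂ ← ∧-true {isZero b} ok₁
      with c≡0 , ok₃ ← ∧-true {isZero c} ok₂
      with d≡0 , ok₄ ← ∧-true {isZero d} ok₃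
      with ≡.refl ← isZero-sound {a} a≡0 | ≡.refl ← isZero-sound {b} b≡0 | ≡.refl ← isZero-sound {c} c≡0 | ≡.refl ← isZero-sound {d} d≡0
      = ≤-trans (≤-reflexive (⟦constant⟧ e)) (isNonPositive-sound e ok₄)

    AllPositive : List Form → Set
    AllPositive = All (λ u → 0# < ⟦ u ⟧)

    hypothesis-positive : ∀ {us} → AllPositive us → ∀ i → 0# < ⟦ hypothesis us i ⟧
    hypothesis-positive [] i = <-resp refl (sym (⟦constant⟧ (+ 1))) (0<fromℕ 0)
    hypothesis-positive (0<u ∷ _) zero = 0<u
    hypothesis-positive (_ ∷ all) (suc i) = hypothesis-positive all i

    summand-positive : ∀ {us} → AllPositive us → ∀ i n → 0# < ⟦ + suc n ⊡ hypothesis us i ⟧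
    summand-positive {us} all i n = <-resp refl (sym (⟦⊡⟧ (+ suc n) (hypothesis us i))) (*-pos (0<fromℕ n) (hypothesis-positive all i))

    combine-nonnegative : ∀ {us} → AllPositive us → ∀ c → 0# ≤ ⟦ combine us c ⟧
    combine-nonnegative all [] = ≤-reflexive (sym (⟦constant⟧ (+ 0)))
    combine-nonnegative {us} all (i at n & c) = ≤-resp refl (sym (⟦⊞⟧ (+ suc n ⊡ hypothesis us i) (combine us c)))
      (<⇒≤ (summand-positive all i n) ⊕ combine-nonnegative all c)

    refutes-sound : ∀ {us} → AllPositive us → ∀ {u} t → refutes us u t ≡ true → ¬ 0# ≤ ⟦ u ⟧
    refutes-sound {us} all {u} (k ⊢ t@(i at n & c)) ok 0≤u = <⇒≱
      (<-resp refl (sym (⟦⊞⟧ (+ k ⊡ u) (combine us t))) (≤-resp refl (sym (⟦⊡⟧ (+ k) u)) (0≤fromℕ k ⊛ 0≤u) ⊕<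
        <-resp refl (trans (+-comm _ _) (sym (⟦⊞⟧ (+ suc n ⊡ hypothesis us i) (combine us c)))) (combine-nonnegative all c ⊕< summand-positive all i n)))
      (isNonPositiveConstant-sound (+ k ⊡ u ⊞ combine us t) ok)

    -- Multiplying by the denominator `D` keeps the coefficients of the forms integral.
    Represents : ℕ → Triple Form → Triple Carrier → Set
    Represents D ⟨ u , v , w ⟩ ⟨ a , b , c ⟩ = (ι D * a ≈ ⟦ u ⟧) × (ι D * b ≈ ⟦ v ⟧) × (ι D * c ≈ ⟦ w ⟧)

    record Realises (S : Side) (a : Triple Carrier) (σ : Sign) (b : Triple Carrier) : Set where
      field
        signs    : Side.sign S ≡ σ
        previous : Represents (Side.denominator S) (Side.previous S) a
        current  : Represents (Side.denominator S) (Side.current S) b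

    triple-equation : ∀ {a} D u → ι D * a ≈ ⟦ u ⟧ → ι (3 ℕ.* D) * a ≈ ⟦ + 3 ⊡ u ⟧
    triple-equation {a} D u eq = trans (*-congʳ (fromℕ-* 3 D)) (trans (*-assoc _ _ _) (trans (*-congˡ eq) (sym (⟦⊡⟧ (+ 3) u))))

    rescale : ∀ D F a → Represents D F a → Represents (3 ℕ.* D) (mapT (+ 3 ⊡_) F) a
    rescale D ⟨ u , v , w ⟩ _ (p , q , r) = triple-equation D u p , triple-equation D v q , triple-equation D w r

    new-equation : ∀ D dir σ k u v v′ {a b b′ c} → ι D * a ≈ ⟦ u ⟧ → ι D * b ≈ ⟦ v ⟧ → ι D * b′ ≈ ⟦ v′ ⟧ →
      StepEq dir σ k a b b′ c →
      ι (3 ℕ.* D) * c ≈ ⟦ + 3 ⊡ u ⊞ toℤ dir ⊡ (constantForm (+ 15 ℤ.* + D ℤ.* (toℤ σ ℤ.* k)) ⊟ (v′ ⊟ v)) ⟧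
    new-equation D dir σ k u v v′ {a} {b} {b′} {c} a≈ b≈ b′≈ step =
      trans (*-congʳ (fromℕ-* 3 D)) (trans (front (ι 3) (ι D) c) (trans (*-congˡ step)
      (trans (distribute (ι D) (ι 3) a σ⟦ dir ⟧ (ι 15) σ⟦ σ ⟧ (fromℤ k) b b′)
      (sym (trans (⟦⊞⟧ (+ 3 ⊡ u) (toℤ dir ⊡ (constantForm kD ⊟ (v′ ⊟ v)))) (+-cong (trans (⟦⊡⟧ (+ 3) u) (*-congˡ (sym a≈)))
        (trans (⟦⊡⟧ (toℤ dir) (constantForm kD ⊟ (v′ ⊟ v))) (*-congˡ (trans (⟦⊟⟧ (constantForm kD) (v′ ⊟ v))
          (+-cong (trans (⟦constant⟧ kD) (trans (fromℤ-* (+ 15 ℤ.* + D) (toℤ σ ℤ.* k)) (*-cong (fromℤ-* (+ 15) (+ D)) (fromℤ-* (toℤ σ) k))))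
            (-‿cong (trans (⟦⊟⟧ v′ v) (+-cong (sym b′≈) (-‿cong (sym b≈)))))))))))))))
      where
      kD = + 15 ℤ.* + D ℤ.* (toℤ σ ℤ.* k)
      front : ∀ x y z → (x * y) * z ≈ y * (x * z)
      front = solve 3 (λ x y z → (x :* y) :* z := y :* (x :* z)) refl
      distribute : ∀ D t a d f s k b b′ → D * (t * a + d * (f * (s * k) - (b′ - b))) ≈ t * (D * a) + d * ((f * D) * (s * k) - (D * b′ - D * b))
      distribute = solve 9 (λ D t a d f s k b b′ → D :* (t :* a :+ d :* (f :* (s :* k) :- (b′ :- b))) := t :* (D :* a) :+ d :* ((f :* D) :* (s :* k) :- (D :* b′ :- D :* b))) refl

    next-realises : ∀ dir j σ′ S {a σ b c} → Realises S a σ b → Step dir j σ a b c →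
      Realises (side (3 ℕ.* Side.denominator S) (mapT (+ 3 ⊡_) (Side.current S)) σ′ (next dir j S)) b σ′ c
    next-realises dir j σ′ (side D ⟨ u₀ , u₁ , u₂ ⟩ σ ⟨ v₀ , v₁ , v₂ ⟩) record { signs = ≡.refl ; previous = p₀ , p₁ , p₂ ; current = c@(c₀ , c₁ , c₂) } (s₀ , s₁ , s₂) =
      record { signs = ≡.refl ; previous = rescale D ⟨ v₀ , v₁ , v₂ ⟩ _ c
             ; current = new-equation D dir σ _ u₀ v₁ v₂ p₀ c₁ c₂ s₀ , new-equation D dir σ _ u₁ v₂ v₀ p₁ c₂ c₀ s₁ , new-equation D dir σ _ u₂ v₀ v₁ p₂ c₀ c₁ s₂ }

    positivity-sound : ∀ D σ u {a} → ι (suc D) * a ≈ ⟦ u ⟧ → 0# < σ⟦ σ ⟧ * a + ι 2 → 0# < ⟦ positivity (suc D) σ u ⟧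
    positivity-sound D σ u {a} eq 0<a = <-resp refl
      (trans (distribute (ι (suc D)) σ⟦ σ ⟧ a (ι 2)) (sym (trans (⟦⊞⟧ (toℤ σ ⊡ u) (constantForm (+ 2 ℤ.* + suc D))) (+-cong (trans (⟦⊡⟧ (toℤ σ) u) (*-congˡ (sym eq)))
        (trans (⟦constant⟧ (+ 2 ℤ.* + suc D)) (fromℤ-* (+ 2) (+ suc D)))))))
      (*-pos (0<fromℕ D) 0<a)
      where
      distribute : ∀ D s a t → D * (s * a + t) ≈ s * (D * a) + t * D
      distribute = solve 4 (λ D s a t → D :* (s :* a :+ t) := s :* (D :* a) :+ t :* D) refl

    positivities-sound : ∀ D σ F a {us} → 0 ℕ.< D → Represents D F a → Positive σ a → AllPositive us → AllPositive (positivities D σ F us)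
    positivities-sound (suc D) σ ⟨ u , v , w ⟩ _ _ (p , q , r) (p′ , q′ , r′) all =
      positivity-sound D σ u p p′ ∷ positivity-sound D σ v q q′ ∷ positivity-sound D σ w r r′ ∷ all

    failure-sound : ∀ σ₀ {us} → AllPositive us → ∀ k c u v {a b} t → ι 1 * a ≈ ⟦ u ⟧ → ι 1 * b ≈ ⟦ v ⟧ →
      refutes us (failure σ₀ u v k c) t ≡ true → Less σ₀ k c a b
    failure-sound σ₀ all k c u v {a} {b} t a≈ b≈ ok = ≰⇒> λ c≤ → refutes-sound all t ok
      (≤-resp refl (sym (trans (⟦⊟⟧ (+ k ⊡ (toℤ σ₀ ⊡ (u ⊟ v))) (constantForm c)) (+-cong
        (trans (⟦⊡⟧ (+ k) (toℤ σ₀ ⊡ (u ⊟ v))) (*-congˡ (trans (⟦⊡⟧ (toℤ σ₀) (u ⊟ v)) (*-congˡ (trans (⟦⊟⟧ u v) (+-cong (one u a≈) (-‿cong (one v b≈))))))))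
        (-‿cong (⟦constant⟧ c))))) (≤⇒0≤- c≤))
      where
      one : ∀ {a} u → ι 1 * a ≈ ⟦ u ⟧ → ⟦ u ⟧ ≈ a
      one _ eq = trans (sym eq) (trans (*-congʳ fromℕ1≈1) (*-identityˡ _))

    represents-rotate : ∀ h F a → Represents 1 F a → Represents 1 (rotate h F) (rotate h a)
    represents-rotate zero _ _ rep = rep
    represents-rotate (suc zero) _ _ (p , q , r) = q , r , p
    represents-rotate (suc (suc zero)) _ _ (p , q , r) = r , p , q

    module _ (σ₀ : Sign) (a : Triple Carrier) (rep : Represents 1 centre a) where

      concludes-sound : ∀ {us} → AllPositive us → ∀ F b c₁ c₂ c₃ c₄ c₅ c₆ → Represents 1 F b →
        concludes σ₀ us F c₁ c₂ c₃ c₄ c₅ c₆ ≡ true → Hexagon′ σ₀ b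
      concludes-sound {us} all ⟨ x , y , z ⟩ _ c₁ c₂ c₃ c₄ c₅ c₆ (x≈ , y≈ , z≈) ok
        with ok₁ , rest₁ ← ∧-true {refutes us (failure σ₀ x y 5 (+ 27)) c₁} ok
        with ok₂ , rest₂ ← ∧-true {refutes us (failure σ₀ y x 10 (ℤ.- + 21)) c₂} rest₁
        with ok₃ , rest₃ ← ∧-true {refutes us (failure σ₀ x z 5 (+ 27)) c₃} rest₂
        with ok₄ , rest₄ ← ∧-true {refutes us (failure σ₀ z x 10 (ℤ.- + 21)) c₄} rest₃
        with ok₅ , ok₆ ← ∧-true {refutes us (failure σ₀ y z 5 (+ 7)) c₅} rest₄
        = failure-sound σ₀ all 5 (+ 27) x y c₁ x≈ y≈ ok₁ , failure-sound σ₀ all 10 (ℤ.- + 21) y x c₂ y≈ x≈ ok₂ ,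
          failure-sound σ₀ all 5 (+ 27) x z c₃ x≈ z≈ ok₃ , failure-sound σ₀ all 10 (ℤ.- + 21) z x c₄ z≈ x≈ ok₄ ,
          failure-sound σ₀ all 5 (+ 7) y z c₅ y≈ z≈ ok₅ , failure-sound σ₀ all 5 (+ 7) z y c₆ z≈ y≈ ok₆

      private
        0<3* : ∀ {D} → 0 ℕ.< D → 0 ℕ.< 3 ℕ.* D
        0<3* {suc D} _ = ℕ.s≤s ℕ.z≤n

      -- At an inner node the run supplies the actual spike and sign, and thereby the branch to
      -- follow. The positivity forms collected along this branch hold for the actual chain, so a
      -- certificate at its end applies.
      check-sound : ∀ m n R L us t → check σ₀ m n R L us t ≡ true → AllPositive us →
        0 ℕ.< Side.denominator R → 0 ℕ.< Side.denominator L →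
        ∀ {r r′ l l′ σ τ} → Realises R r σ r′ → Realises L l τ l′ → Run pos m r σ r′ → Run neg n l τ l′ → Hexagon σ₀ a
      check-sound m n R L us (refuted c) ok all _ _ _ _ _ _ =
        ⊥-elim (refutes-sound all (0 ⊢ c) ok (≤-reflexive (sym (⟦constant⟧ (+ 0)))))
      check-sound m n R L us (conclusion h c₁ c₂ c₃ c₄ c₅ c₆) ok all _ _ _ _ _ _ =
        h , concludes-sound all (rotate h centre) (rotate h a) c₁ c₂ c₃ c₄ c₅ c₆ (represents-rotate h centre a rep) ok
      check-sound (suc m) n R L us (rightwards t) ok all dR dL rR rL (_ , σ′ , j , positive , step , run) runL =
        let R′ = extend pos j σ′ R
            rR′ = next-realises pos j σ′ R rR step
        in check-sound m n R′ L (positivities (Side.denominator R′) σ′ (Side.current R′) us) (t j σ′) (every-sound (λ j σ → let r = extend pos j σ R in check σ₀ m n r L (positivities (Side.denominator r) σ (Side.current r) us) (t j σ)) ok j σ′)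
          (positivities-sound (Side.denominator R′) σ′ (Side.current R′) _ (0<3* dR) (Realises.current rR′) positive all)
          (0<3* dR) dL rR′ rL run runL
      check-sound m (suc n) R L us (leftwards t) ok all dR dL rR rL runR (_ , σ′ , j , positive , step , run) =
        let L′ = extend neg j σ′ L
            rL′ = next-realises neg j σ′ L rL step
        in check-sound m n R L′ (positivities (Side.denominator L′) σ′ (Side.current L′) us) (t j σ′) (every-sound (λ j σ → let l = extend neg j σ L in check σ₀ m n R l (positivities (Side.denominator l) σ (Side.current l) us) (t j σ)) ok j σ′)
          (positivities-sound (Side.denominator L′) σ′ (Side.current L′) _ (0<3* dL) (Realises.current rL′) positive all)
          dR (0<3* dL) rR rL′ runR run

  -- Deviations of triples that stay far from the integers

  fifth : Carrier
  fifth = ι 5 ⁻¹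

  5*fifth : ι 5 * fifth ≈ 1#
  5*fifth = ⁻¹-inverseʳ _ λ eq → proj₂ (0<fromℕ 4) (sym eq)

  fromℤ-reflects-< : ∀ {i j} → fromℤ i < fromℤ j → i ℤ.< j
  fromℤ-reflects-< {i} {j} i<j = ℤ.≰⇒> λ j≤i → <⇒≱ i<j (fromℤ-mono j≤i)

  x<x+1 : ∀ x → x < x + ι 1
  x<x+1 x = <-by (0<fromℕ 0) refl

  fromℤ-injective : ∀ {i j} → fromℤ i ≈ fromℤ j → i ≡ j
  fromℤ-injective {i} {j} i≈j = ℤ.≤-antisym
    (ℤ.≮⇒≥ λ j<i → <⇒≱ (x<x+1 (fromℤ j)) (≤-trans (fromℤ-<⇒+1≤ j<i) (≤-reflexive i≈j)))
    (ℤ.≮⇒≥ λ i<j → <⇒≱ (x<x+1 (fromℤ i)) (≤-trans (fromℤ-<⇒+1≤ i<j) (≤-reflexive (sym i≈j))))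

  *-cancel-< : ∀ {L x y} → 0# < L → L * x < L * y → x < y
  *-cancel-< {L} {x} {y} 0<L p = ≰⇒> λ y≤x → <⇒≱ p (*-monoˡ-≤ (<⇒≤ 0<L) y≤x)

  infixl 6 _⊕⊕_
  _⊕⊕_ : ∀ {x y} → 0# < x → 0# < y → 0# < x + y
  0<x ⊕⊕ 0<y = <⇒≤ 0<x ⊕< 0<y

  Sum≈0 : Triple Carrier → Set
  Sum≈0 ⟨ a , b , c ⟩ = a + b + c ≈ 0#

  -- That is x = σ/3 + n + e/15: modulo 1 the mean 2/3 is written as -1/3, so that both cases differ
  -- by a sign only.
  record LiftEq (σ : Sign) (x e : Carrier) (n : ℤ) : Set where
    constructor lifted
    field equation : ι 15 * x ≈ e + ι 5 * σ⟦ σ ⟧ + ι 15 * fromℤ n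

  -- e is 15 times the deviation of the fractional parts of X from their mean, which is 1/3 or 2/3 modulo 1.
  record Lift (X : Triple Carrier) : Set where
    field
      σ        : Sign
      e        : Triple Carrier
      n        : Triple ℤ
      positive : Positive σ e
      balanced : Sum≈0 e
      eq₀ : LiftEq σ (Triple.t₀ X) (Triple.t₀ e) (Triple.t₀ n)
      eq₁ : LiftEq σ (Triple.t₁ X) (Triple.t₁ e) (Triple.t₁ n)
      eq₂ : LiftEq σ (Triple.t₂ X) (Triple.t₂ e) (Triple.t₂ n)

  Far : Carrier → Set
  Far x = ∀ i → ¬ (x - fromℤ i ∈± fifth)

  fractional : ∀ x → Far x → ∃[ i ] (ι 1 < ι 5 * (x - fromℤ i) × ι 5 * (x - fromℤ i) < ι 4)
  fractional x far with floor x
  ... | i , i≤x , x<i+1 = i , ≰⇒> below , ≰⇒> above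
    where
    scale : ∀ {y z} → ι 5 * y ≤ ι 5 * z → y ≤ z
    scale = *-cancel-≤ (0<fromℕ 4)
    1≈5fifth : ι 1 ≈ ι 5 * fifth
    1≈5fifth = trans fromℕ1≈1 (sym 5*fifth)
    below : ¬ ι 5 * (x - fromℤ i) ≤ ι 1
    below p = far i (nonneg⇒± (≤⇒0≤- i≤x) (scale (≤-resp refl 1≈5fifth p)))
    above : ¬ ι 4 ≤ ι 5 * (x - fromℤ i)
    above p = far (i ℤ.+ + 1) (±-cast (±-neg near) (trans (flip x (fromℤ i)) (+-congˡ (-‿cong (sym (fromℤ-+ i (+ 1)))))) refl)
      where
      gap : ∀ x i → ι 5 * (x - i) - ι 4 ≈ ι 1 - ι 5 * ((i + ι 1) - x)
      gap = solve 2 (λ x i → # 5 :* (x :- i) :- # 4 := # 1 :- # 5 :* ((i :+ # 1) :- x)) refl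
      flip : ∀ x i → - ((i + ι 1) - x) ≈ x - (i + ι 1)
      flip = solve 2 (λ x i → :- ((i :+ # 1) :- x) := x :- (i :+ # 1)) refl
      short : ι 5 * ((fromℤ i + ι 1) - x) ≤ ι 5 * fifth
      short = 0≤-⇒≤ (≤-resp refl (trans (gap x (fromℤ i)) (+-congʳ 1≈5fifth)) (≤⇒0≤- p))
      near : (fromℤ i + ι 1) - x ∈± fifth
      near = nonneg⇒± (≤⇒0≤- (<⇒≤ x<i+1)) (scale short)

  between-1-and-2 : ∀ i → fromℤ (+ 0) < fromℤ i → fromℤ i < fromℤ (+ 3) → i ≡ + 1 ⊎ i ≡ + 2
  between-1-and-2 i p q with fromℤ-reflects-< {+ 0} {i} p | fromℤ-reflects-< {i} {+ 3} q
  between-1-and-2 (+ 1) p q | _ | _ = inj₁ ≡.refl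
  between-1-and-2 (+ 2) p q | _ | _ = inj₂ ≡.refl
  between-1-and-2 (+ suc (suc (suc n))) p q | _ | ℤ.+<+ (ℕ.s≤s (ℕ.s≤s (ℕ.s≤s ())))
  between-1-and-2 (+ 0) p q | ℤ.+<+ () | _

  NearFraction : Carrier → ℤ → Set
  NearFraction x i = ι 1 < ι 5 * (x - fromℤ i) × ι 5 * (x - fromℤ i) < ι 4

  -- The three fractional parts sum to an integer `N`, and they lie between 1/5 and 4/5, so `N` is 1
  -- or 2.
  lift-from : ∀ x y z i j k → x + y + z ≈ 0# → NearFraction x i → NearFraction y j → NearFraction z k → Lift ⟨ x , y , z ⟩
  lift-from x y z i j k sum (1<f , f<4) (1<g , g<4) (1<h , h<4) = from-total (between-1-and-2 N lower upper)
    where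
    N : ℤ
    N = ℤ.- (i ℤ.+ j ℤ.+ k)
    u = x - fromℤ i
    v = y - fromℤ j
    w = z - fromℤ k
    N≈ : fromℤ N ≈ u + v + w
    N≈ = trans (fromℤ-neg (i ℤ.+ j ℤ.+ k)) (trans (-‿cong (trans (fromℤ-+ (i ℤ.+ j) k) (+-congʳ (fromℤ-+ i j))))
      (trans (sym (+-identityˡ _)) (trans (+-congʳ (sym sum)) (regroup x y z (fromℤ i) (fromℤ j) (fromℤ k)))))
      where
      regroup : ∀ x y z i j k → (x + y + z) + - (i + j + k) ≈ (x - i) + (y - j) + (z - k)
      regroup = solve 6 (λ x y z i j k → (x :+ y :+ z) :+ (:- (i :+ j :+ k)) := (x :- i) :+ (y :- j) :+ (z :- k)) refl
    lower : fromℤ (+ 0) < fromℤ N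
    lower = *-cancel-< (0<fromℕ 4) (<-resp (sym (zeroʳ _)) (trans (collect u v w) (*-congˡ (sym N≈)))
      ((0<fromℕ 0 ⊕⊕ <⇒0<- 1<f) ⊕⊕ (0<fromℕ 0 ⊕⊕ <⇒0<- 1<g) ⊕⊕ (0<fromℕ 0 ⊕⊕ <⇒0<- 1<h)))
      where
      collect : ∀ u v w → (ι 1 + (ι 5 * u - ι 1)) + (ι 1 + (ι 5 * v - ι 1)) + (ι 1 + (ι 5 * w - ι 1)) ≈ ι 5 * (u + v + w)
      collect = solve 3 (λ u v w → (# 1 :+ (# 5 :* u :- # 1)) :+ (# 1 :+ (# 5 :* v :- # 1)) :+ (# 1 :+ (# 5 :* w :- # 1)) := # 5 :* (u :+ v :+ w)) refl
    upper : fromℤ N < fromℤ (+ 3)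
    upper = *-cancel-< (0<fromℕ 4) (0<-⇒< (<-resp refl (trans (collect u v w) (+-congˡ (-‿cong (*-congˡ (sym N≈)))))
      ((0<fromℕ 0 ⊕⊕ <⇒0<- f<4) ⊕⊕ (0<fromℕ 0 ⊕⊕ <⇒0<- g<4) ⊕⊕ (0<fromℕ 0 ⊕⊕ <⇒0<- h<4))))
      where
      collect : ∀ u v w → (ι 1 + (ι 4 - ι 5 * u)) + (ι 1 + (ι 4 - ι 5 * v)) + (ι 1 + (ι 4 - ι 5 * w)) ≈ ι 5 * fromℤ (+ 3) - ι 5 * (u + v + w)
      collect = solve 3 (λ u v w → (# 1 :+ (# 4 :- # 5 :* u)) :+ (# 1 :+ (# 4 :- # 5 :* v)) :+ (# 1 :+ (# 4 :- # 5 :* w)) := # 5 :* # 3 :- # 5 :* (u :+ v :+ w)) refl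
    from-total : N ≡ + 1 ⊎ N ≡ + 2 → Lift ⟨ x , y , z ⟩
    from-total (inj₁ N≡1) = record
      { σ = pos ; e = ⟨ dev u , dev v , dev w ⟩ ; n = ⟨ i , j , k ⟩
      ; positive = pos-dev 1<f , pos-dev 1<g , pos-dev 1<h
      ; balanced = trans (total-dev u v w) (trans (+-congʳ (*-congˡ (trans (sym N≈) (reflexive (≡.cong fromℤ N≡1))))) ending)
      ; eq₀ = lifted (eq x (fromℤ i)) ; eq₁ = lifted (eq y (fromℤ j)) ; eq₂ = lifted (eq z (fromℤ k)) }
      where
      dev : Carrier → Carrier
      dev u = ι 15 * u - ι 5
      pos-dev : ∀ {u} → ι 1 < ι 5 * u → 0# < σ⟦ pos ⟧ * dev u + ι 2
      pos-dev {u} p = <-resp refl (identity u) (*-pos (0<fromℕ 2) (<⇒0<- p))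
        where
        identity : ∀ u → ι 3 * (ι 5 * u - ι 1) ≈ ι 1 * (ι 15 * u - ι 5) + ι 2
        identity = solve 1 (λ u → # 3 :* (# 5 :* u :- # 1) := # 1 :* (# 15 :* u :- # 5) :+ # 2) refl
      total-dev : ∀ u v w → (ι 15 * u - ι 5) + (ι 15 * v - ι 5) + (ι 15 * w - ι 5) ≈ ι 15 * (u + v + w) - ι 15
      total-dev = solve 3 (λ u v w → (# 15 :* u :- # 5) :+ (# 15 :* v :- # 5) :+ (# 15 :* w :- # 5) := # 15 :* (u :+ v :+ w) :- # 15) refl
      ending : ι 15 * fromℤ (+ 1) - ι 15 ≈ 0#
      ending = solve 0 (# 15 :* # 1 :- # 15 := # 0) refl
      eq : ∀ x i → ι 15 * x ≈ (ι 15 * (x - i) - ι 5) + ι 5 * fromℤ (+ 1) + ι 15 * i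
      eq = solve 2 (λ x i → # 15 :* x := (# 15 :* (x :- i) :- # 5) :+ # 5 :* # 1 :+ # 15 :* i) refl
    from-total (inj₂ N≡2) = record
      -- The floors are raised by one because the mean 10 is written as 15 - 5.
      { σ = neg ; e = ⟨ dev u , dev v , dev w ⟩ ; n = ⟨ i ℤ.+ + 1 , j ℤ.+ + 1 , k ℤ.+ + 1 ⟩
      ; positive = pos-dev f<4 , pos-dev g<4 , pos-dev h<4
      ; balanced = trans (total-dev u v w) (trans (+-congʳ (*-congˡ (trans (sym N≈) (reflexive (≡.cong fromℤ N≡2))))) ending)
      ; eq₀ = lifted (eq x i) ; eq₁ = lifted (eq y j) ; eq₂ = lifted (eq z k) }
      where
      dev : Carrier → Carrier
      dev u = ι 15 * u - ι 10
      pos-dev : ∀ {u} → ι 5 * u < ι 4 → 0# < σ⟦ neg ⟧ * dev u + ι 2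
      pos-dev {u} p = <-resp refl (identity u) (*-pos (0<fromℕ 2) (<⇒0<- p))
        where
        identity : ∀ u → ι 3 * (ι 4 - ι 5 * u) ≈ fromℤ -[1+ 0 ] * (ι 15 * u - ι 10) + ι 2
        identity = solve 1 (λ u → # 3 :* (# 4 :- # 5 :* u) := con -[1+ 0 ] :* (# 15 :* u :- # 10) :+ # 2) refl
      total-dev : ∀ u v w → (ι 15 * u - ι 10) + (ι 15 * v - ι 10) + (ι 15 * w - ι 10) ≈ ι 15 * (u + v + w) - ι 30
      total-dev = solve 3 (λ u v w → (# 15 :* u :- # 10) :+ (# 15 :* v :- # 10) :+ (# 15 :* w :- # 10) := # 15 :* (u :+ v :+ w) :- # 30) refl
      ending : ι 15 * fromℤ (+ 2) - ι 30 ≈ 0#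
      ending = solve 0 (# 15 :* # 2 :- # 30 := # 0) refl
      eq : ∀ x i → ι 15 * x ≈ (ι 15 * (x - fromℤ i) - ι 10) + ι 5 * fromℤ -[1+ 0 ] + ι 15 * fromℤ (i ℤ.+ + 1)
      eq x i = trans (identity x (fromℤ i)) (+-congˡ (*-congˡ (sym (fromℤ-+ i (+ 1)))))
        where
        identity : ∀ x i → ι 15 * x ≈ (ι 15 * (x - i) - ι 10) + ι 5 * fromℤ -[1+ 0 ] + ι 15 * (i + fromℤ (+ 1))
        identity = solve 2 (λ x i → # 15 :* x := (# 15 :* (x :- i) :- # 10) :+ # 5 :* con -[1+ 0 ] :+ # 15 :* (i :+ # 1)) refl

  lift : ∀ X → Sum≈0 X → Far (Triple.t₀ X) → Far (Triple.t₁ X) → Far (Triple.t₂ X) → Lift X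
  lift ⟨ x , y , z ⟩ sum far₀ far₁ far₂ =
    let i , fi = fractional x far₀
        j , fj = fractional y far₁
        k , fk = fractional z far₂
    in lift-from x y z i j k sum fi fj fk

  -- The relation (ω − ω²)(ζ² − 1) + ζ = 0, row by row.
  Link : (a b c : Triple Carrier) → Set
  Link ⟨ a₀ , a₁ , a₂ ⟩ ⟨ b₀ , b₁ , b₂ ⟩ ⟨ c₀ , c₁ , c₂ ⟩ =
    ((c₁ - c₂) - (a₁ - a₂) + b₀ ≈ 0#) × ((c₂ - c₀) - (a₂ - a₀) + b₁ ≈ 0#) × ((c₀ - c₁) - (a₀ - a₁) + b₂ ≈ 0#)

  lift-difference : ∀ {σ x e n x′ e′ n′} → LiftEq σ x e n → LiftEq σ x′ e′ n′ →
    ι 15 * (x - x′) ≈ (e - e′) + ι 15 * fromℤ (n ℤ.- n′)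
  lift-difference {σ} {x} {e} {n} {x′} {e′} {n′} (lifted p) (lifted q) = trans (distribute (ι 15) x x′) (trans (+-cong p (-‿cong q))
    (trans (cancel e e′ (ι 5 * σ⟦ σ ⟧) (ι 15) (fromℤ n) (fromℤ n′)) (+-congˡ (*-congˡ (sym (fromℤ-- n n′))))))
    where
    distribute : ∀ k x y → k * (x - y) ≈ k * x - k * y
    distribute = solve 3 (λ k x y → k :* (x :- y) := k :* x :- k :* y) refl
    cancel : ∀ e e′ s k n n′ → (e + s + k * n) - (e′ + s + k * n′) ≈ (e - e′) + k * (n - n′)
    cancel = solve 6 (λ e e′ s k n n′ → (e :+ s :+ k :* n) :- (e′ :+ s :+ k :* n′) := (e :- e′) :+ k :* (n :- n′)) refl

  -- Subtracting integers turns a row of Link into an equation between deviations.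
  Row : Sign → (d d′ b : Carrier) → ℤ → Set
  Row σ d d′ b m = (d - d′) + b + ι 5 * σ⟦ σ ⟧ + ι 15 * fromℤ m ≈ 0#

  row : ∀ {σ τ υ a a′ ea ea′ na na′ b eb nb c c′ ec ec′ nc nc′} →
    LiftEq σ a ea na → LiftEq σ a′ ea′ na′ → LiftEq τ b eb nb → LiftEq υ c ec nc → LiftEq υ c′ ec′ nc′ →
    (c - c′) - (a - a′) + b ≈ 0# → Row τ (ec - ec′) (ea - ea′) eb ((nc ℤ.- nc′) ℤ.- (na ℤ.- na′) ℤ.+ nb)
  row {σ} {τ} {υ} {a} {a′} {ea} {ea′} {na} {na′} {b} {eb} {nb} {c} {c′} {ec} {ec′} {nc} {nc′} pa pa′ (lifted pb) pc pc′ eq =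
    trans (sym (trans (distribute (ι 15) (c - c′) (a - a′) b)
        (trans (+-cong (+-cong (lift-difference pc pc′) (-‿cong (lift-difference pa pa′))) pb)
        (trans (collect (ec - ec′) (ea - ea′) eb (ι 5 * σ⟦ τ ⟧) (ι 15) (fromℤ (nc ℤ.- nc′)) (fromℤ (na ℤ.- na′)) (fromℤ nb))
          (+-congˡ (*-congˡ (sym (trans (fromℤ-+ ((nc ℤ.- nc′) ℤ.- (na ℤ.- na′)) nb) (+-congʳ (fromℤ-- (nc ℤ.- nc′) (na ℤ.- na′)))))))))))
      (trans (*-congˡ eq) (zeroʳ _))
    where
    distribute : ∀ k c a b → k * (c - a + b) ≈ k * c - k * a + k * b
    distribute = solve 4 (λ k c a b → k :* (c :- a :+ b) := k :* c :- k :* a :+ k :* b) refl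
    collect : ∀ c a b s k m m′ m″ → (c + k * m) - (a + k * m′) + (b + s + k * m″) ≈ (c - a) + b + s + k * (m - m′ + m″)
    collect = solve 8 (λ c a b s k m m′ m″ → (c :+ k :* m) :- (a :+ k :* m′) :+ (b :+ s :+ k :* m″) := (c :- a) :+ b :+ s :+ k :* (m :- m′ :+ m″)) refl

  unsign : ∀ σ {x k} → 0# < k - σ⟦ σ ⟧ * x → 0# < k + σ⟦ σ ⟧ * x → (0# < k - x) × (0# < k + x)
  unsign pos {x} {k} p q = <-resp refl (identity⁻ k x) p , <-resp refl (identity⁺ k x) q
    where
    identity⁻ : ∀ k x → k - fromℤ (+ 1) * x ≈ k - x
    identity⁻ = solve 2 (λ k x → k :- # 1 :* x := k :- x) refl
    identity⁺ : ∀ k x → k + fromℤ (+ 1) * x ≈ k + x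
    identity⁺ = solve 2 (λ k x → k :+ # 1 :* x := k :+ x) refl
  unsign neg {x} {k} p q = <-resp refl (identity⁺ k x) q , <-resp refl (identity⁻ k x) p
    where
    identity⁻ : ∀ k x → k - fromℤ -[1+ 0 ] * x ≈ k + x
    identity⁻ = solve 2 (λ k x → k :- con -[1+ 0 ] :* x := k :+ x) refl
    identity⁺ : ∀ k x → k + fromℤ -[1+ 0 ] * x ≈ k - x
    identity⁺ = solve 2 (λ k x → k :+ con -[1+ 0 ] :* x := k :- x) refl

  -- Since the sum vanishes, 6 - σ(p - q) = 2(σq + 2) + (σr + 2), and likewise with p and q
  -- exchanged.
  difference-bound : ∀ σ {p q r} → 0# < σ⟦ σ ⟧ * p + ι 2 → 0# < σ⟦ σ ⟧ * q + ι 2 → 0# < σ⟦ σ ⟧ * r + ι 2 → p + q + r ≈ 0# →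
    (0# < ι 6 - (p - q)) × (0# < ι 6 + (p - q))
  difference-bound σ {p} {q} {r} 0<p 0<q 0<r sum = unsign σ
    (<-resp refl (trans (upper σ⟦ σ ⟧ p q r) (vanish _)) (0<q ⊕⊕ 0<q ⊕⊕ 0<r))
    (<-resp refl (trans (lower σ⟦ σ ⟧ p q r) (vanish _)) (0<p ⊕⊕ 0<p ⊕⊕ 0<r))
    where
    vanish : ∀ z → z + σ⟦ σ ⟧ * (p + q + r) ≈ z
    vanish z = trans (+-congˡ (trans (*-congˡ sum) (zeroʳ _))) (+-identityʳ z)
    upper : ∀ s p q r → (s * q + ι 2) + (s * q + ι 2) + (s * r + ι 2) ≈ (ι 6 - s * (p - q)) + s * (p + q + r)
    upper = solve 4 (λ s p q r → (s :* q :+ # 2) :+ (s :* q :+ # 2) :+ (s :* r :+ # 2) := (# 6 :- s :* (p :- q)) :+ s :* (p :+ q :+ r)) refl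
    lower : ∀ s p q r → (s * p + ι 2) + (s * p + ι 2) + (s * r + ι 2) ≈ (ι 6 + s * (p - q)) + s * (p + q + r)
    lower = solve 4 (λ s p q r → (s :* p :+ # 2) :+ (s :* p :+ # 2) :+ (s :* r :+ # 2) := (# 6 :+ s :* (p :- q)) :+ s :* (p :+ q :+ r)) refl

  upper-bound : ∀ σ {p q r} → 0# < σ⟦ σ ⟧ * q + ι 2 → 0# < σ⟦ σ ⟧ * r + ι 2 → p + q + r ≈ 0# → 0# < ι 4 - σ⟦ σ ⟧ * p
  upper-bound σ {p} {q} {r} 0<q 0<r sum = <-resp refl
    (trans (identity σ⟦ σ ⟧ p q r) (trans (+-congˡ (trans (*-congˡ sum) (zeroʳ _))) (+-identityʳ _))) (0<q ⊕⊕ 0<r)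
    where
    identity : ∀ s p q r → (s * q + ι 2) + (s * r + ι 2) ≈ (ι 4 - s * p) + s * (p + q + r)
    identity = solve 4 (λ s p q r → (s :* q :+ # 2) :+ (s :* r :+ # 2) := (# 4 :- s :* p) :+ s :* (p :+ q :+ r)) refl

  two-integers : ∀ k i → fromℤ (k ℤ.- + 2) < fromℤ i → fromℤ i < fromℤ (k ℤ.+ + 1) → i ≡ k ℤ.- + 1 ⊎ i ≡ k
  two-integers k i p q = shift (classify (i ℤ.- k) lower upper)
    where
    lower : -[1+ 1 ] ℤ.< i ℤ.- k
    lower = fromℤ-reflects-< (0<-⇒< (<-resp refl (trans (identity (fromℤ i) (fromℤ k) (fromℤ (k ℤ.- + 2)) (fromℤ-- k (+ 2))) (+-congʳ (sym (fromℤ-- i k)))) (<⇒0<- p)))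
      where
      expand : ∀ i k → i - (k - ι 2) ≈ (i - k) - fromℤ -[1+ 1 ]
      expand = solve 2 (λ i k → i :- (k :- # 2) := (i :- k) :- con -[1+ 1 ]) refl
      identity : ∀ i k m → m ≈ k - fromℤ (+ 2) → i - m ≈ (i - k) - fromℤ -[1+ 1 ]
      identity i k m eq = trans (+-congˡ (-‿cong eq)) (expand i k)
    upper : i ℤ.- k ℤ.< + 1
    upper = fromℤ-reflects-< (0<-⇒< (<-resp refl (trans (identity (fromℤ i) (fromℤ k) (fromℤ (k ℤ.+ + 1)) (fromℤ-+ k (+ 1))) (+-congˡ (-‿cong (sym (fromℤ-- i k))))) (<⇒0<- q)))
      where
      expand : ∀ i k → (k + ι 1) - i ≈ fromℤ (+ 1) - (i - k)
      expand = solve 2 (λ i k → (k :+ # 1) :- i := # 1 :- (i :- k)) refl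
      identity : ∀ i k m → m ≈ k + fromℤ (+ 1) → m - i ≈ fromℤ (+ 1) - (i - k)
      identity i k m eq = trans (+-congʳ eq) (expand i k)
    classify : ∀ j → -[1+ 1 ] ℤ.< j → j ℤ.< + 1 → j ≡ -[1+ 0 ] ⊎ j ≡ + 0
    classify (+ 0) _ _ = inj₂ ≡.refl
    classify (+ suc n) _ (ℤ.+<+ (ℕ.s≤s ()))
    classify -[1+ 0 ] _ _ = inj₁ ≡.refl
    classify -[1+ suc n ] (ℤ.-<- (ℕ.s≤s ())) _
    back : ∀ {j} → i ℤ.- k ≡ j → i ≡ k ℤ.+ j
    back {j} eq = fromℤ-injective (trans (restore (fromℤ i) (fromℤ k)) (trans (+-congˡ (trans (sym (fromℤ-- i k)) (reflexive (≡.cong fromℤ eq)))) (sym (fromℤ-+ k j))))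
      where
      restore : ∀ i k → i ≈ k + (i - k)
      restore = solve 2 (λ i k → i := k :+ (i :- k)) refl
    shift : i ℤ.- k ≡ -[1+ 0 ] ⊎ i ℤ.- k ≡ + 0 → i ≡ k ℤ.- + 1 ⊎ i ≡ k
    shift (inj₁ eq) = inj₁ (back eq)
    shift (inj₂ eq) = inj₂ (≡.trans (back eq) (ℤ.+-identityʳ k))

  -- Each difference lies between -6 and 6 and σb between -2 and 4, so the row confines 15σm to the
  -- interval from -21 to 9. The summands 9 and 6 in the proof pad it to -30 and 15.
  row-integer : ∀ σ {d d′ b m} → (0# < ι 6 - d) × (0# < ι 6 + d) → (0# < ι 6 - d′) × (0# < ι 6 + d′) →
    0# < σ⟦ σ ⟧ * b + ι 2 → 0# < ι 4 - σ⟦ σ ⟧ * b → Row σ d d′ b m → m ≡ + 0 ⊎ m ≡ ℤ.- toℤ σ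
  row-integer pos {d} {d′} {b} {m} (d< , <d) (d′< , <d′) b> b< eq = swap (two-integers (+ 0) m
      (*-cancel-< (0<fromℕ 14) (0<-⇒< (<-resp refl (subtract (lower d d′ b (fromℤ m))) (0<fromℕ 8 ⊕⊕ d< ⊕⊕ <d′ ⊕⊕ b<))))
      (*-cancel-< (0<fromℕ 14) (0<-⇒< (<-resp refl (add (upper d d′ b (fromℤ m))) (0<fromℕ 5 ⊕⊕ <d ⊕⊕ d′< ⊕⊕ b>)))))
    where
    row-sum = (d - d′) + b + ι 5 * fromℤ (+ 1) + ι 15 * fromℤ m
    subtract : ∀ {x y} → x ≈ y - row-sum → x ≈ y
    subtract p = trans p (trans (+-congˡ (trans (-‿cong eq) (trans (sym (+-identityˡ _)) (-‿inverseʳ 0#)))) (+-identityʳ _))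
    add : ∀ {x y} → x ≈ y + row-sum → x ≈ y
    add p = trans p (trans (+-congˡ eq) (+-identityʳ _))
    lower : ∀ d d′ b m → ι 9 + (ι 6 - d) + (ι 6 + d′) + (ι 4 - fromℤ (+ 1) * b)
      ≈ (ι 15 * m - ι 15 * fromℤ -[1+ 1 ]) - ((d - d′) + b + ι 5 * fromℤ (+ 1) + ι 15 * m)
    lower = solve 4 (λ d d′ b m → # 9 :+ (# 6 :- d) :+ (# 6 :+ d′) :+ (# 4 :- # 1 :* b)
      := (# 15 :* m :- # 15 :* con -[1+ 1 ]) :- ((d :- d′) :+ b :+ # 5 :* # 1 :+ # 15 :* m)) refl
    upper : ∀ d d′ b m → ι 6 + (ι 6 + d) + (ι 6 - d′) + (fromℤ (+ 1) * b + ι 2)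
      ≈ (ι 15 * fromℤ (+ 1) - ι 15 * m) + ((d - d′) + b + ι 5 * fromℤ (+ 1) + ι 15 * m)
    upper = solve 4 (λ d d′ b m → # 6 :+ (# 6 :+ d) :+ (# 6 :- d′) :+ (# 1 :* b :+ # 2)
      := (# 15 :* # 1 :- # 15 :* m) :+ ((d :- d′) :+ b :+ # 5 :* # 1 :+ # 15 :* m)) refl
    swap : m ≡ -[1+ 0 ] ⊎ m ≡ + 0 → m ≡ + 0 ⊎ m ≡ -[1+ 0 ]
    swap (inj₁ p) = inj₂ p
    swap (inj₂ p) = inj₁ p
  row-integer neg {d} {d′} {b} {m} (d< , <d) (d′< , <d′) b> b< eq = two-integers (+ 1) m
      (*-cancel-< (0<fromℕ 14) (0<-⇒< (<-resp refl (subtract (lower d d′ b (fromℤ m))) (0<fromℕ 5 ⊕⊕ d< ⊕⊕ <d′ ⊕⊕ b>))))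
      (*-cancel-< (0<fromℕ 14) (0<-⇒< (<-resp refl (add (upper d d′ b (fromℤ m))) (0<fromℕ 8 ⊕⊕ <d ⊕⊕ d′< ⊕⊕ b<))))
    where
    row-sum = (d - d′) + b + ι 5 * fromℤ -[1+ 0 ] + ι 15 * fromℤ m
    subtract : ∀ {x y} → x ≈ y - row-sum → x ≈ y
    subtract p = trans p (trans (+-congˡ (trans (-‿cong eq) (trans (sym (+-identityˡ _)) (-‿inverseʳ 0#)))) (+-identityʳ _))
    add : ∀ {x y} → x ≈ y + row-sum → x ≈ y
    add p = trans p (trans (+-congˡ eq) (+-identityʳ _))
    lower : ∀ d d′ b m → ι 6 + (ι 6 - d) + (ι 6 + d′) + (fromℤ -[1+ 0 ] * b + ι 2)
      ≈ (ι 15 * m - ι 15 * fromℤ -[1+ 0 ]) - ((d - d′) + b + ι 5 * fromℤ -[1+ 0 ] + ι 15 * m)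
    lower = solve 4 (λ d d′ b m → # 6 :+ (# 6 :- d) :+ (# 6 :+ d′) :+ (con -[1+ 0 ] :* b :+ # 2)
      := (# 15 :* m :- # 15 :* con -[1+ 0 ]) :- ((d :- d′) :+ b :+ # 5 :* con -[1+ 0 ] :+ # 15 :* m)) refl
    upper : ∀ d d′ b m → ι 9 + (ι 6 + d) + (ι 6 - d′) + (ι 4 - fromℤ -[1+ 0 ] * b)
      ≈ (ι 15 * fromℤ (+ 2) - ι 15 * m) + ((d - d′) + b + ι 5 * fromℤ -[1+ 0 ] + ι 15 * m)
    upper = solve 4 (λ d d′ b m → # 9 :+ (# 6 :+ d) :+ (# 6 :- d′) :+ (# 4 :- con -[1+ 0 ] :* b)
      := (# 15 :* # 2 :- # 15 :* m) :+ ((d :- d′) :+ b :+ # 5 :* con -[1+ 0 ] :+ # 15 :* m)) refl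

  rotate-sum : ∀ {a b c} → a + b + c ≈ 0# → b + c + a ≈ 0#
  rotate-sum {a} {b} {c} p = trans (commute a b c) p
    where
    commute : ∀ a b c → b + c + a ≈ a + b + c
    commute = solve 3 (λ a b c → b :+ c :+ a := a :+ b :+ c) refl

  -- The total forces exactly one of the three integers to be -σ, and its position is the index of
  -- the spike.
  spike-choice : ∀ σ {m₀ m₁ m₂} → m₀ ≡ + 0 ⊎ m₀ ≡ ℤ.- toℤ σ → m₁ ≡ + 0 ⊎ m₁ ≡ ℤ.- toℤ σ → m₂ ≡ + 0 ⊎ m₂ ≡ ℤ.- toℤ σ →
    m₀ ℤ.+ m₁ ℤ.+ m₂ ≡ ℤ.- toℤ σ → ∃[ j ] ((toℤ σ ℤ.* Triple.t₀ (spike j) ≡ m₁ ℤ.- m₂) ×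
      (toℤ σ ℤ.* Triple.t₁ (spike j) ≡ m₂ ℤ.- m₀) × (toℤ σ ℤ.* Triple.t₂ (spike j) ≡ m₀ ℤ.- m₁))
  spike-choice pos (inj₂ ≡.refl) (inj₁ ≡.refl) (inj₁ ≡.refl) _ = zero , ≡.refl , ≡.refl , ≡.refl
  spike-choice neg (inj₂ ≡.refl) (inj₁ ≡.refl) (inj₁ ≡.refl) _ = zero , ≡.refl , ≡.refl , ≡.refl
  spike-choice pos (inj₁ ≡.refl) (inj₂ ≡.refl) (inj₁ ≡.refl) _ = suc zero , ≡.refl , ≡.refl , ≡.refl
  spike-choice neg (inj₁ ≡.refl) (inj₂ ≡.refl) (inj₁ ≡.refl) _ = suc zero , ≡.refl , ≡.refl , ≡.refl
  spike-choice pos (inj₁ ≡.refl) (inj₁ ≡.refl) (inj₂ ≡.refl) _ = suc (suc zero) , ≡.refl , ≡.refl , ≡.refl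
  spike-choice neg (inj₁ ≡.refl) (inj₁ ≡.refl) (inj₂ ≡.refl) _ = suc (suc zero) , ≡.refl , ≡.refl , ≡.refl
  spike-choice pos (inj₁ ≡.refl) (inj₁ ≡.refl) (inj₁ ≡.refl) ()
  spike-choice neg (inj₁ ≡.refl) (inj₁ ≡.refl) (inj₁ ≡.refl) ()
  spike-choice pos (inj₁ ≡.refl) (inj₂ ≡.refl) (inj₂ ≡.refl) ()
  spike-choice neg (inj₁ ≡.refl) (inj₂ ≡.refl) (inj₂ ≡.refl) ()
  spike-choice pos (inj₂ ≡.refl) (inj₁ ≡.refl) (inj₂ ≡.refl) ()
  spike-choice neg (inj₂ ≡.refl) (inj₁ ≡.refl) (inj₂ ≡.refl) ()
  spike-choice pos (inj₂ ≡.refl) (inj₂ ≡.refl) (inj₁ ≡.refl) ()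
  spike-choice neg (inj₂ ≡.refl) (inj₂ ≡.refl) (inj₁ ≡.refl) ()
  spike-choice pos (inj₂ ≡.refl) (inj₂ ≡.refl) (inj₂ ≡.refl) ()
  spike-choice neg (inj₂ ≡.refl) (inj₂ ≡.refl) (inj₂ ≡.refl) ()

  *-cancel-≈ : ∀ {L x y} → 0# < L → L * x ≈ L * y → x ≈ y
  *-cancel-≈ 0<L eq = antisym (*-cancel-≤ 0<L (≤-reflexive eq)) (*-cancel-≤ 0<L (≤-reflexive (sym eq)))

  -- In the sum of the rows the differences telescope and the middle triple vanishes, which leaves
  -- 15σ + 15(m₀ + m₁ + m₂) = 0.
  row-total : ∀ σ a₀ a₁ a₂ b₀ b₁ b₂ c₀ c₁ c₂ m₀ m₁ m₂ → b₀ + b₁ + b₂ ≈ 0# →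
    Row σ (c₁ - c₂) (a₁ - a₂) b₀ m₀ → Row σ (c₂ - c₀) (a₂ - a₀) b₁ m₁ → Row σ (c₀ - c₁) (a₀ - a₁) b₂ m₂ →
    m₀ ℤ.+ m₁ ℤ.+ m₂ ≡ ℤ.- toℤ σ
  row-total σ a₀ a₁ a₂ b₀ b₁ b₂ c₀ c₁ c₂ m₀ m₁ m₂ sum r₀ r₁ r₂ = fromℤ-injective
    (trans (trans (fromℤ-+ (m₀ ℤ.+ m₁) m₂) (+-congʳ (fromℤ-+ m₀ m₁)))
      (trans (*-cancel-≈ (0<fromℕ 14) total-rows) (sym (fromℤ-neg (toℤ σ)))))
    where
    isolate : ∀ {d b s m} → d + b + s + m ≈ 0# → m ≈ - (d + b + s)
    isolate {d} {b} {s} {m} p = trans (identity d b s m) (trans (+-congˡ p) (+-identityʳ _))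
      where
      identity : ∀ d b s m → m ≈ - (d + b + s) + (d + b + s + m)
      identity = solve 4 (λ d b s m → m := (:- (d :+ b :+ s)) :+ (d :+ b :+ s :+ m)) refl
    t = ι 5 * σ⟦ σ ⟧
    gather : ∀ a₀ a₁ a₂ b₀ b₁ b₂ c₀ c₁ c₂ t →
      - (((c₁ - c₂) - (a₁ - a₂)) + b₀ + t) + - (((c₂ - c₀) - (a₂ - a₀)) + b₁ + t) + - (((c₀ - c₁) - (a₀ - a₁)) + b₂ + t) ≈ - (b₀ + b₁ + b₂) + - (t + t + t)
    gather = solve 10 (λ a₀ a₁ a₂ b₀ b₁ b₂ c₀ c₁ c₂ t →
      :- (((c₁ :- c₂) :- (a₁ :- a₂)) :+ b₀ :+ t) :+ (:- (((c₂ :- c₀) :- (a₂ :- a₀)) :+ b₁ :+ t)) :+ (:- (((c₀ :- c₁) :- (a₀ :- a₁)) :+ b₂ :+ t)) := (:- (b₀ :+ b₁ :+ b₂)) :+ (:- (t :+ t :+ t))) refl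
    distribute : ∀ k x y z → k * (x + y + z) ≈ k * x + k * y + k * z
    distribute = solve 4 (λ k x y z → k :* (x :+ y :+ z) := k :* x :+ k :* y :+ k :* z) refl
    thrice : ∀ s → - 0# + - (ι 5 * s + ι 5 * s + ι 5 * s) ≈ ι 15 * - s
    thrice = solve 1 (λ s → (:- # 0) :+ (:- (# 5 :* s :+ # 5 :* s :+ # 5 :* s)) := # 15 :* (:- s)) refl
    total-rows : ι 15 * (fromℤ m₀ + fromℤ m₁ + fromℤ m₂) ≈ ι 15 * - σ⟦ σ ⟧
    total-rows = trans (distribute (ι 15) (fromℤ m₀) (fromℤ m₁) (fromℤ m₂))
      (trans (+-cong (+-cong (isolate r₀) (isolate r₁)) (isolate r₂))
      (trans (gather a₀ a₁ a₂ b₀ b₁ b₂ c₀ c₁ c₂ t) (trans (+-congʳ (-‿cong sum)) (thrice σ⟦ σ ⟧))))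

  -- (x₁ − x₂, x₂ − x₀, x₀ − x₁) determines a triple x of sum zero.
  step-equation : ∀ σ k {m m′} a₀ a₁ a₂ b₁ b₂ c₀ c₁ c₂ → toℤ σ ℤ.* k ≡ m ℤ.- m′ → a₀ + a₁ + a₂ ≈ 0# → c₀ + c₁ + c₂ ≈ 0# →
    Row σ (c₂ - c₀) (a₂ - a₀) b₁ m → Row σ (c₀ - c₁) (a₀ - a₁) b₂ m′ → StepEq pos σ k a₀ b₁ b₂ c₀ × StepEq neg σ k c₀ b₁ b₂ a₀
  step-equation σ k {m} {m′} a₀ a₁ a₂ b₁ b₂ c₀ c₁ c₂ k≡ suma sumc r₁ r₂ = forwards , backwards
    where
    t = ι 5 * σ⟦ σ ⟧
    p = ι 15 * fromℤ m
    p′ = ι 15 * fromℤ m′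
    D = ι 15 * (σ⟦ σ ⟧ * fromℤ k)
    D≈ : D ≈ p - p′
    D≈ = trans (*-congˡ (trans (sym (fromℤ-* (toℤ σ) k)) (trans (reflexive (≡.cong fromℤ k≡)) (fromℤ-- m m′)))) (distribute (ι 15) (fromℤ m) (fromℤ m′))
      where
      distribute : ∀ k x y → k * (x - y) ≈ k * x - k * y
      distribute = solve 3 (λ k x y → k :* (x :- y) := k :* x :- k :* y) refl
    identity : ∀ a₀ a₁ a₂ b₁ b₂ c₀ c₁ c₂ t p p′ → ι 3 * c₀ ≈ ι 3 * a₀ + fromℤ (+ 1) * ((p - p′) - (b₂ - b₁)) +
      ((((c₀ - c₁) - (a₀ - a₁)) + b₂ + t + p′) - (((c₂ - c₀) - (a₂ - a₀)) + b₁ + t + p) + ((c₀ + c₁ + c₂) - (a₀ + a₁ + a₂)))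
    identity = solve 11 (λ a₀ a₁ a₂ b₁ b₂ c₀ c₁ c₂ t p p′ → # 3 :* c₀ := # 3 :* a₀ :+ # 1 :* ((p :- p′) :- (b₂ :- b₁)) :+
      ((((c₀ :- c₁) :- (a₀ :- a₁)) :+ b₂ :+ t :+ p′) :- (((c₂ :- c₀) :- (a₂ :- a₀)) :+ b₁ :+ t :+ p) :+ ((c₀ :+ c₁ :+ c₂) :- (a₀ :+ a₁ :+ a₂)))) refl
    zeros : 0# - 0# + (0# - 0#) ≈ 0#
    zeros = solve 0 (# 0 :- # 0 :+ (# 0 :- # 0) := # 0) refl
    forwards : StepEq pos σ k a₀ b₁ b₂ c₀
    forwards = trans (identity a₀ a₁ a₂ b₁ b₂ c₀ c₁ c₂ t p p′)
      (trans (+-congˡ (trans (+-cong (+-cong r₂ (-‿cong r₁)) (+-cong sumc (-‿cong suma))) zeros))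
      (trans (+-identityʳ _) (+-congˡ (*-congˡ (+-congʳ (sym D≈))))))
    reverse : ∀ a E → ι 3 * a ≈ (ι 3 * a + fromℤ (+ 1) * E) + fromℤ -[1+ 0 ] * E
    reverse = solve 2 (λ a E → # 3 :* a := (# 3 :* a :+ # 1 :* E) :+ con -[1+ 0 ] :* E) refl
    backwards : StepEq neg σ k c₀ b₁ b₂ a₀
    backwards = trans (reverse a₀ (D - (b₂ - b₁))) (+-congʳ (sym forwards))

  -- One spike serves both directions: the equation contains the outer triples only through c - a,
  -- so solving for a instead of c just reverses a sign.
  link-step : ∀ {A B C} (LA : Lift A) (LB : Lift B) (LC : Lift C) → Link A B C →
    ∃[ j ] (Step pos j (Lift.σ LB) (Lift.e LA) (Lift.e LB) (Lift.e LC) × Step neg j (Lift.σ LB) (Lift.e LC) (Lift.e LB) (Lift.e LA))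
  link-step
    record { σ = σa ; e = ⟨ a₀ , a₁ , a₂ ⟩ ; n = ⟨ na₀ , na₁ , na₂ ⟩ ; positive = pa₀ , pa₁ , pa₂ ; balanced = suma ; eq₀ = ea₀ ; eq₁ = ea₁ ; eq₂ = ea₂ }
    record { σ = σb ; e = ⟨ b₀ , b₁ , b₂ ⟩ ; n = ⟨ nb₀ , nb₁ , nb₂ ⟩ ; positive = pb₀ , pb₁ , pb₂ ; balanced = sumb ; eq₀ = eb₀ ; eq₁ = eb₁ ; eq₂ = eb₂ }
    record { σ = σc ; e = ⟨ c₀ , c₁ , c₂ ⟩ ; n = ⟨ nc₀ , nc₁ , nc₂ ⟩ ; positive = pc₀ , pc₁ , pc₂ ; balanced = sumc ; eq₀ = ec₀ ; eq₁ = ec₁ ; eq₂ = ec₂ }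
    (z₀ , z₁ , z₂) = from-choice (spike-choice σb {m₀} {m₁} {m₂}
      (row-integer σb {c₁ - c₂} {a₁ - a₂} {b₀} {m₀} (difference-bound σc pc₁ pc₂ pc₀ (rotate-sum sumc)) (difference-bound σa pa₁ pa₂ pa₀ (rotate-sum suma)) pb₀ (upper-bound σb pb₁ pb₂ sumb) r₀)
      (row-integer σb {c₂ - c₀} {a₂ - a₀} {b₁} {m₁} (difference-bound σc pc₂ pc₀ pc₁ (rotate-sum (rotate-sum sumc))) (difference-bound σa pa₂ pa₀ pa₁ (rotate-sum (rotate-sum suma))) pb₁ (upper-bound σb pb₂ pb₀ (rotate-sum sumb)) r₁)
      (row-integer σb {c₀ - c₁} {a₀ - a₁} {b₂} {m₂} (difference-bound σc pc₀ pc₁ pc₂ sumc) (difference-bound σa pa₀ pa₁ pa₂ suma) pb₂ (upper-bound σb pb₀ pb₁ (rotate-sum (rotate-sum sumb))) r₂)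
      (row-total σb a₀ a₁ a₂ b₀ b₁ b₂ c₀ c₁ c₂ m₀ m₁ m₂ sumb r₀ r₁ r₂))
    where
    m₀ = (nc₁ ℤ.- nc₂) ℤ.- (na₁ ℤ.- na₂) ℤ.+ nb₀
    m₁ = (nc₂ ℤ.- nc₀) ℤ.- (na₂ ℤ.- na₀) ℤ.+ nb₁
    m₂ = (nc₀ ℤ.- nc₁) ℤ.- (na₀ ℤ.- na₁) ℤ.+ nb₂
    r₀ : Row σb (c₁ - c₂) (a₁ - a₂) b₀ m₀
    r₀ = row ea₁ ea₂ eb₀ ec₁ ec₂ z₀
    r₁ : Row σb (c₂ - c₀) (a₂ - a₀) b₁ m₁
    r₁ = row ea₂ ea₀ eb₁ ec₂ ec₀ z₁
    r₂ : Row σb (c₀ - c₁) (a₀ - a₁) b₂ m₂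
    r₂ = row ea₀ ea₁ eb₂ ec₀ ec₁ z₂
    from-choice : ∃[ j ] ((toℤ σb ℤ.* Triple.t₀ (spike j) ≡ m₁ ℤ.- m₂) × (toℤ σb ℤ.* Triple.t₁ (spike j) ≡ m₂ ℤ.- m₀) × (toℤ σb ℤ.* Triple.t₂ (spike j) ≡ m₀ ℤ.- m₁)) → _
    from-choice (j , k₀ , k₁ , k₂) =
      let s₀ , s₀′ = step-equation σb (Triple.t₀ (spike j)) {m₁} {m₂} a₀ a₁ a₂ b₁ b₂ c₀ c₁ c₂ k₀ suma sumc r₁ r₂
          s₁ , s₁′ = step-equation σb (Triple.t₁ (spike j)) {m₂} {m₀} a₁ a₂ a₀ b₂ b₀ c₁ c₂ c₀ k₁ (rotate-sum suma) (rotate-sum sumc) r₂ r₀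
          s₂ , s₂′ = step-equation σb (Triple.t₂ (spike j)) {m₀} {m₁} a₂ a₀ a₁ b₀ b₁ c₂ c₀ c₁ k₂ (rotate-sum (rotate-sum suma)) (rotate-sum (rotate-sum sumc)) r₀ r₁
      in j , (s₀ , s₁ , s₂) , (s₀′ , s₁′ , s₂′)

  -- Chains of fifteen triples

  record Chain : Set where
    field
      X     : ℕ → Triple Carrier
      -- As the bound is irrelevant, the lift at an index does not depend on the arithmetic that
      -- reached it, and consecutive steps of a run fit together definitionally.
      lifts : ∀ k → .(k ℕ.≤ 14) → Lift (X k)
      links : ∀ k → Link (X k) (X (suc k)) (X (suc (suc k)))

  module _ (chain : Chain) where
    open Chain chain
    open Lift

    private
      shift : ∀ {m k} → suc m ℕ.+ suc k ℕ.≤ 14 → m ℕ.+ suc (suc k) ℕ.≤ 14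
      shift {m} {k} p = ≡.subst (ℕ._≤ 14) (≡.sym (ℕ.+-suc m (suc k))) p

      bound₂ : ∀ {m k} → suc m ℕ.+ suc k ℕ.≤ 14 → suc (suc k) ℕ.≤ 14
      bound₂ {m} {k} p = ℕ.≤-trans (ℕ.s≤s (ℕ.m≤n+m (suc k) m)) p

      bound₁ : ∀ {m k} → m ℕ.+ suc k ℕ.≤ 14 → suc k ℕ.≤ 14
      bound₁ {m} {k} p = ℕ.≤-trans (ℕ.m≤n+m (suc k) m) p

      bound₀ : ∀ {k} → suc k ℕ.≤ 14 → k ℕ.≤ 14
      bound₀ {k} p = ℕ.≤-trans (ℕ.n≤1+n k) p

    rightRun : ∀ m k .(p : m ℕ.+ suc k ℕ.≤ 14) →
      Run pos m (e (lifts k (bound₀ (bound₁ {m} p)))) (σ (lifts (suc k) (bound₁ {m} p))) (e (lifts (suc k) (bound₁ {m} p)))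
    rightRun zero    k p = tt
    rightRun (suc m) k p =
      let a = lifts k (bound₀ (bound₁ {suc m} p))
          b = lifts (suc k) (bound₁ {suc m} p)
          c = lifts (suc (suc k)) (bound₂ {m} p)
          j , step , _ = link-step a b c (links k)
      in e c , σ c , j , positive c , step , rightRun m (suc k) (shift {m} p)

    leftRun : ∀ k .(p : suc k ℕ.≤ 14) → Run neg k (e (lifts (suc k) p)) (σ (lifts k (bound₀ p))) (e (lifts k (bound₀ p)))
    leftRun zero    p = tt
    leftRun (suc k) p =
      let a = lifts k (bound₀ (bound₀ p))
          b = lifts (suc k) (bound₀ p)
          c = lifts (suc (suc k)) p
          j , _ , step = link-step a b c (links k)
      in e a , σ a , j , positive a , step , leftRun k (bound₀ p)

  tree : Sign → Sign → Tree
  tree pos pos = tree⁺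
  tree pos neg = tree⁻
  tree neg neg = negateTree tree⁺
  tree neg pos = negateTree tree⁻

  hypotheses : Sign → Sign → List Form
  hypotheses σ₀ σ₁ = positivities 1 σ₁ neighbour (positivities 1 σ₀ centre [])

  -- All certificates are verified by evaluation. With the centre at index 7 and its neighbour at 8,
  -- six triples remain on the right and seven on the left.
  checks : ∀ σ₀ σ₁ → check σ₀ 6 7 (side 1 centre σ₁ neighbour) (side 1 neighbour σ₀ centre) (hypotheses σ₀ σ₁) (tree σ₀ σ₁) ≡ true
  checks pos pos = ≡.refl
  checks pos neg = ≡.refl
  checks neg neg = ≡.refl
  checks neg pos = ≡.refl

  runs⇒hexagon : ∀ {σ₀ σ₁} a b → Sum≈0 a → Sum≈0 b → Positive σ₀ a → Positive σ₁ b → Run pos 6 a σ₁ b → Run neg 7 b σ₀ a → Hexagon σ₀ a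
  runs⇒hexagon {σ₀} {σ₁} a@(⟨ a₀ , a₁ , a₂ ⟩) b@(⟨ b₀ , b₁ , b₂ ⟩) suma sumb pa pb =
    check-sound σ₀ a rep-a 6 7 (side 1 centre σ₁ neighbour) (side 1 neighbour σ₀ centre) (hypotheses σ₀ σ₁) (tree σ₀ σ₁) (checks σ₀ σ₁)
      (positivities-sound 1 σ₁ neighbour b (ℕ.s≤s ℕ.z≤n) rep-b pb (positivities-sound 1 σ₀ centre a (ℕ.s≤s ℕ.z≤n) rep-a pa []))
      (ℕ.s≤s ℕ.z≤n) (ℕ.s≤s ℕ.z≤n)
      (record { signs = ≡.refl ; previous = rep-a ; current = rep-b })
      (record { signs = ≡.refl ; previous = rep-b ; current = rep-a })
    where
    open Soundness a₀ a₁ b₀ b₁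
    one : ∀ x → ι 1 * x ≈ x
    one x = trans (*-congʳ fromℕ1≈1) (*-identityˡ x)
    drop : ∀ x u → 0# * x + u ≈ u
    drop x u = trans (+-congʳ (zeroˡ x)) (+-identityˡ u)
    keep : ∀ x {u} → u ≈ 0# → fromℤ (+ 1) * x + u ≈ x
    keep x p = trans (+-cong (one x) p) (+-identityʳ x)
    end : 0# * 1# + 0# ≈ 0#
    end = drop 1# 0#
    ⟦e₀⟧ : ⟦ e₀ ⟧ ≈ a₀
    ⟦e₀⟧ = keep a₀ (trans (drop a₁ _) (trans (drop b₀ _) (trans (drop b₁ _) end)))
    ⟦e₁⟧ : ⟦ e₁ ⟧ ≈ a₁
    ⟦e₁⟧ = trans (drop a₀ _) (keep a₁ (trans (drop b₀ _) (trans (drop b₁ _) end)))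
    ⟦e₂⟧ : ⟦ e₂ ⟧ ≈ b₀
    ⟦e₂⟧ = trans (drop a₀ _) (trans (drop a₁ _) (keep b₀ (trans (drop b₁ _) end)))
    ⟦e₃⟧ : ⟦ e₃ ⟧ ≈ b₁
    ⟦e₃⟧ = trans (drop a₀ _) (trans (drop a₁ _) (trans (drop b₀ _) (keep b₁ end)))
    third : ∀ {x y z u v} → x + y + z ≈ 0# → ⟦ u ⟧ ≈ x → ⟦ v ⟧ ≈ y → z ≈ ⟦ -[1+ 0 ] ⊡ (u ⊞ v) ⟧
    third {x} {y} {z} {u} {v} sum u≈ v≈ = trans (isolate x y z) (trans (+-cong sum refl) (trans (negate x y)
      (sym (trans (⟦⊡⟧ -[1+ 0 ] (u ⊞ v)) (*-congˡ (trans (⟦⊞⟧ u v) (+-cong u≈ v≈)))))))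
      where
      isolate : ∀ x y z → z ≈ (x + y + z) + - (x + y)
      isolate = solve 3 (λ x y z → z := (x :+ y :+ z) :+ (:- (x :+ y))) refl
      negate : ∀ x y → 0# + - (x + y) ≈ fromℤ -[1+ 0 ] * (x + y)
      negate = solve 2 (λ x y → # 0 :+ (:- (x :+ y)) := con -[1+ 0 ] :* (x :+ y)) refl
    rep-a : Represents 1 centre a
    rep-a = trans (one a₀) (sym ⟦e₀⟧) , trans (one a₁) (sym ⟦e₁⟧) , trans (one a₂) (third {u = e₀} {v = e₁} suma ⟦e₀⟧ ⟦e₁⟧)
    rep-b : Represents 1 neighbour b
    rep-b = trans (one b₀) (sym ⟦e₂⟧) , trans (one b₁) (sym ⟦e₃⟧) , trans (one b₂) (third {u = e₂} {v = e₃} sumb ⟦e₂⟧ ⟦e₃⟧)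

  chain⇒hexagon : (chain : Chain) → let L = Chain.lifts chain 7 (ℕ.m≤m+n 7 7) in Hexagon (Lift.σ L) (Lift.e L)
  chain⇒hexagon chain = runs⇒hexagon {Lift.σ a} {Lift.σ b} (Lift.e a) (Lift.e b) (Lift.balanced a) (Lift.balanced b) (Lift.positive a) (Lift.positive b)
      (rightRun chain 6 7 (ℕ.m≤m+n 14 0)) (leftRun chain 7 (ℕ.m≤m+n 8 6))
    where
    a = Chain.lifts chain 7 (ℕ.m≤m+n 7 7)
    b = Chain.lifts chain 8 (ℕ.m≤m+n 8 6)

  -- The contradiction between three chains

  -- ∣ v − 15 m ∣ < r / 15
  Within : Carrier → Carrier → ℕ → Set
  Within v m r = (0# < ι r - (ι 15 * v - ι 225 * m)) × (0# < ι r + (ι 15 * v - ι 225 * m))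

  σ² : ∀ σ → σ⟦ σ ⟧ * σ⟦ σ ⟧ ≈ ι 1
  σ² pos = solve 0 (# 1 :* # 1 := # 1) refl
  σ² neg = solve 0 (con -[1+ 0 ] :* con -[1+ 0 ] := # 1) refl

  within-by : ∀ σ r {v m} → 0# < ι r - σ⟦ σ ⟧ * (ι 15 * v - ι 225 * m) → 0# < ι r + σ⟦ σ ⟧ * (ι 15 * v - ι 225 * m) → Within v m r
  within-by σ r = unsign σ

  multiple : ∀ n {x} → 0# < x → 0# < ι (suc n) * x
  multiple n = *-pos (0<fromℕ n)

  -- The identities below hold only modulo σ² = 1 and the vanishing sum, which the solver cannot
  -- use; the required multiples of these relations are added explicitly.
  modulo : ∀ {E P k z w} → E ≈ P + k * (z - w) → z ≈ w → P ≈ E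
  modulo {E} {P} {k} {z} {w} eq z≈w = sym (trans eq (trans (+-congˡ (trans (*-congˡ (trans (+-congʳ z≈w) (-‿inverseʳ w))) (zeroʳ k))) (+-identityʳ P)))

  modulo₂ : ∀ {E P k z w l u} → E ≈ P + k * (z - w) + l * u → z ≈ w → u ≈ 0# → P ≈ E
  modulo₂ {l = l} eq z≈w u≈0 = modulo (trans eq (trans (+-congˡ (trans (*-congˡ u≈0) (zeroʳ l))) (+-identityʳ _))) z≈w

  module HexagonFacts (σ : Sign) {x y z : Carrier} (sum : x + y + z ≈ 0#) (hexagon : Hexagon′ σ ⟨ x , y , z ⟩) where
    private
      s = σ⟦ σ ⟧
      xy : 0# < ι 27 - ι 5 * (s * (x - y))
      xy = <⇒0<- (proj₁ hexagon)
      yx : 0# < - ι 21 - ι 10 * (s * (y - x))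
      yx = <⇒0<- (proj₁ (proj₂ hexagon))
      xz : 0# < ι 27 - ι 5 * (s * (x - z))
      xz = <⇒0<- (proj₁ (proj₂ (proj₂ hexagon)))
      zx : 0# < - ι 21 - ι 10 * (s * (z - x))
      zx = <⇒0<- (proj₁ (proj₂ (proj₂ (proj₂ hexagon))))
      yz : 0# < ι 7 - ι 5 * (s * (y - z))
      yz = <⇒0<- (proj₁ (proj₂ (proj₂ (proj₂ (proj₂ hexagon)))))
      zy : 0# < ι 7 - ι 5 * (s * (z - y))
      zy = <⇒0<- (proj₂ (proj₂ (proj₂ (proj₂ (proj₂ hexagon)))))

    -- The bounds for x - y and x - z add up to bounds for 3x: x is within 11/10 of 5σ/2, hence 4x +
    -- 20σ within 66/15 of 30σ.
    x-whole : Within (ι 4 * x + ι 20 * s) (ι 2 * s) 66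
    x-whole = within-by σ 66
      (<-resp refl (modulo₂ (upper s x y z) (σ² σ) sum) (multiple 3 (xy ⊕⊕ xz)))
      (<-resp refl (modulo₂ (lower s x y z) (σ² σ) sum) (multiple 1 (yx ⊕⊕ zx)))
      where
      upper : ∀ s x y z → ι 66 - s * (ι 15 * (ι 4 * x + ι 20 * s) - ι 225 * (ι 2 * s))
        ≈ ι 4 * ((ι 27 - ι 5 * (s * (x - y))) + (ι 27 - ι 5 * (s * (x - z)))) + ι 150 * (s * s - ι 1) + - (ι 20 * s) * (x + y + z)
      upper = solve 4 (λ s x y z → # 66 :- s :* (# 15 :* (# 4 :* x :+ # 20 :* s) :- # 225 :* (# 2 :* s))
        := # 4 :* ((# 27 :- # 5 :* (s :* (x :- y))) :+ (# 27 :- # 5 :* (s :* (x :- z)))) :+ # 150 :* (s :* s :- # 1) :+ (:- (# 20 :* s)) :* (x :+ y :+ z)) refl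
      lower : ∀ s x y z → ι 66 + s * (ι 15 * (ι 4 * x + ι 20 * s) - ι 225 * (ι 2 * s))
        ≈ ι 2 * ((- ι 21 - ι 10 * (s * (y - x))) + (- ι 21 - ι 10 * (s * (z - x)))) + - ι 150 * (s * s - ι 1) + (ι 20 * s) * (x + y + z)
      lower = solve 4 (λ s x y z → # 66 :+ s :* (# 15 :* (# 4 :* x :+ # 20 :* s) :- # 225 :* (# 2 :* s))
        := # 2 :* ((:- # 21 :- # 10 :* (s :* (y :- x))) :+ (:- # 21 :- # 10 :* (s :* (z :- x)))) :+ (:- # 150) :* (s :* s :- # 1) :+ (# 20 :* s) :* (x :+ y :+ z)) refl

    x-half : Within (ι 2 * x + ι 10 * s) s 33
    x-half = within-by σ 33
      (<-resp refl (modulo₂ (upper s x y z) (σ² σ) sum) (multiple 1 (xy ⊕⊕ xz)))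
      (<-resp refl (modulo₂ (lower s x y z) (σ² σ) sum) (yx ⊕⊕ zx))
      where
      upper : ∀ s x y z → ι 33 - s * (ι 15 * (ι 2 * x + ι 10 * s) - ι 225 * s)
        ≈ ι 2 * ((ι 27 - ι 5 * (s * (x - y))) + (ι 27 - ι 5 * (s * (x - z)))) + ι 75 * (s * s - ι 1) + - (ι 10 * s) * (x + y + z)
      upper = solve 4 (λ s x y z → # 33 :- s :* (# 15 :* (# 2 :* x :+ # 10 :* s) :- # 225 :* s)
        := # 2 :* ((# 27 :- # 5 :* (s :* (x :- y))) :+ (# 27 :- # 5 :* (s :* (x :- z)))) :+ # 75 :* (s :* s :- # 1) :+ (:- (# 10 :* s)) :* (x :+ y :+ z)) refl
      lower : ∀ s x y z → ι 33 + s * (ι 15 * (ι 2 * x + ι 10 * s) - ι 225 * s)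
        ≈ ((- ι 21 - ι 10 * (s * (y - x))) + (- ι 21 - ι 10 * (s * (z - x)))) + - ι 75 * (s * s - ι 1) + (ι 10 * s) * (x + y + z)
      lower = solve 4 (λ s x y z → # 33 :+ s :* (# 15 :* (# 2 :* x :+ # 10 :* s) :- # 225 :* s)
        := ((:- # 21 :- # 10 :* (s :* (y :- x))) :+ (:- # 21 :- # 10 :* (s :* (z :- x)))) :+ (:- # 75) :* (s :* s :- # 1) :+ (# 10 :* s) :* (x :+ y :+ z)) refl

    yz-whole : Within (ι 4 * (y - z)) 0# 84
    yz-whole = within-by σ 84
      (<-resp refl (upper s y z) (multiple 11 yz)) (<-resp refl (lower s y z) (multiple 11 zy))
      where
      upper : ∀ s y z → ι 12 * (ι 7 - ι 5 * (s * (y - z))) ≈ ι 84 - s * (ι 15 * (ι 4 * (y - z)) - ι 225 * 0#)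
      upper = solve 3 (λ s y z → # 12 :* (# 7 :- # 5 :* (s :* (y :- z))) := # 84 :- s :* (# 15 :* (# 4 :* (y :- z)) :- # 225 :* # 0)) refl
      lower : ∀ s y z → ι 12 * (ι 7 - ι 5 * (s * (z - y))) ≈ ι 84 + s * (ι 15 * (ι 4 * (y - z)) - ι 225 * 0#)
      lower = solve 3 (λ s y z → # 12 :* (# 7 :- # 5 :* (s :* (z :- y))) := # 84 :+ s :* (# 15 :* (# 4 :* (y :- z)) :- # 225 :* # 0)) refl

    yz-half : Within (ι 2 * (y - z)) 0# 42
    yz-half = within-by σ 42
      (<-resp refl (upper s y z) (multiple 5 yz)) (<-resp refl (lower s y z) (multiple 5 zy))
      where
      upper : ∀ s y z → ι 6 * (ι 7 - ι 5 * (s * (y - z))) ≈ ι 42 - s * (ι 15 * (ι 2 * (y - z)) - ι 225 * 0#)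
      upper = solve 3 (λ s y z → # 6 :* (# 7 :- # 5 :* (s :* (y :- z))) := # 42 :- s :* (# 15 :* (# 2 :* (y :- z)) :- # 225 :* # 0)) refl
      lower : ∀ s y z → ι 6 * (ι 7 - ι 5 * (s * (z - y))) ≈ ι 42 + s * (ι 15 * (ι 2 * (y - z)) - ι 225 * 0#)
      lower = solve 3 (λ s y z → # 6 :* (# 7 :- # 5 :* (s :* (z :- y))) := # 42 :+ s :* (# 15 :* (# 2 :* (y :- z)) :- # 225 :* # 0)) refl

    z-odd : Within (ι 4 * z + ι 20 * s) s 66
    z-odd = within-by σ 66
      -- The inequalities give radius 61; the extra 5 raises it to the 66 of `x-whole`, so that both
      -- kinds of triple share one radius.
      (<-resp refl (modulo₂ (upper s x y z) (σ² σ) sum) (0<fromℕ 4 ⊕⊕ multiple 1 (zx ⊕⊕ multiple 1 zy)))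
      (<-resp refl (modulo₂ (lower s x y z) (σ² σ) sum) (0<fromℕ 4 ⊕⊕ multiple 3 (xz ⊕⊕ yz)))
      where
      upper : ∀ s x y z → ι 66 - s * (ι 15 * (ι 4 * z + ι 20 * s) - ι 225 * s)
        ≈ (ι 5 + ι 2 * ((- ι 21 - ι 10 * (s * (z - x))) + ι 2 * (ι 7 - ι 5 * (s * (z - y))))) + - ι 75 * (s * s - ι 1) + - (ι 20 * s) * (x + y + z)
      upper = solve 4 (λ s x y z → # 66 :- s :* (# 15 :* (# 4 :* z :+ # 20 :* s) :- # 225 :* s)
        := (# 5 :+ # 2 :* ((:- # 21 :- # 10 :* (s :* (z :- x))) :+ # 2 :* (# 7 :- # 5 :* (s :* (z :- y))))) :+ (:- # 75) :* (s :* s :- # 1) :+ (:- (# 20 :* s)) :* (x :+ y :+ z)) refl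
      lower : ∀ s x y z → ι 66 + s * (ι 15 * (ι 4 * z + ι 20 * s) - ι 225 * s)
        ≈ (ι 5 + ι 4 * ((ι 27 - ι 5 * (s * (x - z))) + (ι 7 - ι 5 * (s * (y - z))))) + ι 75 * (s * s - ι 1) + (ι 20 * s) * (x + y + z)
      lower = solve 4 (λ s x y z → # 66 :+ s :* (# 15 :* (# 4 :* z :+ # 20 :* s) :- # 225 :* s)
        := (# 5 :+ # 4 :* ((# 27 :- # 5 :* (s :* (x :- z))) :+ (# 7 :- # 5 :* (s :* (y :- z))))) :+ # 75 :* (s :* s :- # 1) :+ (# 20 :* s) :* (x :+ y :+ z)) refl

    xy-odd : Within (ι 4 * (x - y)) s 99
    xy-odd = within-by σ 99
      (<-resp refl (modulo (upper s x y) (σ² σ)) (multiple 11 xy)) (<-resp refl (modulo (lower s x y) (σ² σ)) (multiple 5 yx))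
      where
      upper : ∀ s x y → ι 99 - s * (ι 15 * (ι 4 * (x - y)) - ι 225 * s) ≈ ι 12 * (ι 27 - ι 5 * (s * (x - y))) + ι 225 * (s * s - ι 1)
      upper = solve 3 (λ s x y → # 99 :- s :* (# 15 :* (# 4 :* (x :- y)) :- # 225 :* s) := # 12 :* (# 27 :- # 5 :* (s :* (x :- y))) :+ # 225 :* (s :* s :- # 1)) refl
      lower : ∀ s x y → ι 99 + s * (ι 15 * (ι 4 * (x - y)) - ι 225 * s) ≈ ι 6 * (- ι 21 - ι 10 * (s * (y - x))) + - ι 225 * (s * s - ι 1)
      lower = solve 3 (λ s x y → # 99 :+ s :* (# 15 :* (# 4 :* (x :- y)) :- # 225 :* s) := # 6 :* (:- # 21 :- # 10 :* (s :* (y :- x))) :+ (:- # 225) :* (s :* s :- # 1)) refl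

  hexagon-swap : ∀ σ {x y z} → Hexagon′ σ ⟨ x , y , z ⟩ → Hexagon′ σ ⟨ x , z , y ⟩
  hexagon-swap σ (xy , yx , xz , zx , yz , zy) = xz , zx , xy , yx , zy , yz

  Within-resp : ∀ {v v′ m m′} r → v ≈ v′ → m ≈ m′ → Within v m r → Within v′ m′ r
  Within-resp r v≈ m≈ (p , q) =
    <-resp refl (+-congˡ (-‿cong (+-cong (*-congˡ v≈) (-‿cong (*-congˡ m≈))))) p ,
    <-resp refl (+-congˡ (+-cong (*-congˡ v≈) (-‿cong (*-congˡ m≈)))) q

  Within-neg : ∀ {v m} r → Within v m r → Within (- v) (- m) r
  Within-neg {v} {m} r (p , q) = <-resp refl (upper (ι r) v m) q , <-resp refl (lower (ι r) v m) p
    where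
    upper : ∀ r v m → r + (ι 15 * v - ι 225 * m) ≈ r - (ι 15 * - v - ι 225 * - m)
    upper = solve 3 (λ r v m → r :+ (# 15 :* v :- # 225 :* m) := r :- (# 15 :* (:- v) :- # 225 :* (:- m))) refl
    lower : ∀ r v m → r - (ι 15 * v - ι 225 * m) ≈ r + (ι 15 * - v - ι 225 * - m)
    lower = solve 3 (λ r v m → r :- (# 15 :* v :- # 225 :* m) := r :+ (# 15 :* (:- v) :- # 225 :* (:- m))) refl

  -- Only the parity `κ` of the nearby multiple of 15 is kept, as its size depends on unknown
  -- integer parts.
  Parity : ℕ → Carrier → ℕ → Set
  Parity κ v r = ∃[ u ] Within v (fromℤ (+ κ ℤ.+ + 2 ℤ.* u)) r

  odd-sign : ∀ σ → ∃[ u ] (toℤ σ ≡ + 1 ℤ.+ + 2 ℤ.* u)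
  odd-sign pos = + 0 , ≡.refl
  odd-sign neg = -[1+ 0 ] , ≡.refl

  even-parity : ∀ σ {v} r → Within v (ι 2 * σ⟦ σ ⟧) r → Parity 0 v r
  even-parity σ r w = toℤ σ , Within-resp r refl (sym (trans (fromℤ-+ (+ 0) (+ 2 ℤ.* toℤ σ)) (trans (+-identityˡ _) (fromℤ-* (+ 2) (toℤ σ))))) w

  zero-parity : ∀ {v} r → Within v 0# r → Parity 0 v r
  zero-parity r w = + 0 , w

  odd-parity : ∀ σ {v} r → Within v σ⟦ σ ⟧ r → Parity 1 v r
  odd-parity σ r w = let u , eq = odd-sign σ in u , Within-resp r refl (reflexive (≡.cong fromℤ eq)) w

  neg-parity : ∀ σ {v} r → Within v σ⟦ σ ⟧ r → Parity 1 (- v) r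
  neg-parity σ r w = odd-parity (opposite σ) r (Within-resp r refl (trans (sym (fromℤ-neg (toℤ σ))) (reflexive (≡.cong fromℤ (opposite-toℤ σ)))) (Within-neg r w))
    where
    opposite-toℤ : ∀ σ → ℤ.- toℤ σ ≡ toℤ (opposite σ)
    opposite-toℤ pos = ≡.refl
    opposite-toℤ neg = ≡.refl

  no-integer : ∀ i → fromℤ -[1+ 0 ] < fromℤ i → fromℤ i < fromℤ (+ 0) → ⊥
  no-integer i p q = absurd i (fromℤ-reflects-< p) (fromℤ-reflects-< q)
    where
    absurd : ∀ i → -[1+ 0 ] ℤ.< i → i ℤ.< + 0 → ⊥
    absurd (+ n) _ (ℤ.+<+ ())
    absurd -[1+ n ] (ℤ.-<- ()) _

  -- An odd integer cannot be smaller than 1 in absolute value.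
  parity-clash : ∀ {κ₁ κ₂ κ₃ v₁ v₂ v₃} r₁ r₂ r₃ w (M : ℤ) → Parity κ₁ v₁ r₁ → Parity κ₂ v₂ r₂ → Parity κ₃ v₃ r₃ →
    r₁ ℕ.+ r₂ ℕ.+ r₃ ℕ.≤ 225 → κ₁ ℕ.+ κ₂ ℕ.+ κ₃ ≡ 1 ℕ.+ 2 ℕ.* w → v₁ + v₂ + v₃ + ι 30 * fromℤ M ≈ 0# → ⊥
  parity-clash {κ₁} {κ₂} {κ₃} {v₁} {v₂} {v₃} r₁ r₂ r₃ w M (u₁ , p₁ , q₁) (u₂ , p₂ , q₂) (u₃ , p₃ , q₃) r≤ κ≡ sum = no-integer U
      (*-cancel-< (0<fromℕ 449) (0<-⇒< (<-resp refl (trans upper (vanish⁺ _)) (slack ⊕< (p₁ ⊕⊕ p₂ ⊕⊕ p₃)))))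
      (*-cancel-< (0<fromℕ 449) (0<-⇒< (<-resp refl (trans lower (vanish⁻ _)) (slack ⊕< (q₁ ⊕⊕ q₂ ⊕⊕ q₃)))))
    where
    R = ι r₁ + ι r₂ + ι r₃
    slack : 0# ≤ ι 225 - R
    slack = ≤⇒0≤- (≤-respˡ-≈ (trans (fromℕ-+ (r₁ ℕ.+ r₂) r₃) (+-congʳ (fromℕ-+ r₁ r₂))) (fromℕ-mono r≤))
    -- Chosen so that 1 + 2U is the total multiple of 15, the 2M from the integer parts included.
    U = u₁ ℤ.+ u₂ ℤ.+ u₃ ℤ.+ M ℤ.+ + w
    U≈ : fromℤ U ≈ fromℤ u₁ + fromℤ u₂ + fromℤ u₃ + fromℤ M + ι w
    U≈ = trans (fromℤ-+ (u₁ ℤ.+ u₂ ℤ.+ u₃ ℤ.+ M) (+ w)) (+-congʳ (trans (fromℤ-+ (u₁ ℤ.+ u₂ ℤ.+ u₃) M) (+-congʳ (trans (fromℤ-+ (u₁ ℤ.+ u₂) u₃) (+-congʳ (fromℤ-+ u₁ u₂))))))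
    μ : ℕ → ℤ → Carrier
    μ κ u = fromℤ (+ κ ℤ.+ + 2 ℤ.* u)
    μ≈ : ∀ κ u → μ κ u ≈ ι κ + ι 2 * fromℤ u
    μ≈ κ u = trans (fromℤ-+ (+ κ) (+ 2 ℤ.* u)) (+-congˡ (fromℤ-* (+ 2) u))
    V = v₁ + v₂ + v₃
    S = μ κ₁ u₁ + μ κ₂ u₂ + μ κ₃ u₃
    κ≈ : ι κ₁ + ι κ₂ + ι κ₃ ≈ ι 1 + ι 2 * ι w
    κ≈ = trans (sym (trans (fromℕ-+ (κ₁ ℕ.+ κ₂) κ₃) (+-congʳ (fromℕ-+ κ₁ κ₂)))) (trans (reflexive (≡.cong ι κ≡)) (trans (fromℕ-+ 1 (2 ℕ.* w)) (+-congˡ (fromℕ-* 2 w))))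
    S≈ : S + ι 2 * fromℤ M ≈ ι 1 + ι 2 * fromℤ U
    S≈ = trans (+-congʳ (trans (+-cong (+-cong (μ≈ κ₁ u₁) (μ≈ κ₂ u₂)) (μ≈ κ₃ u₃)) (regroup (ι κ₁) (ι κ₂) (ι κ₃) (fromℤ u₁) (fromℤ u₂) (fromℤ u₃))))
      (trans (+-congʳ (+-congʳ κ≈)) (trans (collect (ι w) (fromℤ u₁ + fromℤ u₂ + fromℤ u₃) (fromℤ M)) (+-congˡ (*-congˡ (sym U≈)))))
      where
      regroup : ∀ a b c x y z → (a + ι 2 * x) + (b + ι 2 * y) + (c + ι 2 * z) ≈ (a + b + c) + ι 2 * (x + y + z)
      regroup = solve 6 (λ a b c x y z → (a :+ # 2 :* x) :+ (b :+ # 2 :* y) :+ (c :+ # 2 :* z) := (a :+ b :+ c) :+ # 2 :* (x :+ y :+ z)) refl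
      collect : ∀ w x m → ((ι 1 + ι 2 * w) + ι 2 * x) + ι 2 * m ≈ ι 1 + ι 2 * (x + m + w)
      collect = solve 3 (λ w x m → ((# 1 :+ # 2 :* w) :+ # 2 :* x) :+ # 2 :* m := # 1 :+ # 2 :* (x :+ m :+ w)) refl
    group : ∀ {v₁ v₂ v₃ m₁ m₂ m₃} → (ι 15 * v₁ - ι 225 * m₁) + (ι 15 * v₂ - ι 225 * m₂) + (ι 15 * v₃ - ι 225 * m₃)
      ≈ ι 15 * (v₁ + v₂ + v₃) - ι 225 * (m₁ + m₂ + m₃)
    group {v₁} {v₂} {v₃} {m₁} {m₂} {m₃} = solve 6 (λ v₁ v₂ v₃ m₁ m₂ m₃ → (# 15 :* v₁ :- # 225 :* m₁) :+ (# 15 :* v₂ :- # 225 :* m₂) :+ (# 15 :* v₃ :- # 225 :* m₃)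
      := # 15 :* (v₁ :+ v₂ :+ v₃) :- # 225 :* (m₁ :+ m₂ :+ m₃)) refl v₁ v₂ v₃ m₁ m₂ m₃
    W₁ = ι 15 * v₁ - ι 225 * μ κ₁ u₁
    W₂ = ι 15 * v₂ - ι 225 * μ κ₂ u₂
    W₃ = ι 15 * v₃ - ι 225 * μ κ₃ u₃
    W≈ : W₁ + W₂ + W₃ ≈ - (ι 225 * (ι 1 + ι 2 * fromℤ U))
    W≈ = trans (group {v₁} {v₂} {v₃} {μ κ₁ u₁} {μ κ₂ u₂} {μ κ₃ u₃}) (trans (substitute V S (fromℤ M)) (trans (+-cong (trans (*-congˡ sum) (zeroʳ _)) (-‿cong (*-congˡ S≈))) (+-identityˡ _)))
      where
      substitute : ∀ V S M → ι 15 * V - ι 225 * S ≈ ι 15 * (V + ι 30 * M) - ι 225 * (S + ι 2 * M)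
      substitute = solve 3 (λ V S M → # 15 :* V :- # 225 :* S := # 15 :* (V :+ # 30 :* M) :- # 225 :* (S :+ # 2 :* M)) refl
    D = - (ι 225 * (ι 1 + ι 2 * fromℤ U))
    vanish⁺ : ∀ z → z + (D - (W₁ + W₂ + W₃)) ≈ z
    vanish⁺ z = trans (+-congˡ (trans (+-congˡ (-‿cong W≈)) (-‿inverseʳ D))) (+-identityʳ z)
    vanish⁻ : ∀ z → z + ((W₁ + W₂ + W₃) - D) ≈ z
    vanish⁻ z = trans (+-congˡ (trans (+-congʳ W≈) (-‿inverseʳ D))) (+-identityʳ z)
    upper : (ι 225 - R) + ((ι r₁ - W₁) + (ι r₂ - W₂) + (ι r₃ - W₃)) ≈ (ι 450 * fromℤ U - ι 450 * fromℤ -[1+ 0 ]) + (D - (W₁ + W₂ + W₃))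
    upper = identity (ι r₁) (ι r₂) (ι r₃) W₁ W₂ W₃ (fromℤ U)
      where
      identity : ∀ a b c x y z u → (ι 225 - (a + b + c)) + ((a - x) + (b - y) + (c - z)) ≈ (ι 450 * u - ι 450 * fromℤ -[1+ 0 ]) + (- (ι 225 * (ι 1 + ι 2 * u)) - (x + y + z))
      identity = solve 7 (λ a b c x y z u → (# 225 :- (a :+ b :+ c)) :+ ((a :- x) :+ (b :- y) :+ (c :- z)) := (# 450 :* u :- # 450 :* con -[1+ 0 ]) :+ ((:- (# 225 :* (# 1 :+ # 2 :* u))) :- (x :+ y :+ z))) refl
    lower : (ι 225 - R) + ((ι r₁ + W₁) + (ι r₂ + W₂) + (ι r₃ + W₃)) ≈ (ι 450 * fromℤ (+ 0) - ι 450 * fromℤ U) + ((W₁ + W₂ + W₃) - D)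
    lower = identity (ι r₁) (ι r₂) (ι r₃) W₁ W₂ W₃ (fromℤ U)
      where
      identity : ∀ a b c x y z u → (ι 225 - (a + b + c)) + ((a + x) + (b + y) + (c + z)) ≈ (ι 450 * fromℤ (+ 0) - ι 450 * u) + ((x + y + z) - - (ι 225 * (ι 1 + ι 2 * u)))
      identity = solve 7 (λ a b c x y z u → (# 225 :- (a :+ b :+ c)) :+ ((a :+ x) :+ (b :+ y) :+ (c :+ z)) := (# 450 :* # 0 :- # 450 :* u) :+ ((x :+ y :+ z) :- (:- (# 225 :* (# 1 :+ # 2 :* u))))) refl

  -- Row 0 compared with the other two rows. `κ` is 0 if the entry near a half stands in row 0, and
  -- 1 otherwise; it governs the entry and the difference alike.
  record Kind (κ r : ℕ) (σ : Sign) (a : Triple Carrier) : Set where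
    field
      entry      : Parity κ (ι 4 * Triple.t₀ a + ι 20 * σ⟦ σ ⟧) 66
      difference : Parity κ (ι 4 * (Triple.t₁ a - Triple.t₂ a)) r

  kind : ∀ σ a h → Sum≈0 a → Hexagon′ σ (rotate h a) → Kind 0 84 σ a ⊎ Kind 1 99 σ a
  kind σ ⟨ a₀ , a₁ , a₂ ⟩ zero sum hexagon = inj₁ (record
    { entry = even-parity σ 66 (HexagonFacts.x-whole σ sum hexagon) ; difference = zero-parity 84 (HexagonFacts.yz-whole σ sum hexagon) })
  kind σ ⟨ a₀ , a₁ , a₂ ⟩ (suc zero) sum hexagon = inj₂ (record
    { entry = odd-parity σ 66 (HexagonFacts.z-odd σ (rotate-sum sum) hexagon) ; difference = odd-parity σ 99 (HexagonFacts.xy-odd σ (rotate-sum sum) hexagon) })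
  kind σ ⟨ a₀ , a₁ , a₂ ⟩ (suc (suc zero)) sum hexagon = inj₂ (record
    { entry = odd-parity σ 66 (HexagonFacts.z-odd σ reversed (hexagon-swap σ hexagon))
    ; difference = let u , w = neg-parity σ 99 (HexagonFacts.xy-odd σ reversed (hexagon-swap σ hexagon)) in u , Within-resp 99 (flip a₁ a₂) refl w })
    where
    reversed : a₂ + a₁ + a₀ ≈ 0#
    reversed = trans (solve 3 (λ x y z → z :+ y :+ x := x :+ y :+ z) refl a₀ a₁ a₂) sum
    flip : ∀ x y → - (ι 4 * (y - x)) ≈ ι 4 * (x - y)
    flip = solve 2 (λ x y → :- (# 4 :* (y :- x)) := # 4 :* (x :- y)) refl

  -- The relation 2η² + 2 + η = 0, row by row.
  Balance : (a b c : Triple Carrier) → Set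
  Balance ⟨ a₀ , a₁ , a₂ ⟩ ⟨ b₀ , b₁ , b₂ ⟩ ⟨ c₀ , c₁ , c₂ ⟩ =
    (ι 2 * a₀ + ι 2 * b₀ + c₀ ≈ 0#) × (ι 2 * a₁ + ι 2 * b₁ + c₁ ≈ 0#) × (ι 2 * a₂ + ι 2 * b₂ + c₂ ≈ 0#)

  -- The relation is multiplied by 30 rather than 15: near half-integers then become near odd
  -- multiples of 15, and the integer parts contribute even ones.
  balance-row : ∀ {σa σb σc a b c ea eb ec na nb nc} → LiftEq σa a ea na → LiftEq σb b eb nb → LiftEq σc c ec nc →
    ι 2 * a + ι 2 * b + c ≈ 0# →
    (ι 4 * ea + ι 20 * σ⟦ σa ⟧) + (ι 4 * eb + ι 20 * σ⟦ σb ⟧) + (ι 2 * ec + ι 10 * σ⟦ σc ⟧)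
      + ι 30 * fromℤ (+ 2 ℤ.* na ℤ.+ + 2 ℤ.* nb ℤ.+ nc) ≈ 0#
  balance-row {σa} {σb} {σc} {a} {b} {c} {ea} {eb} {ec} {na} {nb} {nc} (lifted pa) (lifted pb) (lifted pc) eq =
    trans (+-congˡ (*-congˡ n≈)) (trans (identity ea eb ec σ⟦ σa ⟧ σ⟦ σb ⟧ σ⟦ σc ⟧ (fromℤ na) (fromℤ nb) (fromℤ nc))
      (trans (+-cong (+-cong (*-congˡ (sym pa)) (*-congˡ (sym pb))) (*-congˡ (sym pc)))
      (trans (factor a b c) (trans (*-congˡ eq) (zeroʳ _)))))
    where
    n≈ : fromℤ (+ 2 ℤ.* na ℤ.+ + 2 ℤ.* nb ℤ.+ nc) ≈ ι 2 * fromℤ na + ι 2 * fromℤ nb + fromℤ nc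
    n≈ = trans (fromℤ-+ (+ 2 ℤ.* na ℤ.+ + 2 ℤ.* nb) nc) (+-congʳ (trans (fromℤ-+ (+ 2 ℤ.* na) (+ 2 ℤ.* nb)) (+-cong (fromℤ-* (+ 2) na) (fromℤ-* (+ 2) nb))))
    identity : ∀ ea eb ec sa sb sc na nb nc →
      (ι 4 * ea + ι 20 * sa) + (ι 4 * eb + ι 20 * sb) + (ι 2 * ec + ι 10 * sc) + ι 30 * (ι 2 * na + ι 2 * nb + nc)
      ≈ ι 4 * (ea + ι 5 * sa + ι 15 * na) + ι 4 * (eb + ι 5 * sb + ι 15 * nb) + ι 2 * (ec + ι 5 * sc + ι 15 * nc)
    identity = solve 9 (λ ea eb ec sa sb sc na nb nc →
      (# 4 :* ea :+ # 20 :* sa) :+ (# 4 :* eb :+ # 20 :* sb) :+ (# 2 :* ec :+ # 10 :* sc) :+ # 30 :* (# 2 :* na :+ # 2 :* nb :+ nc)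
      := # 4 :* (ea :+ # 5 :* sa :+ # 15 :* na) :+ # 4 :* (eb :+ # 5 :* sb :+ # 15 :* nb) :+ # 2 :* (ec :+ # 5 :* sc :+ # 15 :* nc)) refl
    factor : ∀ a b c → ι 4 * (ι 15 * a) + ι 4 * (ι 15 * b) + ι 2 * (ι 15 * c) ≈ ι 30 * (ι 2 * a + ι 2 * b + c)
    factor = solve 3 (λ a b c → # 4 :* (# 15 :* a) :+ # 4 :* (# 15 :* b) :+ # 2 :* (# 15 :* c) := # 30 :* (# 2 :* a :+ # 2 :* b :+ c)) refl

  -- In the row where C is near 1/2, either this row or the difference of the other two sums to nearly a half-integer.
  clash₀ : ∀ {A B C} (LA : Lift A) (LB : Lift B) (LC : Lift C) → Balance A B C →
    Hexagon (Lift.σ LA) (Lift.e LA) → Hexagon (Lift.σ LB) (Lift.e LB) → Hexagon′ (Lift.σ LC) (Lift.e LC) → ⊥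
  clash₀ LA LB LC (z₀ , z₁ , z₂) (ha , hexa) (hb , hexb) hexc = dispatch (kind σa ea ha (Lift.balanced LA) hexa) (kind σb eb hb (Lift.balanced LB) hexb)
    where
    σa = Lift.σ LA
    σb = Lift.σ LB
    σc = Lift.σ LC
    ea = Lift.e LA
    eb = Lift.e LB
    ec = Lift.e LC
    m : ℤ → ℤ → ℤ → ℤ
    m na nb nc = + 2 ℤ.* na ℤ.+ + 2 ℤ.* nb ℤ.+ nc
    open Triple
    m₀ = m (t₀ (Lift.n LA)) (t₀ (Lift.n LB)) (t₀ (Lift.n LC))
    m₁ = m (t₁ (Lift.n LA)) (t₁ (Lift.n LB)) (t₁ (Lift.n LC))
    m₂ = m (t₂ (Lift.n LA)) (t₂ (Lift.n LB)) (t₂ (Lift.n LC))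
    row₀ = balance-row (Lift.eq₀ LA) (Lift.eq₀ LB) (Lift.eq₀ LC) z₀
    row₁ = balance-row (Lift.eq₁ LA) (Lift.eq₁ LB) (Lift.eq₁ LC) z₁
    row₂ = balance-row (Lift.eq₂ LA) (Lift.eq₂ LB) (Lift.eq₂ LC) z₂
    row₁₂ : ι 4 * (t₁ ea - t₂ ea) + ι 4 * (t₁ eb - t₂ eb) + ι 2 * (t₁ ec - t₂ ec) + ι 30 * fromℤ (m₁ ℤ.- m₂) ≈ 0#
    row₁₂ = trans (+-congˡ (*-congˡ (fromℤ-- m₁ m₂)))
      (trans (identity (t₁ ea) (t₂ ea) (t₁ eb) (t₂ eb) (t₁ ec) (t₂ ec) (ι 20 * σ⟦ σa ⟧) (ι 20 * σ⟦ σb ⟧) (ι 10 * σ⟦ σc ⟧) (fromℤ m₁) (fromℤ m₂))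
      (trans (+-cong row₁ (-‿cong row₂)) (-‿inverseʳ 0#)))
      where
      identity : ∀ a a′ b b′ c c′ sa sb sc n n′ → ι 4 * (a - a′) + ι 4 * (b - b′) + ι 2 * (c - c′) + ι 30 * (n - n′) ≈
        ((ι 4 * a + sa) + (ι 4 * b + sb) + (ι 2 * c + sc) + ι 30 * n) - ((ι 4 * a′ + sa) + (ι 4 * b′ + sb) + (ι 2 * c′ + sc) + ι 30 * n′)
      identity = solve 11 (λ a a′ b b′ c c′ sa sb sc n n′ → # 4 :* (a :- a′) :+ # 4 :* (b :- b′) :+ # 2 :* (c :- c′) :+ # 30 :* (n :- n′) :=
        ((# 4 :* a :+ sa) :+ (# 4 :* b :+ sb) :+ (# 2 :* c :+ sc) :+ # 30 :* n) :- ((# 4 :* a′ :+ sa) :+ (# 4 :* b′ :+ sb) :+ (# 2 :* c′ :+ sc) :+ # 30 :* n′)) refl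
    entryC : Parity 1 (ι 2 * t₀ ec + ι 10 * σ⟦ σc ⟧) 33
    entryC = odd-parity σc 33 (HexagonFacts.x-half σc (Lift.balanced LC) hexc)
    differenceC : Parity 0 (ι 2 * (t₁ ec - t₂ ec)) 42
    differenceC = zero-parity 42 (HexagonFacts.yz-half σc (Lift.balanced LC) hexc)
    dispatch : Kind 0 84 σa ea ⊎ Kind 1 99 σa ea → Kind 0 84 σb eb ⊎ Kind 1 99 σb eb → ⊥
    dispatch (inj₁ ka) (inj₁ kb) = parity-clash 66 66 33 0 m₀ (Kind.entry ka) (Kind.entry kb) entryC (ℕ.m≤m+n 165 60) ≡.refl row₀
    dispatch (inj₂ ka) (inj₂ kb) = parity-clash 66 66 33 1 m₀ (Kind.entry ka) (Kind.entry kb) entryC (ℕ.m≤m+n 165 60) ≡.refl row₀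
    -- For different kinds the entries have an even total and give nothing, but the differences do.
    -- Here 84 + 99 + 42 is exactly 225, so the sides of the hexagon leave no slack.
    dispatch (inj₁ ka) (inj₂ kb) = parity-clash 84 99 42 0 (m₁ ℤ.- m₂) (Kind.difference ka) (Kind.difference kb) differenceC ℕ.≤-refl ≡.refl row₁₂
    dispatch (inj₂ ka) (inj₁ kb) = parity-clash 99 84 42 0 (m₁ ℤ.- m₂) (Kind.difference ka) (Kind.difference kb) differenceC ℕ.≤-refl ≡.refl row₁₂

  rotateLift : ∀ {X} → Lift X → Lift (rotate (suc zero) X)
  rotateLift L = record
    { σ = σ ; e = rotate (suc zero) e ; n = rotate (suc zero) n ; positive = proj₁ (proj₂ positive) , proj₂ (proj₂ positive) , proj₁ positive
    ; balanced = rotate-sum balanced ; eq₀ = eq₁ ; eq₁ = eq₂ ; eq₂ = eq₀ }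
    where open Lift L

  rotateHexagon : ∀ σ e → Hexagon σ e → Hexagon σ (rotate (suc zero) e)
  rotateHexagon σ e (zero , hexagon)           = suc (suc zero) , hexagon
  rotateHexagon σ e (suc zero , hexagon)       = zero , hexagon
  rotateHexagon σ e (suc (suc zero) , hexagon) = suc zero , hexagon

  -- A simultaneous cyclic shift of the three triples brings the entry of C near a half into row 0.
  clash : ∀ {A B C} (LA : Lift A) (LB : Lift B) (LC : Lift C) → Balance A B C →
    Hexagon (Lift.σ LA) (Lift.e LA) → Hexagon (Lift.σ LB) (Lift.e LB) → Hexagon (Lift.σ LC) (Lift.e LC) → ⊥
  clash LA LB LC z hexa hexb (zero , hexc) = clash₀ LA LB LC z hexa hexb hexc
  clash LA LB LC (z₀ , z₁ , z₂) hexa hexb (suc zero , hexc) =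
    clash₀ (rotateLift LA) (rotateLift LB) (rotateLift LC) (z₁ , z₂ , z₀) (rotateHexagon (Lift.σ LA) (Lift.e LA) hexa) (rotateHexagon (Lift.σ LB) (Lift.e LB) hexb) hexc
  clash LA LB LC (z₀ , z₁ , z₂) hexa hexb (suc (suc zero) , hexc) =
    clash₀ (rotateLift (rotateLift LA)) (rotateLift (rotateLift LB)) (rotateLift (rotateLift LC)) (z₂ , z₀ , z₁)
      (rotateHexagon (Lift.σ LA) _ (rotateHexagon (Lift.σ LA) (Lift.e LA) hexa)) (rotateHexagon (Lift.σ LB) _ (rotateHexagon (Lift.σ LB) (Lift.e LB) hexb)) hexc

  -- The directions

  infixr 7 _⋆_
  _⋆_ : ℝ² → ℝ² → ℝ²
  (a , b) ⋆ (c , d) = a * c - b * d , a * d + b * c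

  ⋆-unit : ∀ z w → IsUnit z → IsUnit w → IsUnit (z ⋆ w)
  ⋆-unit (a , b) (c , d) unit unit′ = trans (identity a b c d) (trans (*-cong unit unit′) (*-identityʳ 1#))
    where
    identity : ∀ a b c d → (a * c - b * d) * (a * c - b * d) + (a * d + b * c) * (a * d + b * c) ≈ (a * a + b * b) * (c * c + d * d)
    identity = solve 4 (λ a b c d → (a :* c :- b :* d) :* (a :* c :- b :* d) :+ (a :* d :+ b :* c) :* (a :* d :+ b :* c) := (a :* a :+ b :* b) :* (c :* c :+ d :* d)) refl

  -- The inner product with the direction turned by a right angle. Together with `dot` it makes a
  -- rotation of the direction act linearly on two numbers.
  cross : ℝ² → ℝ² → Carrier
  cross q (c , s) = dot q (- s , c)

  dot-⋆ : ∀ q z w → dot q (z ⋆ w) ≈ proj₁ z * dot q w + proj₂ z * cross q w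
  dot-⋆ (x , y) (a , b) (c , d) = solve 6 (λ x y a b c d → (a :* c :- b :* d) :* x :+ (a :* d :+ b :* c) :* y := a :* (c :* x :+ d :* y) :+ b :* ((:- d) :* x :+ c :* y)) refl x y a b c d

  cross-⋆ : ∀ q z w → cross q (z ⋆ w) ≈ proj₁ z * cross q w - proj₂ z * dot q w
  cross-⋆ (x , y) (a , b) (c , d) = solve 6 (λ x y a b c d → (:- (a :* d :+ b :* c)) :* x :+ (a :* c :- b :* d) :* y := a :* ((:- d) :* x :+ c :* y) :- b :* (c :* x :+ d :* y)) refl x y a b c d

  unrotate : ∀ {c s x y x′ y′} → c * c + s * s ≈ 1# → x′ ≈ c * x + s * y → y′ ≈ c * y - s * x → (x ≈ c * x′ - s * y′) × (y ≈ c * y′ + s * x′)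
  unrotate {c} {s} {x} {y} {x′} {y′} unit x′≈ y′≈ =
    trans (sym (*-identityˡ x)) (trans (*-congʳ (sym unit)) (trans (fst c s x y) (+-cong (*-congˡ (sym x′≈)) (-‿cong (*-congˡ (sym y′≈)))))) ,
    trans (sym (*-identityˡ y)) (trans (*-congʳ (sym unit)) (trans (snd c s x y) (+-cong (*-congˡ (sym y′≈)) (*-congˡ (sym x′≈)))))
    where
    fst : ∀ c s x y → (c * c + s * s) * x ≈ c * (c * x + s * y) - s * (c * y - s * x)
    fst = solve 4 (λ c s x y → (c :* c :+ s :* s) :* x := c :* (c :* x :+ s :* y) :- s :* (c :* y :- s :* x)) refl
    snd : ∀ c s x y → (c * c + s * s) * y ≈ c * (c * y - s * x) + s * (c * x + s * y)
    snd = solve 4 (λ c s x y → (c :* c :+ s :* s) :* y := c :* (c :* y :- s :* x) :+ s :* (c :* x :+ s :* y)) refl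

  reciprocal : ∀ n → ι (suc n) * ι (suc n) ⁻¹ ≈ 1#
  reciprocal n = ⁻¹-inverseʳ _ λ eq → proj₂ (0<fromℕ n) (sym eq)

  reciprocal≤1 : ∀ n → ι (suc n) ⁻¹ ≤ 1#
  reciprocal≤1 n = *-cancel-≤ (0<fromℕ n) (≤-resp (trans fromℕ1≈1 (sym (reciprocal n))) (sym (*-identityʳ _)) (fromℕ-mono {1} {suc n} (ℕ.s≤s ℕ.z≤n)))

  1≤4 : 1# ≤ ι 4
  1≤4 = ≤-resp fromℕ1≈1 refl (fromℕ-mono {1} {4} (ℕ.s≤s ℕ.z≤n))

  sqrt-complement : ∀ a → 0# ≤ a → a ≤ 1# → ∃[ x ] (x * x ≈ 1# - a)
  sqrt-complement a 0≤a a≤1 = sqrt (1# - a) (≤⇒0≤- a≤1) (≤-trans (≤-by 0≤a (solve 2 (λ o a → o := (o :- a) :+ a) refl 1# a)) 1≤4)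

  -- ω = −1/2 + 3ti, ζ = b + ti, η = −1/4 + ei
  abstract
   t-root : ∃[ t ] (t * t ≈ ι 12 ⁻¹)
   t-root = sqrt (ι 12 ⁻¹) (<⇒≤ (inverse-pos (0<fromℕ 11))) (≤-trans (reciprocal≤1 11) 1≤4)

  t : Carrier
  t = proj₁ t-root

  12t²≈1 : ι 12 * (t * t) ≈ 1#
  12t²≈1 = trans (*-congˡ (proj₂ t-root)) (reciprocal 11)

  abstract
   b-root : ∃[ b ] (b * b ≈ 1# - t * t)
   b-root = sqrt-complement (t * t) (0≤x² t) (≤-respˡ-≈ (sym (proj₂ t-root)) (reciprocal≤1 11))

   e-root : ∃[ e ] (e * e ≈ 1# - ι 4 ⁻¹ * ι 4 ⁻¹)
   e-root = sqrt-complement (ι 4 ⁻¹ * ι 4 ⁻¹) (0≤x² _) (≤-trans (*-monoˡ-≤ 0≤g (reciprocal≤1 3)) (≤-trans (≤-reflexive (*-identityʳ _)) (reciprocal≤1 3)))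
    where
    0≤g : 0# ≤ ι 4 ⁻¹
    0≤g = <⇒≤ (inverse-pos (0<fromℕ 3))

  g b e : Carrier
  g = ι 4 ⁻¹
  b = proj₁ b-root
  e = proj₁ e-root

  ω ω̄ ζ η : ℝ²
  ω = - half , ι 3 * t
  ω̄ = - half , - (ι 3 * t)
  ζ = b , t
  η = - g , e

  2half≈1 : ι 2 * half ≈ 1#
  2half≈1 = reciprocal 1

  ζ-unit : IsUnit ζ
  ζ-unit = trans (+-congʳ (proj₂ b-root)) (solve 2 (λ o x → (o :- x) :+ x := o) refl 1# (t * t))

  η-unit : IsUnit η
  η-unit = trans (+-congˡ (proj₂ e-root)) (solve 2 (λ o g → (:- g) :* (:- g) :+ (o :- g :* g) := o) refl 1# g)

  ω-unit : IsUnit ω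
  ω-unit = *-cancel-≈ (0<fromℕ 3) (trans (expand half t) (trans (+-cong (*-cong 2half≈1 2half≈1) (*-congˡ 12t²≈1)) ending))
    where
    expand : ∀ h t → ι 4 * (- h * - h + (ι 3 * t) * (ι 3 * t)) ≈ (ι 2 * h) * (ι 2 * h) + ι 3 * (ι 12 * (t * t))
    expand = solve 2 (λ h t → # 4 :* ((:- h) :* (:- h) :+ (# 3 :* t) :* (# 3 :* t)) := (# 2 :* h) :* (# 2 :* h) :+ # 3 :* (# 12 :* (t :* t))) refl
    ending : 1# * 1# + ι 3 * 1# ≈ ι 4 * 1#
    ending = trans (+-congʳ (*-cong refl (sym fromℕ1≈1) ⟨≈⟩ *-comm 1# (ι 1))) (solve 1 (λ o → # 1 :* o :+ # 3 :* o := # 4 :* o) refl 1#)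
      where
      _⟨≈⟩_ : ∀ {a b c} → a ≈ b → b ≈ c → a ≈ c
      _⟨≈⟩_ = trans

  ω̄-unit : IsUnit ω̄
  ω̄-unit = trans (+-congˡ (solve 1 (λ x → (:- x) :* (:- x) := x :* x) refl (ι 3 * t))) ω-unit

  -- The number ζᵏ ηˡ. The powers of ζ are outermost, so that a step along a chain is definitional
  -- for every l; relations between different l are proved at k = 0 and carried along.
  lattice : ℕ → ℕ → ℝ²
  lattice zero    zero    = 1# , 0#
  lattice zero    (suc l) = η ⋆ lattice zero l
  lattice (suc k) l       = ζ ⋆ lattice k l

  lattice-unit : ∀ k l → IsUnit (lattice k l)
  lattice-unit zero    zero    = trans (+-cong (*-identityˡ 1#) (zeroˡ 0#)) (+-identityʳ 1#)
  lattice-unit zero    (suc l) = ⋆-unit η (lattice zero l) η-unit (lattice-unit zero l)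
  lattice-unit (suc k) l       = ⋆-unit ζ (lattice k l) ζ-unit (lattice-unit k l)

  direction : ℕ → ℕ → Fin 3 → ℝ²
  direction k l zero             = lattice k l
  direction k l (suc zero)       = ω ⋆ lattice k l
  direction k l (suc (suc zero)) = ω̄ ⋆ lattice k l

  direction-unit : ∀ k l i → IsUnit (direction k l i)
  direction-unit k l zero             = lattice-unit k l
  direction-unit k l (suc zero)       = ⋆-unit ω (lattice k l) ω-unit (lattice-unit k l)
  direction-unit k l (suc (suc zero)) = ⋆-unit ω̄ (lattice k l) ω̄-unit (lattice-unit k l)

  -- The values of a point in the chosen directions

  module Values (q : ℝ²) where

    X : ℕ → ℕ → Triple Carrier
    X k l = ⟨ dot q (direction k l zero) , dot q (direction k l (suc zero)) , dot q (direction k l (suc (suc zero))) ⟩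

    module _ (k l : ℕ) where
      A B : Carrier
      A = dot q (lattice k l)
      B = cross q (lattice k l)

      X₁≈ : Triple.t₁ (X k l) ≈ - half * A + (ι 3 * t) * B
      X₁≈ = dot-⋆ q ω (lattice k l)

      X₂≈ : Triple.t₂ (X k l) ≈ - half * A + - (ι 3 * t) * B
      X₂≈ = dot-⋆ q ω̄ (lattice k l)

      X-sum : Sum≈0 (X k l)
      X-sum = trans (+-cong (+-congˡ X₁≈) X₂≈) (trans (collect A half (ι 3 * t) B) (trans (+-congˡ (-‿cong (trans (*-congʳ 2half≈1) (*-identityˡ A)))) (-‿inverseʳ A)))
        where
        collect : ∀ A h s B → A + (- h * A + s * B) + (- h * A + - s * B) ≈ A - (ι 2 * h) * A
        collect = solve 4 (λ A h s B → A :+ ((:- h) :* A :+ s :* B) :+ ((:- h) :* A :+ (:- s) :* B) := A :- (# 2 :* h) :* A) refl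

    module _ (k l : ℕ) where
      private
        A₀ = A k l
        B₀ = B k l
        A₁ = A (suc k) l
        B₁ = B (suc k) l
        A₂ = A (suc (suc k)) l
        B₂ = B (suc (suc k)) l
        back = unrotate {b} {t} {A₀} {B₀} {A₁} {B₁} ζ-unit (dot-⋆ q ζ (lattice k l)) (cross-⋆ q ζ (lattice k l))

        -- The neighbours in the chain arise from the middle direction by ζ and by its conjugate,
        -- and ζ minus its conjugate is 2ti.
        A-gap : A₂ - A₀ ≈ ι 2 * (t * B₁)
        A-gap = trans (+-cong (dot-⋆ q ζ (lattice (suc k) l)) (-‿cong (proj₁ back)))
          (solve 4 (λ b t A B → (b :* A :+ t :* B) :- (b :* A :- t :* B) := # 2 :* (t :* B)) refl b t A₁ B₁)

        B-gap : B₂ - B₀ ≈ - (ι 2 * (t * A₁))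
        B-gap = trans (+-cong (cross-⋆ q ζ (lattice (suc k) l)) (-‿cong (proj₂ back)))
          (solve 4 (λ b t A B → (b :* B :- t :* A) :- (b :* B :+ t :* A) := :- (# 2 :* (t :* A))) refl b t A₁ B₁)

        half-12t² : ∀ A → (ι 6 * (t * t) - half) * A ≈ 0#
        half-12t² A = trans (*-congʳ (trans (+-congʳ six) (-‿inverseʳ half))) (zeroˡ A)
          where
          six : ι 6 * (t * t) ≈ half
          six = trans (sym (*-identityˡ _)) (trans (*-congʳ (sym 2half≈1)) (trans (identity half (t * t)) (trans (*-congˡ 12t²≈1) (*-identityʳ half))))
            where
            identity : ∀ h u → (ι 2 * h) * (ι 6 * u) ≈ h * (ι 12 * u)
            identity = solve 2 (λ h u → (# 2 :* h) :* (# 6 :* u) := h :* (# 12 :* u)) refl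

        1-2half : ∀ x → (ι 1 - ι 2 * half) * x ≈ 0#
        1-2half x = trans (*-congʳ (trans (+-cong fromℕ1≈1 (-‿cong 2half≈1)) (-‿inverseʳ 1#))) (zeroˡ x)

        1-12t² : ∀ x → (ι 1 - ι 12 * (t * t)) * x ≈ 0#
        1-12t² x = trans (*-congʳ (trans (+-cong fromℕ1≈1 (-‿cong 12t²≈1)) (-‿inverseʳ 1#))) (zeroˡ x)

      -- After the gaps are inserted, every row is a combination of the middle values whose
      -- coefficients vanish by 12t² = 1 and 2 · `half` = 1.
      X-link : Link (X k l) (X (suc k) l) (X (suc (suc k)) l)
      X-link =
        trans (+-congʳ (+-cong (+-cong (X₁≈ (suc (suc k)) l) (-‿cong (X₂≈ (suc (suc k)) l))) (-‿cong (+-cong (X₁≈ k l) (-‿cong (X₂≈ k l))))))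
          (trans (first half t A₀ B₀ A₂ B₂ A₁) (trans (+-congʳ (*-congˡ B-gap)) (trans (first′ t A₁) (1-12t² A₁)))) ,
        trans (+-cong (+-cong (+-congʳ (X₂≈ (suc (suc k)) l)) (-‿cong (+-congʳ (X₂≈ k l)))) (X₁≈ (suc k) l))
          (trans (second half t A₀ B₀ A₂ B₂ A₁ B₁) (trans (+-congʳ (+-cong (*-congˡ A-gap) (*-congˡ B-gap)))
            (trans (second′ half t A₁ B₁) (trans (+-cong (1-2half (t * B₁)) (half-12t² A₁)) (+-identityʳ 0#))))) ,
        trans (+-cong (+-cong (+-congˡ (-‿cong (X₁≈ (suc (suc k)) l))) (-‿cong (+-congˡ (-‿cong (X₁≈ k l))))) (X₂≈ (suc k) l))
          (trans (third′ half t A₀ B₀ A₂ B₂ A₁ B₁) (trans (+-congʳ (+-cong (*-congˡ A-gap) (*-congˡ B-gap)))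
            (trans (third″ half t A₁ B₁) (trans (+-cong (1-2half (- (t * B₁))) (half-12t² A₁)) (+-identityʳ 0#)))))
        where
        first : ∀ h t a b a″ b″ a′ → ((- h * a″ + (ι 3 * t) * b″) - (- h * a″ + - (ι 3 * t) * b″)) - ((- h * a + (ι 3 * t) * b) - (- h * a + - (ι 3 * t) * b)) + a′
          ≈ (ι 6 * t) * (b″ - b) + a′
        first = solve 7 (λ h t a b a″ b″ a′ → (((:- h) :* a″ :+ (# 3 :* t) :* b″) :- ((:- h) :* a″ :+ (:- (# 3 :* t)) :* b″)) :- (((:- h) :* a :+ (# 3 :* t) :* b) :- ((:- h) :* a :+ (:- (# 3 :* t)) :* b)) :+ a′
          := (# 6 :* t) :* (b″ :- b) :+ a′) refl
        first′ : ∀ t a → (ι 6 * t) * - (ι 2 * (t * a)) + a ≈ (ι 1 - ι 12 * (t * t)) * a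
        first′ = solve 2 (λ t a → (# 6 :* t) :* (:- (# 2 :* (t :* a))) :+ a := (# 1 :- # 12 :* (t :* t)) :* a) refl
        second : ∀ h t a b a″ b″ a′ b′ → ((- h * a″ + - (ι 3 * t) * b″) - a″) - ((- h * a + - (ι 3 * t) * b) - a) + (- h * a′ + (ι 3 * t) * b′)
          ≈ - (ι 1 + h) * (a″ - a) + - (ι 3 * t) * (b″ - b) + (- h * a′ + (ι 3 * t) * b′)
        second = solve 8 (λ h t a b a″ b″ a′ b′ → (((:- h) :* a″ :+ (:- (# 3 :* t)) :* b″) :- a″) :- (((:- h) :* a :+ (:- (# 3 :* t)) :* b) :- a) :+ ((:- h) :* a′ :+ (# 3 :* t) :* b′)
          := (:- (# 1 :+ h)) :* (a″ :- a) :+ (:- (# 3 :* t)) :* (b″ :- b) :+ ((:- h) :* a′ :+ (# 3 :* t) :* b′)) refl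
        second′ : ∀ h t a b → - (ι 1 + h) * (ι 2 * (t * b)) + - (ι 3 * t) * - (ι 2 * (t * a)) + (- h * a + (ι 3 * t) * b)
          ≈ (ι 1 - ι 2 * h) * (t * b) + (ι 6 * (t * t) - h) * a
        second′ = solve 4 (λ h t a b → (:- (# 1 :+ h)) :* (# 2 :* (t :* b)) :+ (:- (# 3 :* t)) :* (:- (# 2 :* (t :* a))) :+ ((:- h) :* a :+ (# 3 :* t) :* b)
          := (# 1 :- # 2 :* h) :* (t :* b) :+ (# 6 :* (t :* t) :- h) :* a) refl
        third′ : ∀ h t a b a″ b″ a′ b′ → (a″ - (- h * a″ + (ι 3 * t) * b″)) - (a - (- h * a + (ι 3 * t) * b)) + (- h * a′ + - (ι 3 * t) * b′)
          ≈ (ι 1 + h) * (a″ - a) + - (ι 3 * t) * (b″ - b) + (- h * a′ + - (ι 3 * t) * b′)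
        third′ = solve 8 (λ h t a b a″ b″ a′ b′ → (a″ :- ((:- h) :* a″ :+ (# 3 :* t) :* b″)) :- (a :- ((:- h) :* a :+ (# 3 :* t) :* b)) :+ ((:- h) :* a′ :+ (:- (# 3 :* t)) :* b′)
          := (# 1 :+ h) :* (a″ :- a) :+ (:- (# 3 :* t)) :* (b″ :- b) :+ ((:- h) :* a′ :+ (:- (# 3 :* t)) :* b′)) refl
        third″ : ∀ h t a b → (ι 1 + h) * (ι 2 * (t * b)) + - (ι 3 * t) * - (ι 2 * (t * a)) + (- h * a + - (ι 3 * t) * b)
          ≈ (ι 1 - ι 2 * h) * - (t * b) + (ι 6 * (t * t) - h) * a
        third″ = solve 4 (λ h t a b → (# 1 :+ h) :* (# 2 :* (t :* b)) :+ (:- (# 3 :* t)) :* (:- (# 2 :* (t :* a))) :+ ((:- h) :* a :+ (:- (# 3 :* t)) :* b)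
          := (# 1 :- # 2 :* h) :* (:- (t :* b)) :+ (# 6 :* (t :* t) :- h) :* a) refl

    combine-balance : ∀ {c s u v w x y z u′ v′ w′} → ι 2 * u + ι 2 * v + w ≈ 0# → ι 2 * x + ι 2 * y + z ≈ 0# →
      u′ ≈ c * u + s * x → v′ ≈ c * v + s * y → w′ ≈ c * w + s * z → ι 2 * u′ + ι 2 * v′ + w′ ≈ 0#
    combine-balance {c} {s} {u} {v} {w} {x} {y} {z} p r u≈ v≈ w≈ = trans (+-cong (+-cong (*-congˡ u≈) (*-congˡ v≈)) w≈)
      (trans (regroup c s u v w x y z) (trans (+-cong (trans (*-congˡ p) (zeroʳ c)) (trans (*-congˡ r) (zeroʳ s))) (+-identityʳ 0#)))
      where
      regroup : ∀ c s u v w x y z → ι 2 * (c * u + s * x) + ι 2 * (c * v + s * y) + (c * w + s * z) ≈ c * (ι 2 * u + ι 2 * v + w) + s * (ι 2 * x + ι 2 * y + z)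
      regroup = solve 8 (λ c s u v w x y z → # 2 :* (c :* u :+ s :* x) :+ # 2 :* (c :* v :+ s :* y) :+ (c :* w :+ s :* z) := c :* (# 2 :* u :+ # 2 :* v :+ w) :+ s :* (# 2 :* x :+ # 2 :* y :+ z)) refl

    -- At k = 0 it is the sum of η and its conjugate being -1/2. Multiplication by ζ mixes the A and
    -- B values linearly and so preserves the pair of relations.
    AB-balance : ∀ k → (ι 2 * A k 2 + ι 2 * A k 0 + A k 1 ≈ 0#) × (ι 2 * B k 2 + ι 2 * B k 0 + B k 1 ≈ 0#)
    AB-balance zero =
      trans (+-congʳ (+-cong (*-congˡ (dot-⋆ q η (lattice 0 1))) (*-congˡ (proj₁ back)))) (trans (cosine-part g e (A 0 1) (B 0 1)) (trans (*-congʳ 1-4g) (zeroˡ _))) ,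
      trans (+-congʳ (+-cong (*-congˡ (cross-⋆ q η (lattice 0 1))) (*-congˡ (proj₂ back)))) (trans (sine-part g e (A 0 1) (B 0 1)) (trans (*-congʳ 1-4g) (zeroˡ _)))
      where
      back = unrotate { - g} {e} {A 0 0} {B 0 0} {A 0 1} {B 0 1} η-unit (dot-⋆ q η (lattice 0 0)) (cross-⋆ q η (lattice 0 0))
      1-4g : ι 1 - ι 4 * g ≈ 0#
      1-4g = trans (+-cong fromℕ1≈1 (-‿cong (reciprocal 3))) (-‿inverseʳ 1#)
      cosine-part : ∀ g e a b → ι 2 * (- g * a + e * b) + ι 2 * (- g * a - e * b) + a ≈ (ι 1 - ι 4 * g) * a
      cosine-part = solve 4 (λ g e a b → # 2 :* ((:- g) :* a :+ e :* b) :+ # 2 :* ((:- g) :* a :- e :* b) :+ a := (# 1 :- # 4 :* g) :* a) refl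
      sine-part : ∀ g e a b → ι 2 * (- g * b - e * a) + ι 2 * (- g * b + e * a) + b ≈ (ι 1 - ι 4 * g) * b
      sine-part = solve 4 (λ g e a b → # 2 :* ((:- g) :* b :- e :* a) :+ # 2 :* ((:- g) :* b :+ e :* a) :+ b := (# 1 :- # 4 :* g) :* b) refl
    AB-balance (suc k) = let p , r = AB-balance k in
      combine-balance {b} {t} p r (dot-⋆ q ζ (lattice k 2)) (dot-⋆ q ζ (lattice k 0)) (dot-⋆ q ζ (lattice k 1)) ,
      combine-balance {b} { - t} r p (cross-ζ 2) (cross-ζ 0) (cross-ζ 1)
      where
      cross-ζ : ∀ l → B (suc k) l ≈ b * B k l + - t * A k l
      cross-ζ l = trans (cross-⋆ q ζ (lattice k l)) (solve 4 (λ b t x y → b :* y :- t :* x := b :* y :+ (:- t) :* x) refl b t (A k l) (B k l))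

    X-balance : ∀ k → Balance (X k 2) (X k 0) (X k 1)
    X-balance k = proj₁ (AB-balance k) ,
      combine-balance { - half} {ι 3 * t} (proj₁ (AB-balance k)) (proj₂ (AB-balance k)) (X₁≈ k 2) (X₁≈ k 0) (X₁≈ k 1) ,
      combine-balance { - half} { - (ι 3 * t)} (proj₁ (AB-balance k)) (proj₂ (AB-balance k)) (X₂≈ k 2) (X₂≈ k 0) (X₂≈ k 1)

    module _ (far : ∀ k → .(k ℕ.< 15) → ∀ (l i : Fin 3) → Far (dot q (direction k (toℕ l) i))) where

      chain : Fin 3 → Chain
      chain l = record
        { X     = λ k → X k (toℕ l)
        ; lifts = λ k k≤14 → lift (X k (toℕ l)) (X-sum k (toℕ l))
                    (far k (ℕ.s≤s k≤14) l zero) (far k (ℕ.s≤s k≤14) l (suc zero)) (far k (ℕ.s≤s k≤14) l (suc (suc zero)))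
        ; links = λ k → X-link k (toℕ l) }

      not-all-far : ⊥
      -- The chains of η² and 1 carry the coefficient 2, the chain of η the coefficient 1; hence
      -- this order.
      not-all-far = clash (centre-lift (suc (suc zero))) (centre-lift zero) (centre-lift (suc zero)) (X-balance 7)
        (chain⇒hexagon (chain (suc (suc zero)))) (chain⇒hexagon (chain zero)) (chain⇒hexagon (chain (suc zero)))
        where
        centre-lift : ∀ l → Lift (X 7 (toℕ l))
        centre-lift l = Chain.lifts (chain l) 7 (ℕ.m≤m+n 7 7)

  -- Enumeration of the 135 directions and conclusion

  directionAt : Fin 15 → Fin 3 × Fin 3 → ℝ²
  directionAt k (l , i) = direction (toℕ k) (toℕ l) i

  directionOf : Fin 15 × Fin 9 → ℝ²
  directionOf (k , li) = directionAt k (Fin.remQuot {3} 3 li)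

  directions : Fin 135 → ℝ²
  directions j = directionOf (Fin.remQuot {15} 9 j)

  directions-combine : ∀ k .(k<15 : k ℕ.< 15) l i → directions (Fin.combine (Fin.fromℕ< k<15) (Fin.combine l i)) ≡ direction k (toℕ l) i
  directions-combine k k<15 l i =
    ≡.trans (≡.cong directionOf (Fin.remQuot-combine {15} {9} (Fin.fromℕ< k<15) (Fin.combine l i)))
    (≡.trans (≡.cong (directionAt (Fin.fromℕ< k<15)) (Fin.remQuot-combine {3} {3} l i))
      (≡.cong (λ k → direction k (toℕ l) i) (Fin.toℕ-fromℕ< k<15)))

  directions-unit : ∀ j → IsUnit (directions j)
  directions-unit j = let k , li = Fin.remQuot {15} 9 j
                          l , i = Fin.remQuot {3} 3 li
                      in direction-unit (toℕ k) (toℕ l) i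

  directions-dense : ∀ q → ¬ (∀ j i → ¬ (dot q (directions j) - fromℤ i ∈± fifth))
  directions-dense q far = Values.not-all-far q λ k k<15 l i n near →
    far (Fin.combine (Fin.fromℕ< k<15) (Fin.combine l i)) n
      (≡.subst (λ u → dot q u - fromℤ n ∈± fifth) (≡.sym (directions-combine k k<15 l i)) near)

  2fifth≤1 : fifth + fifth ≤ ι 1
  2fifth≤1 = ≤-trans (≤-by (0≤fromℕ 3 ⊛ <⇒≤ (inverse-pos (0<fromℕ 4))) (split fifth)) (≤-reflexive (trans 5*fifth (sym fromℕ1≈1)))
    where
    split : ∀ x → ι 5 * x ≈ (x + x) + ι 3 * x
    split = solve 1 (λ x → # 5 :* x := (x :+ x) :+ # 3 :* x) refl

  fifth-property : FiniteRotationProperty fifth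
  fifth-property = finiteRotationProperty 134 directions directions-unit (inverse-pos (0<fromℕ 4)) 2fifth≤1 directions-dense

corollary4p5 : ExcludedMiddle 0ℓ → (ℝ : RealNumbers) →
    let open RealNumbers ℝ in let open Rotations ℝ in
    ∃[ ε₀ ] (IsInfimum _≤_ FiniteRotationProperty ε₀ × ε₀ ≤ fromℕ 5 ⁻¹)
corollary4p5 em ℝ = infimum fifth-property
  where open Proof em ℝ
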